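{- Let $\rho$ and $\sigma$ be odd partitions with no part equal to $1$. Then for every integer $n\ge0$, $$\mathbb{E}_n[\mathfrak{p}_\rho\mathfrak{p}_\sigma]=\delta_{\rho,\sigma}\,2^{|\rho|-\ell(\rho)}z_\rho\,n^{\downarrow|\rho|}.$$
   Context: Partitions are finite weakly decreasing sequences of positive integers; $\ell$ = length, $|\cdot|$ = size; strict = distinct parts, odd = all parts odd; $\mathcal{SP}_k,\mathcal{OP}_k$ the strict/odd partitions of $k$. $x^{\downarrow k}=x(x-1)\cdots(x-k+1)$, $x^{\downarrow0}=1$. Shifted diagram $S(\lambda)=\{(i,j):1\le i\le\ell(\lambda),\ i\le j\le\lambda_i+i-1\}$; $g^\lambda$ = number of chains $\emptyset=\lambda^{(0)},\dots,\lambda^{(|\lambda|)}=\lambda$ of strict partitions each obtained from the previous by adding one box to the shifted diagram. $\mathbb{E}_n[\varphi]=\sum_{\lambda\in\mathcal{SP}_n}\frac{2^{n-\ell(\lambda)}(g^\lambda)^2}{n!}\varphi(\lambda)$. $p_r=\sum_ix_i^r$; $\Gamma$ = $\mathbb{Q}$-algebra generated by $p_1,p_3,\dots$; for $f\in\Gamma$, $f(\lambda)=f(\lambda_1,\dots,\lambda_{\ell(\lambda)},0,\dots)$. For $\rho\in\mathcal{OP}$: $p_\rho=\prod_ip_{\rho_i}$, $z_\rho=\prod_rr^{m_r(\rho)}m_r(\rho)!$ ($m_r$ = multiplicity of $r$); scalar product $\langle p_\rho,p_\sigma\rangle=2^{ -\ell(\rho)}z_\rho\delta_{\rho\sigma}$.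 For strict $\lambda$ of length $l$, $P_\lambda(x_1,\dots,x_N)=\frac1{(N-l)!}\sum_{\omega\in S_N}\omega\big(x_1^{\lambda_1}\cdots x_l^{\lambda_l}\prod_{1\le i\le l,\,i<j\le N}\frac{x_i+x_j}{x_i-x_j}\big)$ ($N\ge l$; zero if $N<l$), $Q_\lambda=2^{\ell(\lambda)}P_\lambda$, and $P^*_\lambda$ is the same formula with $x_i^{\lambda_i}$ replaced by $x_i^{\downarrow\lambda_i}$. $X^\lambda_\rho=\langle p_\rho,Q_\lambda\rangle$, and $\mathfrak{p}_\rho=\sum_{\lambda\in\mathcal{SP}_{|\rho|}}X^\lambda_\rho P^*_\lambda\in\Gamma$ ($\mathfrak p_\emptyset=1$). -}

module Defs where

open import Data.Nat as ℕ using (ℕ; zero; suc; _∸_; _≤ᵇ_; _<ᵇ_)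
open import Data.Nat using (_!)
open import Data.Integer using (+_)
open import Data.Rational using (ℚ; 0ℚ; 1ℚ; _+_; _*_; _-_; 1/_; _/_; ≢-nonZero)
open import Data.Rational.Properties using (_≟_)
open import Data.List using (List; []; _∷_; _++_; map; foldr; length; concatMap; upTo; filter)
open import Data.List.Properties using (≡-dec)
open import Data.Bool using (Bool; true; false; if_then_else_; _∧_)
open import Relation.Nullary using (yes; no)
open import Relation.Binary.PropositionalEquality using (_≡_)

ℕ→ℚ : ℕ → ℚ
ℕ→ℚ n = (+ n) / 1

-- multiplicative inverse, totalised by 1/0 := 0 (only ever applied to
-- nonzero arguments in this development)
inv : ℚ → ℚ
inv p with p ≟ 0ℚ
... | yes _ = 0ℚ
... | no ne = 1/_ p {{≢-nonZero ne}}

_÷_ : ℚ → ℚ → ℚ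
p ÷ q = p * inv q

sumℚ : List ℚ → ℚ
sumℚ = foldr _+_ 0ℚ

prodℚ : List ℚ → ℚ
prodℚ = foldr _*_ 1ℚ

_^ℚ_ : ℚ → ℕ → ℚ
x ^ℚ zero = 1ℚ
x ^ℚ suc k = x * (x ^ℚ k)

fall : ℚ → ℕ → ℚ
fall x zero = 1ℚ
fall x (suc k) = fall x k * (x - ℕ→ℚ k)

fallℕ : ℕ → ℕ → ℕ
fallℕ n zero = 1
fallℕ n (suc k) = fallℕ n k ℕ.* (n ∸ k)

-- Partitions (as lists of positive integers, weakly decreasing)

size : List ℕ → ℕ
size = foldr ℕ._+_ 0

strictPartsB : ℕ → ℕ → List (List ℕ)
strictPartsB zero zero = [] ∷ []
strictPartsB zero (suc n) = []
strictPartsB (suc b) n =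
  strictPartsB b n ++
  (if suc b ≤ᵇ n then map (suc b ∷_) (strictPartsB b (n ∸ suc b)) else [])

SP : ℕ → List (List ℕ)
SP n = strictPartsB n n

isOdd : ℕ → Bool
isOdd zero = false
isOdd (suc zero) = true
isOdd (suc (suc n)) = isOdd n

oddPartsB : ℕ → ℕ → List (List ℕ)
oddPartsB zero zero = [] ∷ []
oddPartsB zero (suc n) = []
oddPartsB (suc b) n = oddPartsB b n ++ go n n
  where
  go : ℕ → ℕ → List (List ℕ)
  go zero m = []
  go (suc f) m =
    if isOdd (suc b) ∧ (suc b ≤ᵇ m)
    then map (suc b ∷_) (oddPartsB b (m ∸ suc b)) ++
         map (suc b ∷_) (go f (m ∸ suc b))
    else []

OP : ℕ → List (List ℕ)
OP n = oddPartsB n n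

-- g^λ : number of chains ∅ = λ⁽⁰⁾ ⊂ ... ⊂ λ⁽ⁿ⁾ = λ of strict partitions,
-- each obtained from the previous one by adding a box to the shifted
-- diagram.  Counted by the last step: λ⁽ⁿ⁻¹⁾ = λ with one part decreased
-- by one (a part 1 disappearing), required to be again strict.

isStrict : List ℕ → Bool
isStrict [] = true
isStrict (zero ∷ _) = false
isStrict (suc a ∷ []) = true
isStrict (suc a ∷ b ∷ l) = (b <ᵇ suc a) ∧ isStrict (b ∷ l)

removeBox : List ℕ → List (List ℕ)
removeBox [] = []
removeBox (zero ∷ l) = map (zero ∷_) (removeBox l)
removeBox (suc zero ∷ l) = l ∷ map (suc zero ∷_) (removeBox l)
removeBox (suc (suc a) ∷ l) = (suc a ∷ l) ∷ map (suc (suc a) ∷_) (removeBox l)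

gAux : ℕ → List ℕ → ℕ
gAux zero [] = 1
gAux zero (_ ∷ _) = 0
gAux (suc k) l = foldr ℕ._+_ 0 (map (gAux k) (filter (λ μ → Data.Bool.T? (isStrict μ)) (removeBox l)))
  where import Data.Bool

g : List ℕ → ℕ
g λ' = gAux (size λ') λ'

-- Symmetrisation over S_N: all orderings (x_{ω(1)},...,x_{ω(N)}) of a
-- list of N values (N! lists, one per permutation ω)

insertions : {A : Set} → A → List A → List (List A)
insertions a [] = (a ∷ []) ∷ []
insertions a (b ∷ l) = (a ∷ b ∷ l) ∷ map (b ∷_) (insertions a l)

perms : {A : Set} → List A → List (List A)
perms [] = [] ∷ []
perms (a ∷ l) = concatMap (insertions a) (perms l)

-- the summand  Π_{i≤l} pw(y_i, λ_i) · Π_{1≤i≤l, i<j≤N} (y_i+y_j)/(y_i−y_j)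
summand : (ℚ → ℕ → ℚ) → List ℕ → List ℚ → ℚ
summand pw [] ys = 1ℚ
summand pw (m ∷ μ) [] = 0ℚ
summand pw (m ∷ μ) (y ∷ ys) =
  pw y m * prodℚ (map (λ z → (y + z) ÷ (y - z)) ys) * summand pw μ ys

symmetrise : (ℚ → ℕ → ℚ) → List ℕ → List ℚ → ℚ
symmetrise pw λ' x =
  if length x <ᵇ length λ' then 0ℚ
  else inv (ℕ→ℚ ((length x ∸ length λ') !)) * sumℚ (map (summand pw λ') (perms x))

Pfun : List ℕ → List ℚ → ℚ
Pfun = symmetrise _^ℚ_

Qfun : List ℕ → List ℚ → ℚ
Qfun λ' x = ℕ→ℚ (2 ℕ.^ length λ') * Pfun λ' x

Pstar : List ℕ → List ℚ → ℚ
Pstar = symmetrise fall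

pfun : List ℕ → List ℚ → ℚ
pfun ρ x = prodℚ (map (λ r → sumℚ (map (λ xj → xj ^ℚ r) x)) ρ)

mult : ℕ → List ℕ → ℕ
mult r [] = 0
mult r (a ∷ l) with r ℕ.≟ a
... | yes _ = suc (mult r l)
... | no _ = mult r l

-- z_ρ = Π_r r^{m_r(ρ)} m_r(ρ)!   (r ranging over 1..|ρ| suffices)
z : List ℕ → ℕ
z ρ = foldr ℕ._*_ 1 (map (λ i → let r = suc i in (r ℕ.^ mult r ρ) ℕ.* (mult r ρ !)) (upTo (size ρ)))

δ : List ℕ → List ℕ → ℚ
δ ρ σ with ≡-dec ℕ._≟_ ρ σ
... | yes _ = 1ℚ
... | no _ = 0ℚ

-- Characters X^λ_ρ = ⟨p_ρ, Q_λ⟩.  Since ⟨p_ρ,p_σ⟩ = 2^{-ℓ(ρ)} z_ρ δ_{ρσ},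
-- this is the same as the expansion  Q_λ = Σ_{ρ∈𝒪𝒫_k} 2^{ℓ(ρ)} z_ρ^{-1} X^λ_ρ p_ρ.
-- A function X is "the character table" if this identity holds for every
-- strict λ ⊢ k as functions of k variables (at all points with pairwise
-- distinct coordinates, where the defining formula of Q_λ makes sense).
-- The p_ρ (ρ ⊢ k odd) are linearly independent functions there, so X is
-- uniquely determined on the relevant arguments.

open import Data.List.Membership.Propositional using (_∈_)
open import Data.List.Relation.Unary.Unique.Propositional using (Unique)

IsCharTable : (List ℕ → List ℕ → ℚ) → Set
IsCharTable X =
  ∀ (k : ℕ) (λ' : List ℕ) → λ' ∈ SP k →
  ∀ (x : List ℚ) → length x ≡ k → Unique x →
  Qfun λ' x ≡ sumℚ (map (λ ρ → (ℕ→ℚ (2 ℕ.^ length ρ) ÷ ℕ→ℚ (z ρ)) * X λ' ρ * pfun ρ x) (OP k))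

-- 𝔭_ρ(λ) = Σ_{μ∈𝒮𝒫_{|ρ|}} X^μ_ρ P*_μ(λ); a function in Γ is evaluated at
-- λ via its ℓ(λ)-variable specialisation (λ_1,...,λ_ℓ) (stability).
frakp : (List ℕ → List ℕ → ℚ) → List ℕ → List ℕ → ℚ
frakp X ρ λ' = sumℚ (map (λ μ → X μ ρ * Pstar μ (map ℕ→ℚ λ')) (SP (size ρ)))

𝔼 : ℕ → (List ℕ → ℚ) → ℚ
𝔼 n φ = sumℚ (map (λ λ' → (ℕ→ℚ (2 ℕ.^ (n ∸ length λ') ℕ.* (g λ' ℕ.* g λ')) ÷ ℕ→ℚ (n !)) * φ λ') (SP n))

{-# OPTIONS --safe #-}
-- The functions P*_μ satisfy the Pieri rule (|λ| - |μ|) P*_μ(λ) = Σ P*_ν(λ), ν running over μ plus a box, and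
-- P*_ν(λ) = 0 if |ν| = |λ| and ν ≠ λ.  Iterating the rule at λ ⊢ n gives g^λ 𝔭_ρ(λ) = n^{↓|ρ|} Y(λ), where Y is
-- obtained from μ ↦ X^μ_ρ by n - |ρ| steps up the shifted Young graph.  By the Pieri rule for P_μ, the function Y
-- lists the P-coefficients of p_ρ p_1^{n-|ρ|}.  If these agree with the characters of ρ ∪ 1^{n-|ρ|}, the expectation
-- is an instance of the orthogonality of characters.
--
-- Orthogonality comes from the Cauchy identity Σ 2^ℓ(λ) P_λ(x) P_λ(y) = ∏ (1 + x_i y_j) / (1 - x_i y_j): its right
-- side is expanded in power sums by a logarithmic derivative, and the products p_ρ are linearly independent.  The
-- Cauchy identity is proved by adding one variable u to y; partial fractions in u show that both sides satisfy the
-- same recursion.  The characters also determine Y, not only its pairings with them, because they form a complete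
-- orthogonal system: by Euler's theorem there are as many strict as odd partitions of n.
--
-- All identities are evaluated at distinct positive integers, so that no x_i - x_j and no x_i + x_j vanishes.
module Submission where

import Defs
open import Defs using (size; strictPartsB; SP; OP; oddPartsB; isOdd; isStrict; removeBox; mult; insertions; perms; fallℕ)
open import Level using (0ℓ)
open import Algebra.Bundles using (CommutativeRing)
open import Algebra.Structures using (IsCommutativeRing)
open import Data.Bool as Bool using (Bool; true; false; if_then_else_; _∧_)
open import Data.Empty using (⊥-elim)
open import Data.Integer as ℤ using (ℤ)
import Data.Integer.Properties as ℤ
open import Data.List using (List; []; _∷_; _++_; map; foldr; length; upTo; concatMap; filter)
import Data.List.Properties as List
open import Data.List.Membership.Propositional using (_∈_)
import Data.List.Membership.Propositional.Properties as ∈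
open import Data.List.Relation.Binary.Permutation.Propositional using (_↭_; ↭-refl; ↭-sym; ↭-trans; prep; swap)
import Data.List.Relation.Binary.Permutation.Propositional.Properties as ↭
open import Data.List.Relation.Unary.All using (All; []; _∷_)
import Data.List.Relation.Unary.All as All
import Data.List.Relation.Unary.All.Properties as All
open import Data.List.Relation.Unary.AllPairs using (AllPairs; []; _∷_)
import Data.List.Relation.Unary.AllPairs as AllPairs
import Data.List.Relation.Unary.AllPairs.Properties as AllPairs
open import Data.List.Relation.Unary.Any using (here; there)
open import Data.List.Relation.Unary.Unique.Propositional using (Unique)
import Data.List.Relation.Unary.Unique.Propositional.Properties as Unique
open import Data.Maybe using (nothing)
open import Data.Nat as ℕ using (ℕ; zero; suc; _∸_; _!; _≤_; _<_; _≤ᵇ_; _<ᵇ_; z≤n; s≤s; _≟_; _≤?_)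
import Data.Nat.Properties as ℕ
open import Data.Nat.Tactic.RingSolver using (solve-∀)
open import Data.Product using (_×_; _,_; ∃-syntax; proj₁; proj₂)
open import Data.Rational as ℚ using (ℚ; 0ℚ; 1ℚ)
import Data.Rational.Properties as ℚ
import Data.Rational.Unnormalised as ℚᵘ
import Data.Rational.Unnormalised.Properties as ℚᵘ
open import Data.Sum using (_⊎_; inj₁; inj₂)
open import Data.Unit using (tt)
open import Data.Vec using (Vec)
open import Function using (id)
import Relation.Binary.Reflection as Reflection
open import Relation.Binary.PropositionalEquality as ≡ using (_≡_; _≢_)
open import Relation.Nullary using (¬_; Dec; yes; no; contradiction)
open import Tactic.RingSolver.Core.AlmostCommutativeRing using (fromCommutativeRing)
open import Tactic.RingSolver.Core.Expression using (Expr; Κ; Ι; _⊕_; _⊗_; ⊝_; _⊛_; module Eval)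
open import Tactic.RingSolver.Core.Polynomial.Parameters using (Homomorphism)

-- Indices are arbitrary lists of parts, and the functions `R` alternate in them. The branching and
-- Pieri rules therefore need no case distinction: a term that leaves the strict partitions either
-- vanishes or returns with a sign. The weight of the expectation fits this exactly. For |λ| = n the
-- vanishing property gives g^λ P*_λ(λ) = n!, so each of the two functions 𝔭 uses up one factor g^λ
-- of the square. What remains of the weight is 2^(-ℓ(λ)), for which the characters are orthogonal.
-- The table X is given only through Q_λ in exactly |λ| variables, whereas the argument needs the
-- dual expansion of p_ρ into the P_λ, in any number of variables. Only one of the two sets of
-- variables in the Cauchy identity is restricted, and this bridges the gap. The absence of parts 1
-- enters at the end: ρ can be recovered from ρ ∪ 1^i without knowledge of i, and z of ρ ∪ 1^i is i!
-- z_ρ. One of the two factors i! that arise on clearing denominators cancels against this z, the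
-- other produces n! / i!, the falling power.

infix 4 _:=_
infixl 6 _:+_ _:-_
infixl 7 _:*_
infix 8 :-_

-- Ring solver with integer coefficients.

_:=_ : ∀ {n} → Expr ℤ n → Expr ℤ n → Expr ℤ n × Expr ℤ n
_:=_ = _,_

_:+_ _:*_ _:-_ : ∀ {n} → Expr ℤ n → Expr ℤ n → Expr ℤ n
_:+_ = _⊕_
_:*_ = _⊗_
a :- b = a ⊕ (⊝ b)

:-_ : ∀ {n} → Expr ℤ n → Expr ℤ n
:-_ = ⊝_

:0 :1 :2 : ∀ {n} → Expr ℤ n
:0 = Κ (ℤ.+ 0)
:1 = Κ (ℤ.+ 1)
:2 = Κ (ℤ.+ 2)

-- Coefficients are normalised in ℤ, where zero is decidable. In this way terms cancel even over a
-- ring without decidable equality, such as an abstract field or its ring of power series.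
module IntegerCoefficients (R : CommutativeRing 0ℓ 0ℓ) where
  open CommutativeRing R
  open import Algebra.Properties.Ring ring using (-‿distribˡ-*; -‿distribʳ-*; -0#≈0#; -‿+-comm; -‿involutive)
  open import Algebra.Properties.Semiring.Mult.TCOptimised semiring using (1+×; ×1-homo-*; ×-homo-+) renaming (_×_ to _×′_)
  open import Relation.Binary.Reasoning.Setoid setoid

  ⟦_⟧ℤ : ℤ → Carrier
  ⟦ ℤ.+ n ⟧ℤ = n ×′ 1#
  ⟦ ℤ.-[1+ n ] ⟧ℤ = - (ℕ.suc n ×′ 1#)

  private
    ×′-suc : ∀ n → ℕ.suc n ×′ 1# ≈ 1# + n ×′ 1#
    ×′-suc n = 1+× n 1#

    cancelˡ : ∀ a b c → (a + b) - (a + c) ≈ b - c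
    cancelˡ a b c = begin
      (a + b) + - (a + c)      ≈⟨ +-cong (+-comm a b) (sym (-‿+-comm a c)) ⟩
      (b + a) + (- a + - c)    ≈⟨ +-assoc b a _ ⟩
      b + (a + (- a + - c))    ≈⟨ +-congˡ (sym (+-assoc a (- a) (- c))) ⟩
      b + ((a + - a) + - c)    ≈⟨ +-congˡ (+-congʳ (-‿inverseʳ a)) ⟩
      b + (0# + - c)           ≈⟨ +-congˡ (+-identityˡ _) ⟩
      b - c                    ∎

    ⊖-homo : ∀ m n → ⟦ m ℤ.⊖ n ⟧ℤ ≈ m ×′ 1# - n ×′ 1#
    ⊖-homo m ℕ.zero = sym (trans (+-congˡ -0#≈0#) (+-identityʳ _))
    ⊖-homo ℕ.zero (ℕ.suc n) = sym (+-identityˡ _)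
    ⊖-homo (ℕ.suc m) (ℕ.suc n) = begin
      ⟦ ℕ.suc m ℤ.⊖ ℕ.suc n ⟧ℤ                  ≡⟨ ≡.cong ⟦_⟧ℤ (ℤ.[1+m]⊖[1+n]≡m⊖n m n) ⟩
      ⟦ m ℤ.⊖ n ⟧ℤ                              ≈⟨ ⊖-homo m n ⟩
      m ×′ 1# - n ×′ 1#                         ≈⟨ cancelˡ 1# _ _ ⟨
      (1# + m ×′ 1#) - (1# + n ×′ 1#)           ≈⟨ +-cong (×′-suc m) (-‿cong (×′-suc n)) ⟨
      ℕ.suc m ×′ 1# - ℕ.suc n ×′ 1#             ∎

    neg-homo : ∀ i → ⟦ ℤ.- i ⟧ℤ ≈ - ⟦ i ⟧ℤ
    neg-homo (ℤ.+ ℕ.zero) = sym -0#≈0#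
    neg-homo (ℤ.+ ℕ.suc n) = refl
    neg-homo ℤ.-[1+ n ] = sym (-‿involutive _)

    add-homo : ∀ i j → ⟦ i ℤ.+ j ⟧ℤ ≈ ⟦ i ⟧ℤ + ⟦ j ⟧ℤ
    add-homo (ℤ.+ m) (ℤ.+ n) = ×-homo-+ 1# m n
    add-homo (ℤ.+ m) ℤ.-[1+ n ] = ⊖-homo m (ℕ.suc n)
    add-homo ℤ.-[1+ m ] (ℤ.+ n) = trans (⊖-homo n (ℕ.suc m)) (+-comm _ _)
    add-homo ℤ.-[1+ m ] ℤ.-[1+ n ] = begin
      - (ℕ.suc (ℕ.suc (m ℕ.+ n)) ×′ 1#)           ≡⟨ ≡.cong (λ k → - (ℕ.suc k ×′ 1#)) (ℕ.+-suc m n) ⟨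
      - ((ℕ.suc m ℕ.+ ℕ.suc n) ×′ 1#)             ≈⟨ -‿cong (×-homo-+ 1# (ℕ.suc m) (ℕ.suc n)) ⟩
      - (ℕ.suc m ×′ 1# + ℕ.suc n ×′ 1#)           ≈⟨ -‿+-comm _ _ ⟨
      - (ℕ.suc m ×′ 1#) - ℕ.suc n ×′ 1#           ∎

    +*-homo : ∀ m j → ⟦ ℤ.+ m ℤ.* j ⟧ℤ ≈ m ×′ 1# * ⟦ j ⟧ℤ
    +*-homo m (ℤ.+ n) = trans (reflexive (≡.cong ⟦_⟧ℤ (≡.sym (ℤ.pos-* m n)))) (×1-homo-* m n)
    +*-homo m ℤ.-[1+ n ] = begin
      ⟦ ℤ.+ m ℤ.* ℤ.-[1+ n ] ⟧ℤ             ≡⟨ ≡.cong ⟦_⟧ℤ (ℤ.neg-distribʳ-* (ℤ.+ m) (ℤ.+ ℕ.suc n)) ⟨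
      ⟦ ℤ.- (ℤ.+ m ℤ.* ℤ.+ ℕ.suc n) ⟧ℤ      ≈⟨ neg-homo (ℤ.+ m ℤ.* ℤ.+ ℕ.suc n) ⟩
      - ⟦ ℤ.+ m ℤ.* ℤ.+ ℕ.suc n ⟧ℤ          ≈⟨ -‿cong (+*-homo m (ℤ.+ ℕ.suc n)) ⟩
      - (m ×′ 1# * (ℕ.suc n ×′ 1#))         ≈⟨ -‿distribʳ-* _ _ ⟩
      m ×′ 1# * - (ℕ.suc n ×′ 1#)           ∎

    mul-homo : ∀ i j → ⟦ i ℤ.* j ⟧ℤ ≈ ⟦ i ⟧ℤ * ⟦ j ⟧ℤ
    mul-homo (ℤ.+ m) j = +*-homo m j
    mul-homo ℤ.-[1+ m ] j = begin
      ⟦ ℤ.-[1+ m ] ℤ.* j ⟧ℤ                ≡⟨ ≡.cong ⟦_⟧ℤ (ℤ.neg-distribˡ-* (ℤ.+ ℕ.suc m) j) ⟨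
      ⟦ ℤ.- (ℤ.+ ℕ.suc m ℤ.* j) ⟧ℤ         ≈⟨ neg-homo (ℤ.+ ℕ.suc m ℤ.* j) ⟩
      - ⟦ ℤ.+ ℕ.suc m ℤ.* j ⟧ℤ             ≈⟨ -‿cong (+*-homo (ℕ.suc m) j) ⟩
      - (ℕ.suc m ×′ 1# * ⟦ j ⟧ℤ)           ≈⟨ -‿distribˡ-* _ _ ⟩
      - (ℕ.suc m ×′ 1#) * ⟦ j ⟧ℤ           ∎

    isZero : ℤ → Bool
    isZero (ℤ.+ ℕ.zero) = true
    isZero _ = false

    isZero-correct : ∀ i → Bool.T (isZero i) → 0# ≈ ⟦ i ⟧ℤ
    isZero-correct (ℤ.+ ℕ.zero) _ = refl

    homomorphism : Homomorphism 0ℓ 0ℓ 0ℓ 0ℓ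
    homomorphism = record
      { from = record { rawRing = ℤ.+-*-rawRing ; isZero = isZero }
      ; to = fromCommutativeRing R (λ _ → nothing)
      ; morphism = record
          { ⟦_⟧ = ⟦_⟧ℤ ; +-homo = add-homo ; *-homo = mul-homo ; -‿homo = neg-homo
          ; 0-homo = refl ; 1-homo = refl }
      ; Zero-C⟶Zero-R = isZero-correct
      }

    open Eval (CommutativeRing.rawRing R) ⟦_⟧ℤ using (⟦_⟧)
    open import Tactic.RingSolver.Core.Polynomial.Base (Homomorphism.from homomorphism)
    open import Tactic.RingSolver.Core.Polynomial.Semantics homomorphism renaming (⟦_⟧ to ⟦_⟧ₚ)
    open import Tactic.RingSolver.Core.Polynomial.Homomorphism homomorphism
    open import Algebra.Properties.Semiring.Exp.TCOptimised semiring using (^-congˡ)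

    norm : ∀ {n} → Expr ℤ n → Poly n
    norm (Κ x)   = κ x
    norm (Ι x)   = ι x
    norm (x ⊕ y) = norm x ⊞ norm y
    norm (x ⊗ y) = norm x ⊠ norm y
    norm (⊝ x)   = ⊟ norm x
    norm (x ⊛ i) = norm x ⊡ i

    ⟦_⇓⟧ : ∀ {n} → Expr ℤ n → Vec Carrier n → Carrier
    ⟦ e ⇓⟧ = ⟦ norm e ⟧ₚ

    correct : ∀ {n} (e : Expr ℤ n) ρ → ⟦ e ⇓⟧ ρ ≈ ⟦ e ⟧ ρ
    correct (Κ x)   ρ = κ-hom x ρ
    correct (Ι x)   ρ = ι-hom x ρ
    correct (x ⊕ y) ρ = trans (⊞-hom (norm x) (norm y) ρ) (+-cong (correct x ρ) (correct y ρ))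
    correct (x ⊗ y) ρ = trans (⊠-hom (norm x) (norm y) ρ) (*-cong (correct x ρ) (correct y ρ))
    correct (⊝ x)   ρ = trans (⊟-hom (norm x) ρ) (-‿cong (correct x ρ))
    correct (x ⊛ i) ρ = trans (⊡-hom (norm x) i ρ) (^-congˡ i (correct x ρ))

  open Reflection setoid Ι ⟦_⟧ ⟦_⇓⟧ correct public using (solve)

-- Sums over the ways to pick one entry of a list.

data Pick {A : Set} : A → List A → List A → Set where
  here  : ∀ {x xs} → Pick x xs (x ∷ xs)
  there : ∀ {x y ys xs} → Pick y ys xs → Pick y (x ∷ ys) (x ∷ xs)

Pick-All : ∀ {A : Set} {P : A → Set} {y ys xs} → Pick y ys xs → All P xs → P y × All P ys
Pick-All here (p ∷ ps) = p , ps
Pick-All (there π) (p ∷ ps) with Pick-All π ps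
... | q , qs = q , p ∷ qs

Pick-AllPairs : ∀ {A : Set} {P : A → A → Set} → (∀ {a b} → P a b → P b a) →
  ∀ {y ys xs} → Pick y ys xs → AllPairs P xs → All (P y) ys × AllPairs P ys
Pick-AllPairs sym here (p ∷ ps) = p , ps
Pick-AllPairs sym (there π) (p ∷ ps) with Pick-AllPairs sym π ps | Pick-All π p
... | q , qs | r , rs = sym r ∷ q , rs ∷ qs

Pick-↭ : ∀ {A : Set} {y : A} {ys xs} → Pick y ys xs → y ∷ ys ↭ xs
Pick-↭ here = ↭-refl
Pick-↭ (there {x} {y} π) = ↭-trans (swap y x ↭-refl) (prep x (Pick-↭ π))

Pick-length : ∀ {A : Set} {y : A} {ys xs} → Pick y ys xs → length xs ≡ ℕ.suc (length ys)
Pick-length here = ≡.refl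
Pick-length (there π) = ≡.cong ℕ.suc (Pick-length π)

module Sums (R : CommutativeRing 0ℓ 0ℓ) where
  open CommutativeRing R
  open IntegerCoefficients R
  open import Relation.Binary.Reasoning.Setoid setoid

  private variable
    A B : Set

  ∑ ∏ : (A → Carrier) → List A → Carrier
  ∑ f xs = foldr _+_ 0# (map f xs)
  ∏ f xs = foldr _*_ 1# (map f xs)

  ∑-cong : ∀ {f g : A → Carrier} xs → (∀ {x} → x ∈ xs → f x ≈ g x) → ∑ f xs ≈ ∑ g xs
  ∑-cong [] e = refl
  ∑-cong (x ∷ xs) e = +-cong (e (here ≡.refl)) (∑-cong xs (λ m → e (there m)))

  ∑-zero : ∀ {f : A → Carrier} xs → (∀ {x} → x ∈ xs → f x ≈ 0#) → ∑ f xs ≈ 0#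
  ∑-zero [] e = refl
  ∑-zero (x ∷ xs) e = trans (+-cong (e (here ≡.refl)) (∑-zero xs (λ m → e (there m)))) (+-identityˡ 0#)

  ∑-+ : ∀ (f g : A → Carrier) xs → ∑ (λ x → f x + g x) xs ≈ ∑ f xs + ∑ g xs
  ∑-+ f g [] = sym (+-identityˡ 0#)
  ∑-+ f g (x ∷ xs) = trans (+-congˡ (∑-+ f g xs))
    (solve 4 (λ a b c d → (a :+ b) :+ (c :+ d) := (a :+ c) :+ (b :+ d)) refl (f x) (g x) (∑ f xs) (∑ g xs))

  ∑-*ˡ : ∀ c (f : A → Carrier) xs → ∑ (λ x → c * f x) xs ≈ c * ∑ f xs
  ∑-*ˡ c f [] = sym (zeroʳ c)
  ∑-*ˡ c f (x ∷ xs) = trans (+-congˡ (∑-*ˡ c f xs)) (sym (distribˡ c _ _))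

  ∑-*ʳ : ∀ c (f : A → Carrier) xs → ∑ (λ x → f x * c) xs ≈ ∑ f xs * c
  ∑-*ʳ c f [] = sym (zeroˡ c)
  ∑-*ʳ c f (x ∷ xs) = trans (+-congˡ (∑-*ʳ c f xs)) (sym (distribʳ c _ _))

  ∑-++ : ∀ (f : A → Carrier) xs ys → ∑ f (xs ++ ys) ≈ ∑ f xs + ∑ f ys
  ∑-++ f [] ys = sym (+-identityˡ _)
  ∑-++ f (x ∷ xs) ys = trans (+-congˡ (∑-++ f xs ys)) (sym (+-assoc _ _ _))

  ∑-map : ∀ (f : B → Carrier) (h : A → B) xs → ∑ f (map h xs) ≈ ∑ (λ x → f (h x)) xs
  ∑-map f h [] = refl
  ∑-map f h (x ∷ xs) = +-congˡ (∑-map f h xs)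

  ∑-swap : ∀ (f : A → B → Carrier) xs ys → ∑ (λ x → ∑ (f x) ys) xs ≈ ∑ (λ y → ∑ (λ x → f x y) xs) ys
  ∑-swap f [] ys = sym (∑-zero ys (λ _ → refl))
  ∑-swap f (x ∷ xs) ys = trans (+-congˡ (∑-swap f xs ys)) (sym (∑-+ (f x) _ ys))

  ∏-cong : ∀ {f g : A → Carrier} xs → (∀ {x} → x ∈ xs → f x ≈ g x) → ∏ f xs ≈ ∏ g xs
  ∏-cong [] e = refl
  ∏-cong (x ∷ xs) e = *-cong (e (here ≡.refl)) (∏-cong xs (λ m → e (there m)))

  ∏-* : ∀ (f g : A → Carrier) xs → ∏ (λ x → f x * g x) xs ≈ ∏ f xs * ∏ g xs
  ∏-* f g [] = sym (*-identityˡ 1#)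
  ∏-* f g (x ∷ xs) = trans (*-congˡ (∏-* f g xs))
    (solve 4 (λ a b c d → (a :* b) :* (c :* d) := (a :* c) :* (b :* d)) refl (f x) (g x) (∏ f xs) (∏ g xs))

  ∏-one : ∀ {f : A → Carrier} xs → (∀ {x} → x ∈ xs → f x ≈ 1#) → ∏ f xs ≈ 1#
  ∏-one [] e = refl
  ∏-one (x ∷ xs) e = trans (*-cong (e (here ≡.refl)) (∏-one xs (λ m → e (there m)))) (*-identityˡ 1#)

  ∏-pick : ∀ (f : A → Carrier) {y ys xs} → Pick y ys xs → ∏ f xs ≈ f y * ∏ f ys
  ∏-pick f here = refl
  ∏-pick f (there {x} {y} {ys} π) = trans (*-congˡ (∏-pick f π))
    (solve 3 (λ a b c → a :* (b :* c) := b :* (a :* c)) refl (f x) (f y) (∏ f ys))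

  ∑-pick : ∀ (f : A → Carrier) {y ys xs} → Pick y ys xs → ∑ f xs ≈ f y + ∑ f ys
  ∑-pick f here = refl
  ∑-pick f (there {x} {y} {ys} π) = trans (+-congˡ (∑-pick f π))
    (solve 3 (λ a b c → a :+ (b :+ c) := b :+ (a :+ c)) refl (f x) (f y) (∑ f ys))

  -- The summand receives the remaining entries as well, because the weight of a picked variable is
  -- a product over the variables not yet picked.
  ∑ᵖ : (A → List A → Carrier) → List A → Carrier
  ∑ᵖ f [] = 0#
  ∑ᵖ f (x ∷ xs) = f x xs + ∑ᵖ (λ y ys → f y (x ∷ ys)) xs

  ∑ᵖ-cong : ∀ {f g : A → List A → Carrier} xs → (∀ {y ys} → Pick y ys xs → f y ys ≈ g y ys) → ∑ᵖ f xs ≈ ∑ᵖ g xs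
  ∑ᵖ-cong [] e = refl
  ∑ᵖ-cong (x ∷ xs) e = +-cong (e here) (∑ᵖ-cong xs (λ π → e (there π)))

  ∑ᵖ-zero : ∀ {f : A → List A → Carrier} xs → (∀ {y ys} → Pick y ys xs → f y ys ≈ 0#) → ∑ᵖ f xs ≈ 0#
  ∑ᵖ-zero [] e = refl
  ∑ᵖ-zero (x ∷ xs) e = trans (+-cong (e here) (∑ᵖ-zero xs (λ π → e (there π)))) (+-identityˡ 0#)

  ∑ᵖ-+ : ∀ (f g : A → List A → Carrier) xs → ∑ᵖ (λ y ys → f y ys + g y ys) xs ≈ ∑ᵖ f xs + ∑ᵖ g xs
  ∑ᵖ-+ f g [] = sym (+-identityˡ 0#)
  ∑ᵖ-+ f g (x ∷ xs) = trans (+-congˡ (∑ᵖ-+ _ _ xs))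
    (solve 4 (λ a b c d → (a :+ b) :+ (c :+ d) := (a :+ c) :+ (b :+ d)) refl _ _ _ _)

  ∑ᵖ-*ˡ : ∀ c (f : A → List A → Carrier) xs → ∑ᵖ (λ y ys → c * f y ys) xs ≈ c * ∑ᵖ f xs
  ∑ᵖ-*ˡ c f [] = sym (zeroʳ c)
  ∑ᵖ-*ˡ c f (x ∷ xs) = trans (+-congˡ (∑ᵖ-*ˡ c _ xs)) (sym (distribˡ c _ _))

  ∑ᵖ-∑ : ∀ (f : B → A → List A → Carrier) bs xs → ∑ᵖ (λ y ys → ∑ (λ b → f b y ys) bs) xs ≈ ∑ (λ b → ∑ᵖ (f b) xs)
      bs
  ∑ᵖ-∑ f bs [] = sym (∑-zero bs (λ _ → refl))
  ∑ᵖ-∑ f bs (x ∷ xs) = trans (+-congˡ (∑ᵖ-∑ (λ b y ys → f b y (x ∷ ys)) bs xs)) (sym (∑-+ _ _ bs))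

  ∑ᵖ-comm : ∀ (f : A → List A → B → List B → Carrier) xs zs →
    ∑ᵖ (λ x ys → ∑ᵖ (f x ys) zs) xs ≈ ∑ᵖ (λ z ws → ∑ᵖ (λ x ys → f x ys z ws) xs) zs
  ∑ᵖ-comm f [] zs = sym (∑ᵖ-zero zs (λ _ → refl))
  ∑ᵖ-comm f (x ∷ xs) zs = trans (+-congˡ (∑ᵖ-comm (λ y ys → f y (x ∷ ys)) xs zs)) (sym (∑ᵖ-+ _ _ zs))

  -- Two positions picked in either order leave the same list behind. This exchange is what makes
  -- `R` alternate in its parts.
  ∑ᵖ-swap : ∀ (f : A → A → List A → Carrier) xs →
    ∑ᵖ (λ y → ∑ᵖ (f y)) xs ≈ ∑ᵖ (λ y → ∑ᵖ (λ w → f w y)) xs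
  ∑ᵖ-swap f [] = refl
  ∑ᵖ-swap f (x ∷ xs) = begin
    ∑ᵖ (f x) xs + ∑ᵖ (λ y ys → f y x ys + ∑ᵖ (λ w ws → f y w (x ∷ ws)) ys) xs
      ≈⟨ +-congˡ (∑ᵖ-+ _ _ xs) ⟩
    ∑ᵖ (f x) xs + (∑ᵖ (λ y → f y x) xs + ∑ᵖ (λ y → ∑ᵖ (λ w ws → f y w (x ∷ ws))) xs)
      ≈⟨ +-congˡ (+-congˡ (∑ᵖ-swap (λ y w ws → f y w (x ∷ ws)) xs)) ⟩
    ∑ᵖ (f x) xs + (∑ᵖ (λ y → f y x) xs + ∑ᵖ (λ y → ∑ᵖ (λ w ws → f w y (x ∷ ws))) xs)
      ≈⟨ solve 3 (λ a b c → a :+ (b :+ c) := b :+ (a :+ c)) refl _ _ _ ⟩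
    ∑ᵖ (λ y → f y x) xs + (∑ᵖ (f x) xs + ∑ᵖ (λ y → ∑ᵖ (λ w ws → f w y (x ∷ ws))) xs)
      ≈⟨ +-congˡ (sym (∑ᵖ-+ _ _ xs)) ⟩
    ∑ᵖ (λ y → f y x) xs + ∑ᵖ (λ y ys → f x y ys + ∑ᵖ (λ w ws → f w y (x ∷ ws)) ys) xs ∎

-- Ordered fields and partial fractions.

open ≡ using (refl; sym; trans; cong; cong₂; subst; subst₂)

-- Of the order only this much enters: it makes the positive integers nonzero and forces a vanishing
-- sum of squares to vanish term by term. The inverse is a total function about whose value at zero
-- nothing is assumed.
record OrderedField : Set₁ where
  infixl 6 _+_
  infixl 7 _*_
  infix 8 -_
  infix 9 _⁻¹
  field
    Carrier : Set
    _+_ _*_ : Carrier → Carrier → Carrier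
    -_ : Carrier → Carrier
    0# 1# : Carrier
    isCommutativeRing : IsCommutativeRing _≡_ _+_ _*_ -_ 0# 1#
    _⁻¹ : Carrier → Carrier
    inverseʳ : ∀ {x} → x ≢ 0# → x * x ⁻¹ ≡ 1#
    1≢0 : 1# ≢ 0#
    NonNeg : Carrier → Set
    nonNeg-square : ∀ x → NonNeg (x * x)
    nonNeg-+ : ∀ {x y} → NonNeg x → NonNeg y → NonNeg (x + y)
    nonNeg-* : ∀ {x y} → NonNeg x → NonNeg y → NonNeg (x * y)
    nonNeg-sum-zero : ∀ {x y} → NonNeg x → NonNeg y → x + y ≡ 0# → x ≡ 0#
    square-zero : ∀ {x} → x * x ≡ 0# → x ≡ 0#

  commutativeRing : CommutativeRing 0ℓ 0ℓ
  commutativeRing = record { isCommutativeRing = isCommutativeRing }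

module FieldTheory (F : OrderedField) where
  open OrderedField F public using (Carrier; _+_; _*_; -_; 0#; 1#; _⁻¹; inverseʳ; 1≢0; NonNeg; nonNeg-square; nonNeg-+; nonNeg-*; nonNeg-sum-zero; square-zero; commutativeRing)
  open CommutativeRing commutativeRing public using
    ( _-_; +-identityˡ; +-identityʳ; *-identityˡ; *-identityʳ; +-comm; +-assoc; *-comm; *-assoc; zeroˡ; zeroʳ
    ; distribˡ; distribʳ; -‿inverseʳ; -‿inverseˡ)
  open IntegerCoefficients commutativeRing public using (solve)
  open Sums commutativeRing public
  open ≡.≡-Reasoning

  2# : Carrier
  2# = 1# + 1#

  fromℕ : ℕ → Carrier
  fromℕ zero = 0#
  fromℕ (suc n) = 1# + fromℕ n

  fromℕ-+ : ∀ m n → fromℕ (m ℕ.+ n) ≡ fromℕ m + fromℕ n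
  fromℕ-+ zero n = sym (+-identityˡ _)
  fromℕ-+ (suc m) n = trans (cong (1# +_) (fromℕ-+ m n)) (sym (+-assoc _ _ _))

  fromℕ-* : ∀ m n → fromℕ (m ℕ.* n) ≡ fromℕ m * fromℕ n
  fromℕ-* zero n = sym (zeroˡ _)
  fromℕ-* (suc m) n = begin
    fromℕ (n ℕ.+ m ℕ.* n)         ≡⟨ fromℕ-+ n (m ℕ.* n) ⟩
    fromℕ n + fromℕ (m ℕ.* n)     ≡⟨ cong (fromℕ n +_) (fromℕ-* m n) ⟩
    fromℕ n + fromℕ m * fromℕ n   ≡⟨ solve 2 (λ a b → b :+ a :* b := (:1 :+ a) :* b) refl (fromℕ m) (fromℕ n) ⟩
    (1# + fromℕ m) * fromℕ n      ∎

  nonNeg-1 : NonNeg 1#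
  nonNeg-1 = subst NonNeg (*-identityˡ 1#) (nonNeg-square 1#)

  nonNeg-0 : NonNeg 0#
  nonNeg-0 = subst NonNeg (zeroˡ 0#) (nonNeg-square 0#)

  nonNeg-fromℕ : ∀ n → NonNeg (fromℕ n)
  nonNeg-fromℕ zero = nonNeg-0
  nonNeg-fromℕ (suc n) = nonNeg-+ nonNeg-1 (nonNeg-fromℕ n)

  fromℕ-suc≢0 : ∀ n → fromℕ (suc n) ≢ 0#
  fromℕ-suc≢0 n e = 1≢0 (nonNeg-sum-zero nonNeg-1 (nonNeg-fromℕ n) e)

  fromℕ-pos≢0 : ∀ {n} → 0 < n → fromℕ n ≢ 0#
  fromℕ-pos≢0 {suc n} _ = fromℕ-suc≢0 n

  2≢0 : 2# ≢ 0#
  2≢0 e = 1≢0 (nonNeg-sum-zero nonNeg-1 nonNeg-1 e)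

  *-cancelˡ : ∀ {c x y} → c ≢ 0# → c * x ≡ c * y → x ≡ y
  *-cancelˡ {c} {x} {y} c≢0 e = trans (sym (unit x)) (trans (cong (c ⁻¹ *_) e) (unit y))
    where
    unit : ∀ w → c ⁻¹ * (c * w) ≡ w
    unit w = begin
      c ⁻¹ * (c * w) ≡⟨ solve 3 (λ i c w → i :* (c :* w) := c :* i :* w) refl (c ⁻¹) c w ⟩
      c * c ⁻¹ * w   ≡⟨ cong (_* w) (inverseʳ c≢0) ⟩
      1# * w         ≡⟨ *-identityˡ w ⟩
      w              ∎

  *-zero-cancelˡ : ∀ {c x} → c ≢ 0# → c * x ≡ 0# → x ≡ 0#
  *-zero-cancelˡ c≢0 e = *-cancelˡ c≢0 (trans e (sym (zeroʳ _)))

  *-≢0 : ∀ {x y} → x ≢ 0# → y ≢ 0# → x * y ≢ 0#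
  *-≢0 x≢0 y≢0 e = y≢0 (*-zero-cancelˡ x≢0 e)

  x-y≡0⇒x≡y : ∀ {x y} → x - y ≡ 0# → x ≡ y
  x-y≡0⇒x≡y {x} {y} e = begin
    x            ≡⟨ solve 2 (λ x y → x := (x :- y) :+ y) refl x y ⟩
    (x - y) + y  ≡⟨ cong (_+ y) e ⟩
    0# + y       ≡⟨ +-identityˡ y ⟩
    y            ∎

  double-zero : ∀ {x} → x ≡ - x → x ≡ 0#
  double-zero {x} e = *-zero-cancelˡ 2≢0 (begin
    2# * x   ≡⟨ solve 1 (λ x → :2 :* x := x :+ x) refl x ⟩
    x + x    ≡⟨ cong (x +_) e ⟩
    x + - x  ≡⟨ -‿inverseʳ x ⟩
    0#       ∎)

  fromℕ-injective : ∀ {m n} → fromℕ m ≡ fromℕ n → m ≡ n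
  fromℕ-injective {zero} {zero} e = refl
  fromℕ-injective {zero} {suc n} e = ⊥-elim (fromℕ-suc≢0 n (sym e))
  fromℕ-injective {suc m} {zero} e = ⊥-elim (fromℕ-suc≢0 m e)
  fromℕ-injective {suc m} {suc n} e = cong suc (fromℕ-injective (begin
    fromℕ m              ≡⟨ solve 1 (λ a → a := (:1 :+ a) :- :1) refl (fromℕ m) ⟩
    (1# + fromℕ m) - 1#  ≡⟨ cong (_- 1#) e ⟩
    (1# + fromℕ n) - 1#  ≡⟨ solve 1 (λ a → (:1 :+ a) :- :1 := a) refl (fromℕ n) ⟩
    fromℕ n              ∎))

  _^_ : Carrier → ℕ → Carrier
  x ^ zero = 1#
  x ^ suc n = x * x ^ n
  infix 8 _^_

  ^-+ : ∀ x m n → x ^ (m ℕ.+ n) ≡ x ^ m * x ^ n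
  ^-+ x zero n = sym (*-identityˡ _)
  ^-+ x (suc m) n = trans (cong (x *_) (^-+ x m n)) (sym (*-assoc _ _ _))

  ^-* : ∀ x y n → (x * y) ^ n ≡ x ^ n * y ^ n
  ^-* x y zero = sym (*-identityˡ _)
  ^-* x y (suc n) = trans (cong (x * y *_) (^-* x y n))
    (solve 4 (λ a b c d → a :* b :* (c :* d) := a :* c :* (b :* d)) refl x y (x ^ n) (y ^ n))

  ^-≢0 : ∀ {x} n → x ≢ 0# → x ^ n ≢ 0#
  ^-≢0 zero x≢0 = 1≢0
  ^-≢0 (suc n) x≢0 = *-≢0 x≢0 (^-≢0 n x≢0)

  Apart : Carrier → Carrier → Set
  Apart x y = x - y ≢ 0#

  Apart-sym : ∀ {x y} → Apart x y → Apart y x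
  Apart-sym {x} {y} p e = p (begin
    x - y      ≡⟨ solve 2 (λ x y → x :- y := :- (y :- x)) refl x y ⟩
    - (y - x)  ≡⟨ cong -_ e ⟩
    - 0#       ≡⟨ solve 0 (:- :0 := :0) refl ⟩
    0#         ∎)

  inverse-neg : ∀ {x y} → Apart x y → (y - x) ⁻¹ ≡ - (x - y) ⁻¹
  inverse-neg {x} {y} p = *-cancelˡ (Apart-sym p) (begin
    (y - x) * (y - x) ⁻¹      ≡⟨ inverseʳ (Apart-sym p) ⟩
    1#                        ≡⟨ inverseʳ p ⟨
    (x - y) * (x - y) ⁻¹      ≡⟨ solve 3 (λ x y i → (x :- y) :* i := (y :- x) :* :- i) refl x y ((x - y) ⁻¹) ⟩
    (y - x) * - (x - y) ⁻¹    ∎)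

  -- The factor attached to an ordered pair of variables in Schur's P-functions.
  v : Carrier → Carrier → Carrier
  v x y = (x + y) * (x - y) ⁻¹

  v-anti : ∀ {x y} → Apart x y → v y x ≡ - v x y
  v-anti {x} {y} p = begin
    (y + x) * (y - x) ⁻¹      ≡⟨ cong ((y + x) *_) (inverse-neg p) ⟩
    (y + x) * - (x - y) ⁻¹    ≡⟨ solve 3 (λ x y i → (y :+ x) :* :- i := :- ((x :+ y) :* i)) refl x y
        ((x - y) ⁻¹) ⟩
    - ((x + y) * (x - y) ⁻¹)  ∎

  weight : Carrier → List Carrier → Carrier
  weight y ys = ∏ (v y) ys

  private
    partial-fractions : ∀ {u t x} → Apart u t → Apart u x → Apart t x →
      (u - t) ⁻¹ * (t - x) ⁻¹ ≡ (u - t) ⁻¹ * (u - x) ⁻¹ + (u - x) ⁻¹ * (t - x) ⁻¹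
    partial-fractions {u} {t} {x} p q r = begin
      a * c                                ≡⟨ *-identityʳ _ ⟨
      a * c * 1#                           ≡⟨ cong (a * c *_) (inverseʳ q) ⟨
      a * c * ((u - x) * b)                ≡⟨ solve 6
          (λ a b c u t x → a :* c :* ((u :- x) :* b) := ((u :- t) :* a) :* (b :* c) :+ ((t :- x) :* c) :*
          (a :* b)) refl a b c u t x ⟩
      (u - t) * a * (b * c) + (t - x) * c * (a * b)
                                           ≡⟨ cong₂ (λ m n → m * (b * c) + n * (a * b)) (inverseʳ p)
                                                (inverseʳ r) ⟩
      1# * (b * c) + 1# * (a * b)          ≡⟨ solve 3
          (λ a b c → :1 :* (b :* c) :+ :1 :* (a :* b) := a :* b :+ b :* c) refl a b c ⟩
      a * b + b * c                        ∎
      where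
      a = (u - t) ⁻¹
      b = (u - x) ⁻¹
      c = (t - x) ⁻¹

  v-expand : ∀ {u t} → Apart u t → v u t ≡ 1# + 2# * (t * (u - t) ⁻¹)
  v-expand {u} {t} p = begin
    (u + t) * i                  ≡⟨ solve 3 (λ u t i → (u :+ t) :* i := (u :- t) :* i :+ :2 :* (t :* i)) refl u
        t i ⟩
    (u - t) * i + 2# * (t * i)   ≡⟨ cong (_+ 2# * (t * i)) (inverseʳ p) ⟩
    1# + 2# * (t * i)            ∎
    where i = (u - t) ⁻¹

  -- Partial fractions of the product in the variable t, whose poles are the xᵢ.
  weight-expand : ∀ t xs → All (Apart t) xs → AllPairs Apart xs →
    weight t xs ≡ 1# + 2# * ∑ᵖ (λ x ys → weight x ys * (x * (t - x) ⁻¹)) xs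
  weight-expand t [] _ _ = solve 0 (:1 := :1 :+ :2 :* :0) refl
  weight-expand u (t ∷ xs) (p ∷ ps) (q ∷ qs) = begin
    v u t * weight u xs
      ≡⟨ cong₂ _*_ (v-expand p) (weight-expand u xs ps qs) ⟩
    (1# + 2# * e) * (1# + 2# * S)
      ≡⟨ solve 2 (λ e s → (:1 :+ :2 :* e) :* (:1 :+ :2 :* s) := :1 :+ :2 :* (e :+ (:1 :+ :2 :* e) :* s)) refl e
           S ⟩
    1# + 2# * (e + (1# + 2# * e) * S)
      ≡⟨ cong (λ m → 1# + 2# * (e + m)) step ⟩
    1# + 2# * (e + (2# * e * S′ + S″))
      ≡⟨ solve 3 (λ e s r → :1 :+ :2 :* (e :+ (:2 :* e :* s :+ r)) := :1 :+ :2 :* ((:1 :+ :2 :* s) :* e :+ r))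
           refl e S′ S″ ⟩
    1# + 2# * ((1# + 2# * S′) * e + S″)
      ≡⟨ cong (λ m → 1# + 2# * (m * e + S″)) (weight-expand t xs q qs) ⟨
    1# + 2# * (weight t xs * e + S″) ∎
    where
    a = (u - t) ⁻¹
    e = t * a
    S = ∑ᵖ (λ x ys → weight x ys * (x * (u - x) ⁻¹)) xs
    S′ = ∑ᵖ (λ x ys → weight x ys * (x * (t - x) ⁻¹)) xs
    S″ = ∑ᵖ (λ x ys → v x t * weight x ys * (x * (u - x) ⁻¹)) xs
    -- The product of the poles in u at t and at x is split. The pole at t contributes to `S′`, the
    -- pole at x to `S″`, where it acquires the factor `v x t`.
    term : ∀ {x} → Apart u x → Apart t x → ∀ w →
      (1# + 2# * e) * (w * (x * (u - x) ⁻¹)) ≡ 2# * e * (w * (x * (t - x) ⁻¹)) + v x t * w * (x * (u - x) ⁻¹)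
    term {x} r s w = begin
      (1# + 2# * (t * a)) * (w * (x * b))
        -- The last summand is zero by `partial-fractions` and by (t - x) c = 1. Adding it turns the
        -- claim into a polynomial identity in a, b and c.
        ≡⟨ solve 6 (λ a b c t x w → (:1 :+ :2 :* (t :* a)) :* (w :* (x :* b)) :=
             :2 :* (t :* a) :* (w :* (x :* c)) :+ (x :+ t) :* (:- c) :* w :* (x :* b)
             :+ w :* x :* (:2 :* t :* ((a :* b :+ b :* c) :- a :* c) :+ b :* (:1 :- (t :- x) :* c))) refl a b c
                 t x w ⟩
      2# * (t * a) * (w * (x * c)) + (x + t) * (- c) * w * (x * b)
        + w * x * (2# * t * ((a * b + b * c) - a * c) + b * (1# - (t - x) * c))
        ≡⟨ cong₂ (λ m n → 2# * (t * a) * (w * (x * c)) + (x + t) * (- c) * w * (x * b) + w * x *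
             (2# * t * ((a * b + b * c) - m) + b * (1# - n)))
             (partial-fractions p r s) (inverseʳ s) ⟩
      2# * (t * a) * (w * (x * c)) + (x + t) * (- c) * w * (x * b)
        + w * x * (2# * t * ((a * b + b * c) - (a * b + b * c)) + b * (1# - 1#))
        ≡⟨ solve 6 (λ a b c t x w →
             :2 :* (t :* a) :* (w :* (x :* c)) :+ (x :+ t) :* (:- c) :* w :* (x :* b)
             :+ w :* x :* (:2 :* t :* ((a :* b :+ b :* c) :- (a :* b :+ b :* c)) :+ b :* (:1 :- :1))
             := :2 :* (t :* a) :* (w :* (x :* c)) :+ (x :+ t) :* (:- c) :* w :* (x :* b)) refl a b c t x w ⟩
      2# * (t * a) * (w * (x * c)) + (x + t) * (- c) * w * (x * b)
        ≡⟨ cong (λ m → 2# * (t * a) * (w * (x * c)) + (x + t) * m * w * (x * b)) (inverse-neg s) ⟨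
      2# * (t * a) * (w * (x * c)) + v x t * w * (x * b) ∎
      where
      b = (u - x) ⁻¹
      c = (t - x) ⁻¹
    step : (1# + 2# * e) * S ≡ 2# * e * S′ + S″
    step = begin
      (1# + 2# * e) * S ≡⟨ ∑ᵖ-*ˡ (1# + 2# * e) _ xs ⟨
      ∑ᵖ (λ x ys → (1# + 2# * e) * (weight x ys * (x * (u - x) ⁻¹))) xs
        ≡⟨ ∑ᵖ-cong xs (λ {x} {ys} π → term (proj₁ (Pick-All π ps)) (proj₁ (Pick-All π q)) (weight x ys)) ⟩
      ∑ᵖ (λ x ys → 2# * e * (weight x ys * (x * (t - x) ⁻¹)) + v x t * weight x ys * (x * (u - x) ⁻¹)) xs
        ≡⟨ ∑ᵖ-+ _ _ xs ⟩
      ∑ᵖ (λ x ys → 2# * e * (weight x ys * (x * (t - x) ⁻¹))) xs + S″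
        ≡⟨ cong (_+ S″) (∑ᵖ-*ˡ (2# * e) _ xs) ⟩
      2# * e * S′ + S″ ∎

  -- The case t = 0 of `weight-expand`, where every x (t - x)⁻¹ is -1. Since `weight 0# xs` is the
  -- sign (-1)^N for N nonzero variables, the sum is 0 or 1 according to the parity of N.
  ∑-weight : ∀ xs → All (_≢ 0#) xs → AllPairs Apart xs → weight 0# xs ≡ 1# - 2# * ∑ᵖ weight xs
  ∑-weight xs ps qs = begin
    weight 0# xs
      ≡⟨ weight-expand 0# xs (All.map apart ps) qs ⟩
    1# + 2# * ∑ᵖ (λ x ys → weight x ys * (x * (0# - x) ⁻¹)) xs
      ≡⟨ cong (λ m → 1# + 2# * m) (∑ᵖ-cong xs
           (λ {x} {ys} π → term (apart (proj₁ (Pick-All π ps))) (weight x ys))) ⟩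
    1# + 2# * ∑ᵖ (λ x ys → - 1# * weight x ys) xs
      ≡⟨ cong (λ m → 1# + 2# * m) (∑ᵖ-*ˡ (- 1#) weight xs) ⟩
    1# + 2# * (- 1# * ∑ᵖ weight xs)
      ≡⟨ solve 1 (λ s → :1 :+ :2 :* (:- :1 :* s) := :1 :- :2 :* s) refl _ ⟩
    1# - 2# * ∑ᵖ weight xs ∎
    where
    apart : ∀ {x} → x ≢ 0# → Apart 0# x
    apart {x} p e = p (sym (x-y≡0⇒x≡y e))
    term : ∀ {x} → Apart 0# x → ∀ w → w * (x * (0# - x) ⁻¹) ≡ - 1# * w
    term {x} p w = begin
      w * (x * (0# - x) ⁻¹)             ≡⟨ solve 3 (λ w x i → w :* (x :* i) := :- ((:0 :- x) :* i) :* w) refl w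
          x _ ⟩
      - ((0# - x) * (0# - x) ⁻¹) * w    ≡⟨ cong (λ m → - m * w) (inverseʳ p) ⟩
      - 1# * w                          ∎

  -- In terms of `R` this is P_(1) = p₁, the start of the Pieri rule. A new variable t contributes
  -- 2tS through its own weight and -2tS through the weights of the others.
  ∑-weight-id : ∀ xs → AllPairs Apart xs → ∑ᵖ (λ x ys → x * weight x ys) xs ≡ ∑ id xs
  ∑-weight-id [] _ = refl
  ∑-weight-id (t ∷ xs) (q ∷ qs) = begin
    t * weight t xs + ∑ᵖ (λ x ys → x * (v x t * weight x ys)) xs
      ≡⟨ cong₂ _+_ (cong (t *_) (weight-expand t xs q qs))
           (∑ᵖ-cong xs (λ {x} {ys} π → term (proj₁ (Pick-All π q)) (weight x ys))) ⟩
    t * (1# + 2# * S) + ∑ᵖ (λ x ys → x * weight x ys + - (t * 2#) * (weight x ys * (x * (t - x) ⁻¹))) xs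
      ≡⟨ cong (t * (1# + 2# * S) +_) (trans (∑ᵖ-+ _ _ xs) (cong (∑ᵖ _ xs +_) (∑ᵖ-*ˡ _ _ xs))) ⟩
    t * (1# + 2# * S) + (∑ᵖ (λ x ys → x * weight x ys) xs + - (t * 2#) * S)
      ≡⟨ solve 3 (λ t s r → t :* (:1 :+ :2 :* s) :+ (r :+ :- (t :* :2) :* s) := t :+ r) refl t S _ ⟩
    t + ∑ᵖ (λ x ys → x * weight x ys) xs
      ≡⟨ cong (t +_) (∑-weight-id xs qs) ⟩
    t + ∑ id xs ∎
    where
    S = ∑ᵖ (λ x ys → weight x ys * (x * (t - x) ⁻¹)) xs
    term : ∀ {x} → Apart t x → ∀ w → x * (v x t * w) ≡ x * w + - (t * 2#) * (w * (x * (t - x) ⁻¹))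
    term {x} p w = begin
      x * (v x t * w)
        ≡⟨ cong (λ m → x * (m * w)) (v-expand (Apart-sym p)) ⟩
      x * ((1# + 2# * (t * (x - t) ⁻¹)) * w)
        ≡⟨ cong (λ m → x * ((1# + 2# * (t * m)) * w)) (inverse-neg p) ⟩
      x * ((1# + 2# * (t * - (t - x) ⁻¹)) * w)
        ≡⟨ solve 4 (λ x t w i → x :* ((:1 :+ :2 :* (t :* :- i)) :* w) := x :* w :+ :- (t :* :2) :*
             (w :* (x :* i))) refl x t w _ ⟩
      x * w + - (t * 2#) * (w * (x * (t - x) ⁻¹)) ∎

-- Symmetrised sums: alternation, branching rule and Pieri rule.

module Symmetrised (F : OrderedField) where
  open FieldTheory F
  open ≡.≡-Reasoning

  -- Required of all lists of parts, and at every position: marking a part or adding a box leads out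
  -- of the decreasing lists, and exchanges of neighbours lead back.
  Alternating : (List ℕ → Carrier) → Set
  Alternating G = ∀ ps a b β → G (ps ++ a ∷ b ∷ β) ≡ - G (ps ++ b ∷ a ∷ β)

  Alternating-∷ : ∀ {G} → Alternating G → ∀ c → Alternating (λ α → G (c ∷ α))
  Alternating-∷ alt c ps = alt (c ∷ ps)

  Alternating-repeat : ∀ {G} → Alternating G → ∀ a β → G (a ∷ a ∷ β) ≡ 0#
  Alternating-repeat alt a β = double-zero (alt [] a a β)

  SumApart : Carrier → Carrier → Set
  SumApart x y = x + y ≢ 0#

  SumApart-sym : ∀ {x y} → SumApart x y → SumApart y x
  SumApart-sym p e = p (trans (+-comm _ _) e)

  -- The denominators that occur are x - y and x + y for two of the variables and, through the extra
  -- variable 0 in `weight 0#`, also x itself.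
  record Generic (xs : List Carrier) : Set where
    constructor generic
    field
      nonzero : All (_≢ 0#) xs
      apart : AllPairs Apart xs
      sumApart : AllPairs SumApart xs
  open Generic public

  Generic-pick : ∀ {y ys xs} → Pick y ys xs → Generic xs → Generic ys
  Generic-pick π (generic n a s) =
    generic (proj₂ (Pick-All π n)) (proj₂ (Pick-AllPairs Apart-sym π a))
        (proj₂ (Pick-AllPairs SumApart-sym π s))

  -- The reciprocal of `weight u ys`. As a multiplier it trades the poles at u = y for poles at u =
  -- -y, and the residues at these lead back to lists that contain neither u nor y.
  coweight : Carrier → List Carrier → Carrier
  coweight u ys = ∏ (λ y → (u - y) * (u + y) ⁻¹) ys

  -- The partial fraction of `coweight` at u = -y, up to the factor 2, normalised to vanish at u =
  -- 0. The constant left over is then the value of `coweight` at 0, namely `weight 0# ys`.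
  residue : Carrier → Carrier → List Carrier → Carrier
  residue u y ys = weight y ys * (u * (u + y) ⁻¹)

  private
    neg-inverse : ∀ {x} → x ≢ 0# → (- x) ⁻¹ ≡ - x ⁻¹
    neg-inverse {x} p = *-cancelˡ -x≢0 (begin
      - x * (- x) ⁻¹   ≡⟨ inverseʳ -x≢0 ⟩
      1#               ≡⟨ inverseʳ p ⟨
      x * x ⁻¹         ≡⟨ solve 2 (λ x i → x :* i := :- x :* :- i) refl x (x ⁻¹) ⟩
      - x * - x ⁻¹     ∎)
      where
      -x≢0 : - x ≢ 0#
      -x≢0 e = p (begin
        x       ≡⟨ solve 1 (λ x → x := :- :- x) refl x ⟩
        - - x   ≡⟨ cong -_ e ⟩
        - 0#    ≡⟨ solve 0 (:- :0 := :0) refl ⟩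
        0#      ∎)

    -[u+y] : ∀ u y → - u - y ≡ - (u + y)
    -[u+y] = solve 2 (λ u y → :- u :- y := :- (u :+ y)) refl

  weight-coweight : ∀ u ys → All (Apart u) ys → All (SumApart u) ys → coweight u ys * weight u ys ≡ 1#
  weight-coweight u ys ps qs = trans (sym (∏-* _ _ ys)) (∏-one ys (λ {y} m → begin
    (u - y) * (u + y) ⁻¹ * ((u + y) * (u - y) ⁻¹)
      ≡⟨ solve 4 (λ a i b j → a :* i :* (b :* j) := (a :* j) :* (b :* i)) refl (u - y) _ (u + y) _ ⟩
    ((u - y) * (u - y) ⁻¹) * ((u + y) * (u + y) ⁻¹)
      ≡⟨ cong₂ _*_ (inverseʳ (All.lookup ps m)) (inverseʳ (All.lookup qs m)) ⟩
    1# * 1# ≡⟨ *-identityˡ 1# ⟩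
    1# ∎))

  -- The partial fractions of weight (- u) ys.
  coweight-expand : ∀ u ys → All (SumApart u) ys → AllPairs Apart ys →
    coweight u ys ≡ 1# - 2# * ∑ᵖ (λ y zs → weight y zs * (y * (u + y) ⁻¹)) ys
  coweight-expand u ys ps qs = begin
    coweight u ys
      ≡⟨ ∏-cong ys (λ m → factor (All.lookup ps m)) ⟩
    weight (- u) ys
      ≡⟨ weight-expand (- u) ys (All.map (λ {y} p e → p (flip y e)) ps) qs ⟩
    1# + 2# * ∑ᵖ (λ y zs → weight y zs * (y * (- u - y) ⁻¹)) ys
      ≡⟨ cong (λ m → 1# + 2# * m) (∑ᵖ-cong ys (λ {y} {zs} π → term (proj₁ (Pick-All π ps)) (weight y zs))) ⟩
    1# + 2# * ∑ᵖ (λ y zs → - 1# * (weight y zs * (y * (u + y) ⁻¹))) ys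
      ≡⟨ cong (λ m → 1# + 2# * m) (∑ᵖ-*ˡ (- 1#) _ ys) ⟩
    1# + 2# * (- 1# * ∑ᵖ (λ y zs → weight y zs * (y * (u + y) ⁻¹)) ys)
      ≡⟨ solve 1 (λ s → :1 :+ :2 :* (:- :1 :* s) := :1 :- :2 :* s) refl _ ⟩
    1# - 2# * ∑ᵖ (λ y zs → weight y zs * (y * (u + y) ⁻¹)) ys ∎
    where
    flip : ∀ y → - u - y ≡ 0# → u + y ≡ 0#
    flip y e = begin
      u + y      ≡⟨ solve 2 (λ u y → u :+ y := :- (:- u :- y)) refl u y ⟩
      - (- u - y) ≡⟨ cong -_ e ⟩
      - 0#       ≡⟨ solve 0 (:- :0 := :0) refl ⟩
      0#         ∎
    inv′ : ∀ {y} → SumApart u y → (- u - y) ⁻¹ ≡ - (u + y) ⁻¹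
    inv′ {y} p = trans (cong _⁻¹ (-[u+y] u y)) (neg-inverse p)
    factor : ∀ {y} → SumApart u y → (u - y) * (u + y) ⁻¹ ≡ v (- u) y
    factor {y} p = begin
      (u - y) * (u + y) ⁻¹          ≡⟨ solve 3 (λ u y i → (u :- y) :* i := (:- u :+ y) :* :- i) refl u y _ ⟩
      (- u + y) * - (u + y) ⁻¹      ≡⟨ cong ((- u + y) *_) (inv′ p) ⟨
      (- u + y) * (- u - y) ⁻¹      ∎
    term : ∀ {y} → SumApart u y → ∀ w → w * (y * (- u - y) ⁻¹) ≡ - 1# * (w * (y * (u + y) ⁻¹))
    term {y} p w = trans (cong (λ m → w * (y * m)) (inv′ p))
      (solve 3 (λ w y i → w :* (y :* :- i) := :- :1 :* (w :* (y :* i))) refl w y _)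

  -- In `coweight-expand` each y/(u + y) is rewritten as 1 - u/(u + y), and `∑-weight` evaluates the
  -- sum of the constants.
  coweight-residues : ∀ u ys → All (SumApart u) ys → Generic ys →
    coweight u ys ≡ 2# * ∑ᵖ (residue u) ys + weight 0# ys
  coweight-residues u ys ps g = begin
    coweight u ys
      ≡⟨ coweight-expand u ys ps (apart g) ⟩
    1# - 2# * ∑ᵖ (λ y zs → weight y zs * (y * (u + y) ⁻¹)) ys
      ≡⟨ solve 3 (λ r s w → :1 :- :2 :* s := :2 :* (w :- s) :+ (:1 :- :2 :* w)) refl (∑ᵖ (residue u) ys) _
           (∑ᵖ weight ys) ⟩
    2# * (∑ᵖ weight ys - ∑ᵖ (λ y zs → weight y zs * (y * (u + y) ⁻¹)) ys) + (1# - 2# * ∑ᵖ weight ys)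
      ≡⟨ cong₂ (λ m n → 2# * m + n) difference (∑-weight ys (nonzero g) (apart g)) ⟨
    2# * ∑ᵖ (residue u) ys + weight 0# ys ∎
    where
    term : ∀ {y} → SumApart u y → ∀ w → w * (u * (u + y) ⁻¹) ≡ w + - 1# * (w * (y * (u + y) ⁻¹))
    term {y} p w = begin
      w * (u * i)
          ≡⟨ solve 4 (λ w u y i → w :* (u :* i) := w :* ((u :+ y) :* i) :+ :- :1 :* (w :* (y :* i))) refl w u y
          i ⟩
      w * ((u + y) * i) + - 1# * (w * (y * i)) ≡⟨ cong (λ m → w * m + - 1# * (w * (y * i))) (inverseʳ p) ⟩
      w * 1# + - 1# * (w * (y * i))           ≡⟨ cong (_+ - 1# * (w * (y * i))) (*-identityʳ w) ⟩
      w + - 1# * (w * (y * i))                ∎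
      where i = (u + y) ⁻¹
    difference : ∑ᵖ (residue u) ys ≡ ∑ᵖ weight ys - ∑ᵖ (λ y zs → weight y zs * (y * (u + y) ⁻¹)) ys
    difference = begin
      ∑ᵖ (residue u) ys
        ≡⟨ ∑ᵖ-cong ys (λ {y} {zs} π → term (proj₁ (Pick-All π ps)) (weight y zs)) ⟩
      ∑ᵖ (λ y zs → weight y zs + - 1# * (weight y zs * (y * (u + y) ⁻¹))) ys
        ≡⟨ trans (∑ᵖ-+ _ _ ys) (cong (∑ᵖ weight ys +_) (∑ᵖ-*ˡ (- 1#) _ ys)) ⟩
      ∑ᵖ weight ys + - 1# * ∑ᵖ (λ y zs → weight y zs * (y * (u + y) ⁻¹)) ys
        ≡⟨ solve 2 (λ a b → a :+ :- :1 :* b := a :- b) refl _ _ ⟩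
      ∑ᵖ weight ys - ∑ᵖ (λ y zs → weight y zs * (y * (u + y) ⁻¹)) ys ∎

  -- There is no strictness condition: a box that breaks strictness creates two equal neighbouring
  -- parts, and there an alternating `G` is zero.
  addBox : (List ℕ → Carrier) → List ℕ → Carrier
  addBox G [] = G (1 ∷ [])
  addBox G (a ∷ α) = G (suc a ∷ α) + addBox (λ β → G (a ∷ β)) α

  addBox-∑ᵖ : ∀ (c : Carrier → List Carrier → Carrier) (G : List ℕ → Carrier → List Carrier → Carrier) xs α →
    addBox (λ β → ∑ᵖ (λ y ys → c y ys * G β y ys) xs) α ≡ ∑ᵖ (λ y ys → c y ys * addBox (λ β → G β y ys) α) xs
  addBox-∑ᵖ c G xs [] = refl
  addBox-∑ᵖ c G xs (a ∷ α) = trans (cong (∑ᵖ (λ y ys → c y ys * G (suc a ∷ α) y ys) xs +_)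
      (addBox-∑ᵖ c (λ β → G (a ∷ β)) xs α))
    (trans (sym (∑ᵖ-+ _ _ xs)) (∑ᵖ-cong xs (λ _ → sym (distribˡ _ _ _))))

  module _ (pw : Carrier → ℕ → Carrier) where

    -- P_α for pw the powers and P*_α for pw the falling powers: summing over the variable assigned to each part
    -- in turn, instead of over permutations, absorbs the factor 1 / (N - l)!.
    R : List ℕ → List Carrier → Carrier
    R [] xs = 1#
    R (a ∷ α) xs = ∑ᵖ (λ y ys → pw y a * weight y ys * R α ys) xs

    -- Exchanging two neighbouring parts amounts to exchanging the two variables that they pick. Of
    -- all factors only `v y w` depends on the order of these variables, and it is antisymmetric.
    R-alternating : ∀ xs → AllPairs Apart xs → Alternating (λ α → R α xs)
    R-alternating xs ds [] a b β = begin
      ∑ᵖ (λ y ys → pw y a * weight y ys * ∑ᵖ (λ w ws → pw w b * weight w ws * R β ws) ys) xs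
        ≡⟨ ∑ᵖ-cong xs (λ {y} {ys} _ → expand a b y ys) ⟩
      ∑ᵖ (λ y → ∑ᵖ (H a b y)) xs
        ≡⟨ ∑ᵖ-swap (H a b) xs ⟩
      ∑ᵖ (λ y → ∑ᵖ (λ w → H a b w y)) xs
        ≡⟨ ∑ᵖ-cong xs (λ {y} {ys} π → trans (∑ᵖ-cong ys
             (λ {w} {ws} ρ → flip (proj₁ (Pick-All ρ (proj₁ (Pick-AllPairs Apart-sym π ds)))) ws))
             (∑ᵖ-*ˡ (- 1#) _ ys)) ⟩
      ∑ᵖ (λ y ys → - 1# * ∑ᵖ (H b a y) ys) xs
        ≡⟨ ∑ᵖ-*ˡ (- 1#) _ xs ⟩
      - 1# * ∑ᵖ (λ y → ∑ᵖ (H b a y)) xs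
        ≡⟨ solve 1 (λ a → :- :1 :* a := :- a) refl _ ⟩
      - ∑ᵖ (λ y → ∑ᵖ (H b a y)) xs
        ≡⟨ cong -_ (∑ᵖ-cong xs (λ {y} {ys} _ → expand b a y ys)) ⟨
      - R (b ∷ a ∷ β) xs ∎
      where
      H : ℕ → ℕ → Carrier → Carrier → List Carrier → Carrier
      H a b y w ws = pw y a * pw w b * (weight y ws * weight w ws) * v y w * R β ws
      expand : ∀ a b y ys → pw y a * weight y ys * ∑ᵖ (λ w ws → pw w b * weight w ws * R β ws) ys ≡ ∑ᵖ (H a b y)
          ys
      expand a b y ys = trans (sym (∑ᵖ-*ˡ _ _ ys)) (∑ᵖ-cong ys (λ {w} {ws} π → begin
        pw y a * weight y ys * (pw w b * weight w ws * R β ws)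
          ≡⟨ cong (λ m → pw y a * m * (pw w b * weight w ws * R β ws)) (∏-pick (v y) π) ⟩
        pw y a * (v y w * weight y ws) * (pw w b * weight w ws * R β ws)
          ≡⟨ solve 6 (λ p d e q f r → p :* (d :* e) :* (q :* f :* r) := p :* q :* (e :* f) :* d :* r) refl
               (pw y a) (v y w) _ _ _ _ ⟩
        H a b y w ws ∎))
      flip : ∀ {y w} → Apart y w → ∀ ws → H a b w y ws ≡ - 1# * H b a y w ws
      flip {y} {w} p ws = trans (cong (λ m → pw w a * pw y b * (weight w ws * weight y ws) * m * R β ws)
          (v-anti p))
        (solve 6 (λ p q e f d r → p :* q :* (e :* f) :* (:- d) :* r := :- :1 :* (q :* p :* (f :* e) :* d :* r))
            refl _ _ _ _ _ _)
    R-alternating xs ds (c ∷ ps) a b β = begin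
      ∑ᵖ (λ y ys → pw y c * weight y ys * R (ps ++ a ∷ b ∷ β) ys) xs
        ≡⟨ ∑ᵖ-cong xs (λ {y} {ys} π → trans (cong (pw y c * weight y ys *_)
             (R-alternating ys (proj₂ (Pick-AllPairs Apart-sym π ds)) ps a b β))
             (solve 2 (λ a b → a :* :- b := :- :1 :* (a :* b)) refl _ _)) ⟩
      ∑ᵖ (λ y ys → - 1# * (pw y c * weight y ys * R (ps ++ b ∷ a ∷ β) ys)) xs
        ≡⟨ ∑ᵖ-*ˡ (- 1#) _ xs ⟩
      - 1# * R (c ∷ ps ++ b ∷ a ∷ β) xs
        ≡⟨ solve 1 (λ a → :- :1 :* a := :- a) refl _ ⟩
      - R (c ∷ ps ++ b ∷ a ∷ β) xs ∎

    -- A cofactor expansion: u is assigned to one part, and bringing that part to the front costs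
    -- the sign.
    signedDeletion : Carrier → (List ℕ → Carrier) → List ℕ → Carrier
    signedDeletion u G [] = 0#
    signedDeletion u G (a ∷ α) = pw u a * G α - signedDeletion u (λ β → G (a ∷ β)) α

    signedDeletion-∑ᵖ : ∀ u (c : Carrier → List Carrier → Carrier)
        (G : List ℕ → Carrier → List Carrier → Carrier) xs α →
      signedDeletion u (λ β → ∑ᵖ (λ y ys → c y ys * G β y ys) xs) α ≡
      ∑ᵖ (λ y ys → c y ys * signedDeletion u (λ β → G β y ys) α) xs
    signedDeletion-∑ᵖ u c G xs [] = sym (∑ᵖ-zero xs (λ _ → zeroʳ _))
    signedDeletion-∑ᵖ u c G xs (a ∷ α) = begin
      pw u a * ∑ᵖ (λ y ys → c y ys * G α y ys) xs - signedDeletion u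
          (λ β → ∑ᵖ (λ y ys → c y ys * G (a ∷ β) y ys) xs) α
        ≡⟨ cong₂ _-_ (sym (∑ᵖ-*ˡ _ _ xs)) (signedDeletion-∑ᵖ u c (λ β → G (a ∷ β)) xs α) ⟩
      ∑ᵖ (λ y ys → pw u a * (c y ys * G α y ys)) xs - D
        ≡⟨ solve 2 (λ a b → a :- b := a :+ :- :1 :* b) refl _ _ ⟩
      ∑ᵖ (λ y ys → pw u a * (c y ys * G α y ys)) xs + - 1# * D
        ≡⟨ trans (cong (∑ᵖ _ xs +_) (sym (∑ᵖ-*ˡ (- 1#) _ xs))) (sym (∑ᵖ-+ _ _ xs)) ⟩
      ∑ᵖ (λ y ys → pw u a * (c y ys * G α y ys) + - 1# * (c y ys * signedDeletion u (λ β → G (a ∷ β) y ys) α))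
          xs
        ≡⟨ ∑ᵖ-cong xs (λ _ → solve 4 (λ p c g d → p :* (c :* g) :+ :- :1 :* (c :* d) := c :* (p :* g :- d)) refl
             _ _ _ _) ⟩
      ∑ᵖ (λ y ys → c y ys * signedDeletion u (λ β → G β y ys) (a ∷ α)) xs ∎
      where
      D = ∑ᵖ (λ y ys → c y ys * signedDeletion u (λ β → G (a ∷ β) y ys) α) xs

    -- Induction on the parts. If u picks the first part, its weight cancels against the coweight.
    -- If another variable y picks it, then (u - y)/(u + y) times `v y u` is -1, so the expansion of
    -- the remaining parts enters with the opposite sign. This is the sign in `signedDeletion`; in
    -- the other two terms it is compensated.
    branching : ∀ u ys → All (Apart u) ys → All (SumApart u) ys → Generic ys → ∀ α →
      coweight u ys * R α (u ∷ ys) ≡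
      signedDeletion u (λ β → R β ys) α + 2# * ∑ᵖ (λ y zs → residue u y zs * R α zs) ys + weight 0# ys * R α ys
    branching u ys ps qs g [] = begin
      coweight u ys * 1#
        ≡⟨ *-identityʳ _ ⟩
      coweight u ys
        ≡⟨ coweight-residues u ys qs g ⟩
      2# * ∑ᵖ (residue u) ys + weight 0# ys
        ≡⟨ cong₂ (λ m n → 2# * m + n) (∑ᵖ-cong ys (λ _ → sym (*-identityʳ _))) (sym (*-identityʳ _)) ⟩
      2# * ∑ᵖ (λ y zs → residue u y zs * 1#) ys + weight 0# ys * 1#
        ≡⟨ cong (_+ weight 0# ys * 1#) (+-identityˡ _) ⟨
      0# + 2# * ∑ᵖ (λ y zs → residue u y zs * 1#) ys + weight 0# ys * 1# ∎
    branching u ys ps qs g (a ∷ α) = begin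
      K * (pw u a * weight u ys * R α ys + ∑ᵖ (λ y zs → pw y a * (v y u * weight y zs) * R α (u ∷ zs)) ys)
        ≡⟨ solve 5 (λ k p w r s → k :* (p :* w :* r :+ s) := (k :* w) :* (p :* r) :+ k :* s) refl K (pw u a)
             (weight u ys) (R α ys) _ ⟩
      (K * weight u ys) * (pw u a * R α ys) + K * ∑ᵖ (λ y zs → pw y a * (v y u * weight y zs) * R α (u ∷ zs)) ys
        ≡⟨ cong₂ (λ m n → m * (pw u a * R α ys) + n) (weight-coweight u ys ps qs)
             (trans (sym (∑ᵖ-*ˡ K _ ys)) (∑ᵖ-cong ys term)) ⟩
      1# * (pw u a * R α ys) + ∑ᵖ (λ y zs → - 1# * (c y zs * D y zs) +
          (- 2# * ∑ᵖ (λ j js → c y zs * (residue u j js * R α js)) zs + E * (c y zs * R α zs))) ys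
        ≡⟨ cong (1# * (pw u a * R α ys) +_) (trans (∑ᵖ-+ _ _ ys)
             (cong₂ _+_ (∑ᵖ-*ˡ (- 1#) _ ys) (trans (∑ᵖ-+ _ _ ys)
             (cong₂ _+_ (∑ᵖ-*ˡ (- 2#) _ ys) (∑ᵖ-*ˡ E _ ys))))) ⟩
      1# * (pw u a * R α ys) + (- 1# * ∑ᵖ (λ y zs → c y zs * D y zs) ys +
          (- 2# * ∑ᵖ (λ y zs → ∑ᵖ (λ j js → c y zs * (residue u j js * R α js)) zs) ys + E * R (a ∷ α) ys))
        ≡⟨ cong₂ (λ m n → 1# * (pw u a * R α ys) + (- 1# * m + (- 2# * n + E * R (a ∷ α) ys)))
             (sym (signedDeletion-∑ᵖ u c (λ β y zs → R β zs) ys α)) swapped ⟩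
      1# * (pw u a * R α ys) + (- 1# * D′ + (- 2# * (- 1# * S) + E * R (a ∷ α) ys))
        ≡⟨ solve 4 (λ p d s e → :1 :* p :+ (:- :1 :* d :+ (:- :2 :* (:- :1 :* s) :+ e)) := p :- d :+ :2 :* s :+
             e) refl _ _ _ _ ⟩
      (pw u a * R α ys - D′) + 2# * S + E * R (a ∷ α) ys ∎
      where
      K = coweight u ys
      E = weight 0# ys
      c : Carrier → List Carrier → Carrier
      c y zs = pw y a * weight y zs
      D : Carrier → List Carrier → Carrier
      D y zs = signedDeletion u (λ β → R β zs) α
      D′ = signedDeletion u (λ β → R (a ∷ β) ys) α
      S = ∑ᵖ (λ y zs → residue u y zs * R (a ∷ α) zs) ys
      cofactor : ∀ {y} → Apart u y → SumApart u y → (u - y) * (u + y) ⁻¹ * v y u ≡ - 1#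
      cofactor {y} p q = begin
        (u - y) * i * ((y + u) * (y - u) ⁻¹)   ≡⟨ cong (λ m → (u - y) * i * ((y + u) * m)) (inverse-neg p) ⟩
        (u - y) * i * ((y + u) * - j)
            ≡⟨ solve 4 (λ u y i j → (u :- y) :* i :* ((y :+ u) :* :- j) := :-
            (((u :- y) :* j) :* ((u :+ y) :* i))) refl u y i j ⟩
        - (((u - y) * j) * ((u + y) * i))      ≡⟨ cong₂ (λ m n → - (m * n)) (inverseʳ p) (inverseʳ q) ⟩
        - (1# * 1#)                            ≡⟨ cong -_ (*-identityˡ 1#) ⟩
        - 1#                                   ∎
        where
        i = (u + y) ⁻¹
        j = (u - y) ⁻¹
      -- Picking y removes one factor -1 from `weight 0#`, which compensates the sign from
      -- `cofactor`.
      zero-factor : ∀ {y} → y ≢ 0# → v 0# y ≡ - 1#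
      zero-factor {y} p = begin
        (0# + y) * (0# - y) ⁻¹   ≡⟨ cong ((0# + y) *_) (trans (cong _⁻¹ (+-identityˡ _)) (neg-inverse p)) ⟩
        (0# + y) * - y ⁻¹        ≡⟨ solve 2 (λ y i → (:0 :+ y) :* :- i := :- (y :* i)) refl y _ ⟩
        - (y * y ⁻¹)             ≡⟨ cong -_ (inverseʳ p) ⟩
        - 1#                     ∎
      term : ∀ {y zs} → Pick y zs ys → K * (pw y a * (v y u * weight y zs) * R α (u ∷ zs)) ≡
        - 1# * (c y zs * D y zs) + (- 2# * ∑ᵖ (λ j js → c y zs * (residue u j js * R α js)) zs + E *
            (c y zs * R α zs))
      term {y} {zs} π = begin
        K * (pw y a * (v y u * weight y zs) * R α (u ∷ zs))
          ≡⟨ cong (λ m → m * (pw y a * (v y u * weight y zs) * R α (u ∷ zs))) (∏-pick _ π) ⟩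
        (u - y) * (u + y) ⁻¹ * coweight u zs * (pw y a * (v y u * weight y zs) * R α (u ∷ zs))
          ≡⟨ solve 6 (λ f k p w e r → f :* k :* (p :* (w :* e) :* r) := (f :* w) :* (p :* e) :* (k :* r)) refl _
               (coweight u zs) (pw y a) (v y u) _ _ ⟩
        ((u - y) * (u + y) ⁻¹ * v y u) * c y zs * (coweight u zs * R α (u ∷ zs))
          ≡⟨ cong₂ (λ m n → m * c y zs * n) (cofactor (proj₁ (Pick-All π ps)) (proj₁ (Pick-All π qs)))
               (branching u zs (proj₂ (Pick-All π ps)) (proj₂ (Pick-All π qs)) (Generic-pick π g) α) ⟩
        - 1# * c y zs * (D y zs + 2# * Σzs + weight 0# zs * R α zs)
          ≡⟨ solve 5 (λ c d s e r → :- :1 :* c :* (d :+ :2 :* s :+ e :* r) := :- :1 :* (c :* d) :+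
               (:- :2 :* (c :* s) :+ (:- :1 :* e) :* (c :* r))) refl (c y zs) _ _ _ _ ⟩
        - 1# * (c y zs * D y zs) + (- 2# * (c y zs * Σzs) + (- 1# * weight 0# zs) * (c y zs * R α zs))
          ≡⟨ cong₂ (λ m n → - 1# * (c y zs * D y zs) + (- 2# * m + n * (c y zs * R α zs)))
               (sym (∑ᵖ-*ˡ (c y zs) _ zs))
               (sym (trans (∏-pick (v 0#) π) (cong (_* weight 0# zs)
                   (zero-factor (proj₁ (Pick-All π (nonzero g))))))) ⟩
        - 1# * (c y zs * D y zs) + (- 2# * ∑ᵖ (λ j js → c y zs * (residue u j js * R α js)) zs + E *
            (c y zs * R α zs)) ∎
        where Σzs = ∑ᵖ (λ j js → residue u j js * R α js) zs
      -- In the residue terms the sign from `cofactor` is compensated by exchanging the two picked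
      -- variables, as `v y j` is the negative of `v j y`.
      swapped : ∑ᵖ (λ y zs → ∑ᵖ (λ j js → c y zs * (residue u j js * R α js)) zs) ys ≡ - 1# * S
      swapped = begin
        ∑ᵖ (λ y zs → ∑ᵖ (λ j js → c y zs * (residue u j js * R α js)) zs) ys
          ≡⟨ ∑ᵖ-cong ys (λ {y} {zs} π → ∑ᵖ-cong zs
               (λ {j} {js} ρ → move y j (proj₁ (Pick-All ρ (proj₁ (Pick-AllPairs Apart-sym π (apart g))))) zs js
               ρ)) ⟩
        ∑ᵖ (λ y → ∑ᵖ (λ j js → M j y js)) ys
          ≡⟨ ∑ᵖ-swap (λ y j js → M j y js) ys ⟩
        ∑ᵖ (λ j → ∑ᵖ (λ y js → M j y js)) ys
          ≡⟨ ∑ᵖ-cong ys (λ {j} {zs} _ → trans (∑ᵖ-cong zs (λ {y} {js} ρ → regroup j zs y js ρ))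
               (∑ᵖ-*ˡ _ _ zs)) ⟩
        ∑ᵖ (λ j zs → (- 1# * residue u j zs) * R (a ∷ α) zs) ys
          ≡⟨ ∑ᵖ-cong ys (λ _ → *-assoc _ _ _) ⟩
        ∑ᵖ (λ j zs → - 1# * (residue u j zs * R (a ∷ α) zs)) ys
          ≡⟨ ∑ᵖ-*ˡ (- 1#) _ ys ⟩
        - 1# * S ∎
        where
        M : Carrier → Carrier → List Carrier → Carrier
        M j y js = - 1# * (v j y * (weight j js * (u * (u + j) ⁻¹))) * (pw y a * weight y js * R α js)
        move : ∀ y j → Apart y j → ∀ zs js → Pick j js zs → c y zs * (residue u j js * R α js) ≡ M j y js
        move y j p zs js ρ = begin
          pw y a * weight y zs * (weight j js * (u * (u + j) ⁻¹) * R α js)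
            ≡⟨ cong (λ m → pw y a * m * (weight j js * (u * (u + j) ⁻¹) * R α js))
                 (trans (∏-pick (v y) ρ) (cong (_* weight y js) (v-anti (Apart-sym p)))) ⟩
          pw y a * (- v j y * weight y js) * (weight j js * (u * (u + j) ⁻¹) * R α js)
            ≡⟨ solve 5 (λ p d e f r → p :* (:- d :* e) :* (f :* r) := :- :1 :* (d :* f) :* (p :* e :* r)) refl _
                 (v j y) _ _ _ ⟩
          M j y js ∎
        regroup : ∀ j zs y js → Pick y js zs → M j y js ≡ (- 1# * residue u j zs) *
            (pw y a * weight y js * R α js)
        regroup j zs y js ρ = trans
          (cong (λ m → - 1# * m * (pw y a * weight y js * R α js)) (sym (*-assoc _ _ _)))
          (cong (λ m → - 1# * (m * (u * (u + j) ⁻¹)) * (pw y a * weight y js * R α js)) (sym (∏-pick (v j) ρ)))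

    module _ (σ : ℕ → Carrier) (σ-zero : σ 0 ≡ 0#) (pw-zero : ∀ y → pw y 0 ≡ 1#)
             (pw-suc : ∀ y a → pw y (suc a) ≡ pw y a * (y - σ a)) where

      -- If y is the variable picked by the part a, the factor splits into y - σ a, which raises a
      -- by one, and the same factor for the remaining variables and parts. Ordinary powers are the
      -- case σ = 0, falling powers the case σ a = a.
      pieri : ∀ xs → AllPairs Apart xs → ∀ α → (∑ id xs - ∑ σ α) * R α xs ≡ addBox (λ β → R β xs) α
      pieri xs ds [] = begin
        (∑ id xs - 0#) * 1#
          ≡⟨ solve 1 (λ a → (a :- :0) :* :1 := a) refl _ ⟩
        ∑ id xs
          ≡⟨ ∑-weight-id xs ds ⟨
        ∑ᵖ (λ x ys → x * weight x ys) xs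
          ≡⟨ ∑ᵖ-cong xs (λ {x} {ys} _ → trans (cong (_* weight x ys) (sym (linear x))) (sym (*-identityʳ _))) ⟩
        ∑ᵖ (λ x ys → pw x 1 * weight x ys * 1#) xs ∎
        where
        linear : ∀ x → pw x 1 ≡ x
        linear x = trans (pw-suc x 0) (trans (cong₂ (λ m n → m * (x - n)) (pw-zero x) σ-zero)
          (solve 1 (λ x → :1 :* (x :- :0) := x) refl x))
      pieri xs ds (a ∷ α) = begin
        (∑ id xs - (σ a + ∑ σ α)) * R (a ∷ α) xs
          ≡⟨ ∑ᵖ-*ˡ _ _ xs ⟨
        ∑ᵖ (λ y ys → (∑ id xs - (σ a + ∑ σ α)) * (pw y a * weight y ys * R α ys)) xs
          ≡⟨ ∑ᵖ-cong xs term ⟩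
        ∑ᵖ (λ y ys → pw y (suc a) * weight y ys * R α ys + pw y a * weight y ys * addBox (λ β → R β ys) α) xs
          ≡⟨ ∑ᵖ-+ _ _ xs ⟩
        R (suc a ∷ α) xs + ∑ᵖ (λ y ys → pw y a * weight y ys * addBox (λ β → R β ys) α) xs
          ≡⟨ cong (R (suc a ∷ α) xs +_) (sym (addBox-∑ᵖ (λ y ys → pw y a * weight y ys) (λ β y ys → R β ys) xs
               α)) ⟩
        R (suc a ∷ α) xs + addBox (λ β → R (a ∷ β) xs) α ∎
        where
        term : ∀ {y ys} → Pick y ys xs → (∑ id xs - (σ a + ∑ σ α)) * (pw y a * weight y ys * R α ys) ≡
          pw y (suc a) * weight y ys * R α ys + pw y a * weight y ys * addBox (λ β → R β ys) α
        term {y} {ys} π = begin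
          (∑ id xs - (σ a + ∑ σ α)) * (pw y a * weight y ys * R α ys)
            ≡⟨ cong (λ m → (m - (σ a + ∑ σ α)) * (pw y a * weight y ys * R α ys)) (∑-pick id π) ⟩
          ((y + ∑ id ys) - (σ a + ∑ σ α)) * (pw y a * weight y ys * R α ys)
            ≡⟨ solve 7 (λ y p s t q w r → ((y :+ p) :- (s :+ t)) :* (q :* w :* r) := q :* (y :- s) :* w :* r :+
                 q :* w :* ((p :- t) :* r)) refl y (∑ id ys) (σ a) (∑ σ α) (pw y a) (weight y ys) (R α ys) ⟩
          pw y a * (y - σ a) * weight y ys * R α ys + pw y a * weight y ys * ((∑ id ys - ∑ σ α) * R α ys)
            ≡⟨ cong₂ (λ m n → m * weight y ys * R α ys + pw y a * weight y ys * n) (sym (pw-suc y a))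
                 (pieri ys (proj₂ (Pick-AllPairs Apart-sym π ds)) α) ⟩
          pw y (suc a) * weight y ys * R α ys + pw y a * weight y ys * addBox (λ β → R β ys) α ∎

-- Power series in a variable X that records the degree.

module PowerSeries (F : OrderedField) where
  open FieldTheory F

  Series : Set
  Series = ℕ → Carrier

  infix 4 _≈_
  _≈_ : Series → Series → Set
  f ≈ g = ∀ n → f n ≡ g n

  private
    tail : Series → Series
    tail f n = f (suc n)

  infixl 6 _+ˢ_
  infixl 7 _*ˢ_
  infix 8 -ˢ_

  _+ˢ_ _*ˢ_ : Series → Series → Series
  (f +ˢ g) n = f n + g n
  (f *ˢ g) zero = f 0 * g 0
  (f *ˢ g) (suc n) = f 0 * g (suc n) + (tail f *ˢ g) n

  -ˢ_ : Series → Series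
  (-ˢ f) n = - f n

  const : Carrier → Series
  const c zero = c
  const c (suc n) = 0#

  private
    open ≡.≡-Reasoning

    *ˢ-cong : ∀ {f f′ g g′} → f ≈ f′ → g ≈ g′ → f *ˢ g ≈ f′ *ˢ g′
    *ˢ-cong e e′ zero = cong₂ _*_ (e 0) (e′ 0)
    *ˢ-cong e e′ (suc n) = cong₂ _+_ (cong₂ _*_ (e 0) (e′ (suc n))) (*ˢ-cong (λ k → e (suc k)) e′ n)

    zero-*ˢ : ∀ {f} g → (∀ n → f n ≡ 0#) → ∀ n → (f *ˢ g) n ≡ 0#
    zero-*ˢ g e zero = trans (cong (_* g 0) (e 0)) (zeroˡ _)
    zero-*ˢ g e (suc n) = trans (cong₂ _+_ (trans (cong (_* _) (e 0)) (zeroˡ _))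
        (zero-*ˢ g (λ k → e (suc k)) n)) (+-identityˡ 0#)

    *ˢ-sucʳ : ∀ f g n → (f *ˢ g) (suc n) ≡ f (suc n) * g 0 + (f *ˢ tail g) n
    *ˢ-sucʳ f g zero = +-comm _ _
    *ˢ-sucʳ f g (suc n) = trans (cong (_ +_) (*ˢ-sucʳ (tail f) g n))
      (solve 3 (λ a b c → a :+ (b :+ c) := b :+ (a :+ c)) refl _ _ _)

    *ˢ-comm : ∀ f g → f *ˢ g ≈ g *ˢ f
    *ˢ-comm f g zero = *-comm _ _
    *ˢ-comm f g (suc n) = trans (cong₂ _+_ (*-comm _ _) (*ˢ-comm (tail f) g n)) (sym (*ˢ-sucʳ g f n))

    *ˢ-distribʳ : ∀ h f g → (f +ˢ g) *ˢ h ≈ f *ˢ h +ˢ g *ˢ h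
    *ˢ-distribʳ h f g zero = distribʳ _ _ _
    *ˢ-distribʳ h f g (suc n) = trans (cong₂ _+_ (distribʳ _ _ _) (*ˢ-distribʳ h (tail f) (tail g) n))
      (solve 4 (λ a b c d → (a :+ b) :+ (c :+ d) := (a :+ c) :+ (b :+ d)) refl _ _ _ _)

    scale-*ˢ : ∀ c f g n → ((λ k → c * f k) *ˢ g) n ≡ c * (f *ˢ g) n
    scale-*ˢ c f g zero = *-assoc _ _ _
    scale-*ˢ c f g (suc n) = trans (cong₂ _+_ (*-assoc _ _ _) (scale-*ˢ c (tail f) g n)) (sym (distribˡ _ _ _))

    *ˢ-assoc : ∀ f g h → (f *ˢ g) *ˢ h ≈ f *ˢ (g *ˢ h)
    *ˢ-assoc f g h zero = *-assoc _ _ _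
    *ˢ-assoc f g h (suc n) = begin
      f 0 * g 0 * h (suc n) + (tail (f *ˢ g) *ˢ h) n
        ≡⟨ cong (f 0 * g 0 * h (suc n) +_) (*ˢ-distribʳ h (λ k → f 0 * tail g k) (tail f *ˢ g) n) ⟩
      f 0 * g 0 * h (suc n) + (((λ k → f 0 * tail g k) *ˢ h) n + ((tail f *ˢ g) *ˢ h) n)
        ≡⟨ cong₂ (λ a b → f 0 * g 0 * h (suc n) + (a + b)) (scale-*ˢ (f 0) (tail g) h n)
             (*ˢ-assoc (tail f) g h n) ⟩
      f 0 * g 0 * h (suc n) + (f 0 * (tail g *ˢ h) n + (tail f *ˢ (g *ˢ h)) n)
        ≡⟨ solve 5 (λ a b c d e → a :* b :* c :+ (a :* d :+ e) := a :* (b :* c :+ d) :+ e) refl _ _ _ _ _ ⟩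
      f 0 * (g 0 * h (suc n) + (tail g *ˢ h) n) + (tail f *ˢ (g *ˢ h)) n ∎

    *ˢ-identityˡ : ∀ f → const 1# *ˢ f ≈ f
    *ˢ-identityˡ f zero = *-identityˡ _
    *ˢ-identityˡ f (suc n) = trans (cong₂ _+_ (*-identityˡ _) (zero-*ˢ f (λ _ → refl) n)) (+-identityʳ _)

  seriesRing : CommutativeRing 0ℓ 0ℓ
  seriesRing = record
    { Carrier = Series ; _≈_ = _≈_ ; _+_ = _+ˢ_ ; _*_ = _*ˢ_ ; -_ = -ˢ_ ; 0# = λ _ → 0# ; 1# = const 1#
    ; isCommutativeRing = record
      { isRing = record
        { +-isAbelianGroup = record
          { isGroup = record
            { isMonoid = record
              { isSemigroup = record
                { isMagma = record
                  { isEquivalence = record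
                    { refl = λ _ → refl ; sym = λ e n → sym (e n) ; trans = λ e e′ n → trans (e n) (e′ n) }
                  ; ∙-cong = λ e e′ n → cong₂ _+_ (e n) (e′ n) }
                ; assoc = λ _ _ _ _ → +-assoc _ _ _ }
              ; identity = (λ _ _ → +-identityˡ _) , λ _ _ → +-identityʳ _ }
            ; inverse = (λ _ _ → -‿inverseˡ _) , λ _ _ → -‿inverseʳ _
            ; ⁻¹-cong = λ e n → cong -_ (e n) }
          ; comm = λ _ _ _ → +-comm _ _ }
        ; *-cong = *ˢ-cong
        ; *-assoc = *ˢ-assoc
        ; *-identity = *ˢ-identityˡ , λ f n → trans (*ˢ-comm f _ n) (*ˢ-identityˡ f n)
        ; distrib = (λ h f g n → trans (*ˢ-comm h _ n)
            (trans (*ˢ-distribʳ h f g n) (cong₂ _+_ (*ˢ-comm f h n) (*ˢ-comm g h n)))) , *ˢ-distribʳ }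
      ; *-comm = *ˢ-comm }
    }

  module S where
    open CommutativeRing seriesRing public hiding (Carrier; _≈_; _+_; _*_; -_)
    open IntegerCoefficients seriesRing public using (solve)
    open Sums seriesRing public

  scale : Carrier → Series → Series
  scale c f n = c * f n

  const-* : ∀ c f → const c *ˢ f ≈ scale c f
  const-* c f zero = refl
  const-* c f (suc n) = trans (cong (c * f (suc n) +_) (zero-*ˢ f (λ _ → refl) n)) (+-identityʳ _)

  const-cong : ∀ {c d} → c ≡ d → const c ≈ const d
  const-cong refl _ = refl

  const-mul : ∀ c d → const (c * d) ≈ const c *ˢ const d
  const-mul c d zero = refl
  const-mul c d (suc n) = sym (trans (const-* c (const d) (suc n)) (zeroʳ c))

  const-add : ∀ c d → const (c + d) ≈ const c +ˢ const d
  const-add c d zero = refl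
  const-add c d (suc n) = sym (+-identityˡ 0#)

  const-neg : ∀ c → const (- c) ≈ -ˢ const c
  const-neg c zero = refl
  const-neg c (suc n) = solve 0 (:0 := :- :0) refl

  const-∑ᵖ : ∀ {A : Set} (f : A → List A → Carrier) xs → const (∑ᵖ f xs) ≈ S.∑ᵖ (λ y ys → const (f y ys)) xs
  const-∑ᵖ f [] zero = refl
  const-∑ᵖ f [] (suc n) = refl
  const-∑ᵖ f (x ∷ xs) = S.trans (const-add _ _) (S.+-congˡ (const-∑ᵖ _ xs))

  S-∑ᵖ-coefficient : ∀ {A : Set} (f : A → List A → Series) xs n → S.∑ᵖ f xs n ≡ ∑ᵖ (λ y ys → f y ys n) xs
  S-∑ᵖ-coefficient f [] n = refl
  S-∑ᵖ-coefficient f (x ∷ xs) n = cong (f x xs n +_) (S-∑ᵖ-coefficient _ xs n)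

  shift : ℕ → Series → Series
  shift zero f = f
  shift (suc r) f zero = 0#
  shift (suc r) f (suc n) = shift r f n

  shift-cong : ∀ r {f g} → f ≈ g → shift r f ≈ shift r g
  shift-cong zero e = e
  shift-cong (suc r) e zero = refl
  shift-cong (suc r) e (suc n) = shift-cong r e n

  shift-+ : ∀ r f g → shift r (f +ˢ g) ≈ shift r f +ˢ shift r g
  shift-+ zero f g n = refl
  shift-+ (suc r) f g zero = sym (+-identityˡ 0#)
  shift-+ (suc r) f g (suc n) = shift-+ r f g n

  shift-scale : ∀ r c f → shift r (scale c f) ≈ scale c (shift r f)
  shift-scale zero c f n = refl
  shift-scale (suc r) c f zero = sym (zeroʳ c)
  shift-scale (suc r) c f (suc n) = shift-scale r c f n

  shift-shift : ∀ r s f → shift r (shift s f) ≈ shift (r ℕ.+ s) f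
  shift-shift zero s f n = refl
  shift-shift (suc r) s f zero = refl
  shift-shift (suc r) s f (suc n) = shift-shift r s f n

  shift-comm : ∀ r s f → shift r (shift s f) ≈ shift s (shift r f)
  shift-comm r s f = S.trans (shift-shift r s f)
    (S.trans (λ n → cong (λ k → shift k f n) (ℕ.+-comm r s)) (S.sym (shift-shift s r f)))

  shift-zero : ∀ r {f} → (∀ n → f n ≡ 0#) → ∀ n → shift r f n ≡ 0#
  shift-zero zero e = e
  shift-zero (suc r) e zero = refl
  shift-zero (suc r) e (suc n) = shift-zero r e n

  shift-< : ∀ r f {n} → n < r → shift r f n ≡ 0#
  shift-< (suc r) f {zero} _ = refl
  shift-< (suc r) f {suc n} (s≤s l) = shift-< r f l

  shift-≥ : ∀ r f n → shift r f (r ℕ.+ n) ≡ f n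
  shift-≥ zero f n = refl
  shift-≥ (suc r) f n = shift-≥ r f n

  shift-∑ᵖ : ∀ {A : Set} r (f : A → List A → Series) xs n →
    shift r (λ k → ∑ᵖ (λ y ys → f y ys k) xs) n ≡ ∑ᵖ (λ y ys → shift r (f y ys) n) xs
  shift-∑ᵖ zero f xs n = refl
  shift-∑ᵖ (suc r) f xs zero = sym (∑ᵖ-zero xs (λ _ → refl))
  shift-∑ᵖ (suc r) f xs (suc n) = shift-∑ᵖ r f xs n

  -- The range starts at 1 because the index stands for the size of a part.
  sumTo : ℕ → (ℕ → Carrier) → Carrier
  sumTo zero f = 0#
  sumTo (suc m) f = sumTo m f + f (suc m)

  sumTo-cong : ∀ m {f g} → (∀ n → f (suc n) ≡ g (suc n)) → sumTo m f ≡ sumTo m g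
  sumTo-cong zero e = refl
  sumTo-cong (suc m) e = cong₂ _+_ (sumTo-cong m e) (e _)

  sumTo-+ : ∀ m f g → sumTo m (λ n → f n + g n) ≡ sumTo m f + sumTo m g
  sumTo-+ zero f g = sym (+-identityˡ 0#)
  sumTo-+ (suc m) f g = trans (cong (_+ (f (suc m) + g (suc m))) (sumTo-+ m f g))
    (solve 4 (λ a b c d → (a :+ b) :+ (c :+ d) := (a :+ c) :+ (b :+ d)) refl _ _ _ _)

  sumTo-*ˡ : ∀ m c f → sumTo m (λ n → c * f n) ≡ c * sumTo m f
  sumTo-*ˡ zero c f = sym (zeroʳ c)
  sumTo-*ˡ (suc m) c f = trans (cong (_+ c * f (suc m)) (sumTo-*ˡ m c f)) (sym (distribˡ c _ _))

  sumTo-∑ᵖ : ∀ {A : Set} m (f : ℕ → A → List A → Carrier) xs →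
    sumTo m (λ r → ∑ᵖ (f r) xs) ≡ ∑ᵖ (λ y ys → sumTo m (λ r → f r y ys)) xs
  sumTo-∑ᵖ zero f xs = sym (∑ᵖ-zero xs (λ _ → refl))
  sumTo-∑ᵖ (suc m) f xs = trans (cong (_+ ∑ᵖ (f (suc m)) xs) (sumTo-∑ᵖ m f xs)) (sym (∑ᵖ-+ _ _ xs))

  private
    sumTo-suc : ∀ m f → sumTo (suc m) f ≡ f 1 + sumTo m (λ r → f (suc r))
    sumTo-suc zero f = +-comm _ _
    sumTo-suc (suc m) f = trans (cong (_+ f (suc (suc m))) (sumTo-suc m f)) (+-assoc _ _ _)

  -- Shifts by more than k vanish at k, so one bound m serves all degrees up to m.
  product-shifts : ∀ h f m k → k ≤ m → (h *ˢ f) k ≡ h 0 * f k + sumTo m (λ r → h r * shift r f k)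
  product-shifts h f m zero _ = sym (trans (cong (h 0 * f 0 +_) (vanish m)) (+-identityʳ _))
    where
    vanish : ∀ m → sumTo m (λ r → h r * shift r f 0) ≡ 0#
    vanish zero = refl
    vanish (suc m) = trans (cong₂ _+_ (vanish m) (zeroʳ _)) (+-identityˡ 0#)
  product-shifts h f (suc m) (suc k) (s≤s l) = cong (h 0 * f (suc k) +_)
    (trans (product-shifts (tail h) f m k l) (sym (sumTo-suc m (λ r → h r * shift r f (suc k)))))

  infix 4 _≈[_]_
  -- A sum over partitions with parts at most b sees all partitions only up to degree b, so
  -- identities between such series are stated up to a degree.
  _≈[_]_ : Series → ℕ → Series → Set
  f ≈[ m ] g = ∀ k → k ≤ m → f k ≡ g k

  private
    *-cong-≤ˡ : ∀ {f f′ m} g → f ≈[ m ] f′ → f *ˢ g ≈[ m ] f′ *ˢ g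
    *-cong-≤ˡ g e zero l = cong (_* g 0) (e 0 l)
    *-cong-≤ˡ {m = suc m} g e (suc k) (s≤s l) =
      cong₂ _+_ (cong (_* g (suc k)) (e 0 z≤n)) (*-cong-≤ˡ g (λ i i≤m → e (suc i) (s≤s i≤m)) k l)

  *-cong-≤ : ∀ {f f′ g g′ m} → f ≈[ m ] f′ → g ≈[ m ] g′ → f *ˢ g ≈[ m ] f′ *ˢ g′
  *-cong-≤ {f} {f′} {g} {g′} e e′ k l = trans (*-cong-≤ˡ g e k l)
    (trans (*ˢ-comm f′ g k) (trans (*-cong-≤ˡ f′ e′ k l) (*ˢ-comm g′ f′ k)))

  -- A series with constant term 1 can be divided out degree by degree, which respects truncation.
  *-cancelʳ-≤ : ∀ {f g} h → h 0 ≡ 1# → ∀ m → f *ˢ h ≈[ m ] g *ˢ h → f ≈[ m ] g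
  *-cancelʳ-≤ {f} {g} h h0 m e k l = go m k l e
    where
    difference : ∀ a b x y → x ≡ y → a + x ≡ b + y → a ≡ b
    difference a b x y refl p = x-y≡0⇒x≡y (trans (solve 3 (λ a b x → a :- b := (a :+ x) :- (b :+ x)) refl a b x)
        (trans (cong (_- (b + x)) p) (-‿inverseʳ _)))
    go : ∀ m k → k ≤ m → f *ˢ h ≈[ m ] g *ˢ h → f k ≡ g k
    below : ∀ m → f *ˢ h ≈[ m ] g *ˢ h → f ≈[ m ] g
    go m zero l e = *-cancelˡ (λ h≡0 → 1≢0 (trans (sym h0) h≡0))
        (trans (*-comm _ _) (trans (e 0 l) (*-comm _ _)))
    go (suc m) (suc k) (s≤s l) e = unit (difference _ _ _ _
        (trans (*ˢ-comm f (tail h) k) (trans (*-cong-≤ {tail h} {tail h} (λ _ _ → refl)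
            (below m (λ i i≤m → e i (ℕ.m≤n⇒m≤1+n i≤m))) k l) (*ˢ-comm (tail h) g k)))
        (trans (sym (*ˢ-sucʳ f h k)) (trans (e (suc k) (s≤s l)) (*ˢ-sucʳ g h k))))
      where
      unit : f (suc k) * h 0 ≡ g (suc k) * h 0 → f (suc k) ≡ g (suc k)
      unit p = trans (sym (trans (cong (_ *_) h0) (*-identityʳ _)))
          (trans p (trans (cong (_ *_) h0) (*-identityʳ _)))
    below m e i i≤m = go m i i≤m e

  -- The derivation X d/dX. It preserves degrees, and logarithmic derivatives taken with it have no
  -- constant term.
  D : Series → Series
  D f n = fromℕ n * f n

  D-cong : ∀ {f g} → f ≈ g → D f ≈ D g
  D-cong e n = cong (fromℕ n *_) (e n)

  D-product : ∀ f g → D (f *ˢ g) ≈ D f *ˢ g +ˢ f *ˢ D g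
  D-product f g zero = solve 2 (λ a b → :0 :* (a :* b) := :0 :* a :* b :+ a :* (:0 :* b)) refl _ _
  D-product f g (suc n) = begin
    (1# + fromℕ n) * (f 0 * g (suc n) + (tail f *ˢ g) n)
      ≡⟨ solve 4 (λ m a b c → (:1 :+ m) :* (a :* b :+ c) := (a :* ((:1 :+ m) :* b) :+ (c :+ m :* c))) refl
           (fromℕ n) (f 0) (g (suc n)) _ ⟩
    f 0 * D g (suc n) + ((tail f *ˢ g) n + D (tail f *ˢ g) n)
      ≡⟨ cong (λ m → f 0 * D g (suc n) + ((tail f *ˢ g) n + m)) (D-product (tail f) g n) ⟩
    f 0 * D g (suc n) + ((tail f *ˢ g) n + ((D (tail f) *ˢ g) n + (tail f *ˢ D g) n))
      ≡⟨ solve 6 (λ a b c d e f → a :* b :+ (c :+ (d :+ e)) := (:0 :* a :* f :+ (c :+ d)) :+ (a :* b :+ e)) refl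
           (f 0) (D g (suc n)) _ _ _ (g (suc n)) ⟩
    (0# * f 0 * g (suc n) + ((tail f *ˢ g) n + (D (tail f) *ˢ g) n)) + (f *ˢ D g) (suc n)
      ≡⟨ cong (λ m → (0# * f 0 * g (suc n) + m) + (f *ˢ D g) (suc n)) (*ˢ-distribʳ g (tail f) (D (tail f)) n) ⟨
    (0# * f 0 * g (suc n) + ((tail f +ˢ D (tail f)) *ˢ g) n) + (f *ˢ D g) (suc n)
      ≡⟨ cong (λ m → (0# * f 0 * g (suc n) + m) + (f *ˢ D g) (suc n))
           (*ˢ-cong {g = g} {g} (λ k → solve 2 (λ a m → a :+ m :* a := (:1 :+ m) :* a) refl (f (suc k))
               (fromℕ k)) (λ _ → refl) n) ⟩
    (D f *ˢ g) (suc n) + (f *ˢ D g) (suc n) ∎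

  -- As h has no constant term, D f = h f expresses n fₙ through coefficients of f below n, and n is
  -- invertible.
  D-unique : ∀ h {f g} m → h 0 ≡ 0# → f 0 ≡ g 0 → D f ≈[ m ] h *ˢ f → D g ≈[ m ] h *ˢ g → f ≈[ m ] g
  D-unique h {f} {g} m h0 e p q k l = agree k k ℕ.≤-refl l
    where
    agree : ∀ n k → k ≤ n → k ≤ m → f k ≡ g k
    agree _ zero _ _ = e
    agree (suc n) (suc k) (s≤s k≤n) l = *-cancelˡ (fromℕ-suc≢0 k) (begin
      D f (suc k)                        ≡⟨ p (suc k) l ⟩
      h 0 * f (suc k) + (tail h *ˢ f) k  ≡⟨ cong₂ _+_
          (trans (cong (_* _) h0) (trans (zeroˡ _) (sym (trans (cong (_* _) h0) (zeroˡ _)))))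
                                                (*-cong-≤ {tail h} {tail h} {f} {g} (λ _ _ → refl)
                                                    (λ i i≤k → agree n i (ℕ.≤-trans i≤k k≤n)
                                                    (ℕ.≤-trans i≤k (ℕ.≤-trans (ℕ.n≤1+n k) l))) k ℕ.≤-refl) ⟩
      h 0 * g (suc k) + (tail h *ˢ g) k  ≡⟨ q (suc k) l ⟨
      D g (suc k)                        ∎)

-- The Cauchy kernel and its recursion in the variables y.

module Kernel (F : OrderedField) where
  open FieldTheory F
  open Symmetrised F
  open PowerSeries F

  monomial : ℕ → Series
  monomial r = shift r (const 1#)

  monomial-* : ∀ r f → monomial r *ˢ f ≈ shift r f
  monomial-* zero f = S.*-identityˡ f
  monomial-* (suc r) f zero = zeroˡ _
  monomial-* (suc r) f (suc n) = trans (cong₂ _+_ (zeroˡ _) (monomial-* r f n)) (+-identityˡ _)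

  2ˢ : Series
  2ˢ = S.1# +ˢ S.1#

  2ˢ-* : ∀ f → 2ˢ *ˢ f ≈ f +ˢ f
  2ˢ-* = S.solve 1 (λ f → :2 :* f := f :+ f) S.refl

  -- The series cX/(1 - cX).
  geometric : Carrier → Series
  geometric c zero = 0#
  geometric c (suc n) = c ^ suc n

  -- The series (1 + cX)/(1 - cX), written in the same shape as in `v-expand`.
  q : Carrier → Series
  q c = S.1# +ˢ 2ˢ *ˢ geometric c

  -- This recursion replaces division by 1 - ctX. The constants t and c remain separate factors so
  -- that `geometric-*` can exchange t with w.
  geometric-step : ∀ c t → geometric (c * t) ≈ const t *ˢ (const c *ˢ monomial 1) *ˢ (S.1# +ˢ geometric (c * t))
  geometric-step c t n = trans (go n) (sym (factor n))
    where
    g = S.1# +ˢ geometric (c * t)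
    go : geometric (c * t) ≈ scale t (scale c (shift 1 g))
    go zero = solve 2 (λ t c → :0 := t :* (c :* :0)) refl t c
    go (suc zero) = solve 2 (λ t c → c :* t :* :1 := t :* (c :* (:1 :+ :0))) refl t c
    go (suc (suc n)) = solve 3 (λ t c p → c :* t :* p := t :* (c :* (:0 :+ p))) refl t c _
    factor : const t *ˢ (const c *ˢ monomial 1) *ˢ g ≈ scale t (scale c (shift 1 g))
    factor = S.trans (S.solve 4 (λ t c m g → t :* (c :* m) :* g := t :* (c :* (m :* g))) S.refl (const t)
        (const c) (monomial 1) g)
      (S.trans (const-* t _) (λ n → cong (t *_) (trans (const-* c _ n) (cong (c *_) (monomial-* 1 g n)))))

  private
    -- Partial fractions in X with denominators cleared. The recursion applied to b, and backwards
    -- to a, makes the terms that are quadratic in the geometric series cancel.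
    geometric-* : ∀ {a b} c t w → a ≡ c * t → b ≡ c * w →
      (const t S.- const w) *ˢ (geometric a *ˢ geometric b) ≈ const w *ˢ geometric a S.- const t *ˢ geometric b
    geometric-* c t w refl refl = begin
      (T S.- W) *ˢ (a *ˢ b)
        ≈⟨ S.solve 4 (λ t w a b → (t :- w) :* (a :* b) := t :* (b :* (:1 :+ a)) :- t :* b :- w :* a :* (:1 :+ b)
             :+ w :* a) S.refl T W a b ⟩
      T *ˢ (b *ˢ (S.1# +ˢ a)) S.- T *ˢ b S.- W *ˢ a *ˢ (S.1# +ˢ b) +ˢ W *ˢ a
        ≈⟨ S.+-congʳ (S.+-congʳ (S.+-congʳ (S.*-congˡ (S.*-congʳ (geometric-step c w))))) ⟩
      T *ˢ (W *ˢ X *ˢ (S.1# +ˢ b) *ˢ (S.1# +ˢ a)) S.- T *ˢ b S.- W *ˢ a *ˢ (S.1# +ˢ b) +ˢ W *ˢ a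
        ≈⟨ S.solve 5 (λ t w x a b → t :* (w :* x :* (:1 :+ b) :* (:1 :+ a)) :- t :* b :- w :* a :* (:1 :+ b) :+
             w :* a
             := w :* (t :* x :* (:1 :+ a)) :* (:1 :+ b) :- t :* b :- w :* a :* (:1 :+ b) :+ w :* a) S.refl T W X
                 a b ⟩
      W *ˢ (T *ˢ X *ˢ (S.1# +ˢ a)) *ˢ (S.1# +ˢ b) S.- T *ˢ b S.- W *ˢ a *ˢ (S.1# +ˢ b) +ˢ W *ˢ a
        ≈⟨ S.+-congʳ (S.+-congʳ (S.+-congʳ (S.*-congʳ (S.*-congˡ (geometric-step c t))))) ⟨
      W *ˢ a *ˢ (S.1# +ˢ b) S.- T *ˢ b S.- W *ˢ a *ˢ (S.1# +ˢ b) +ˢ W *ˢ a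
        ≈⟨ S.solve 4 (λ t w a b → w :* a :* (:1 :+ b) :- t :* b :- w :* a :* (:1 :+ b) :+ w :* a := w :* a :- t
             :* b) S.refl T W a b ⟩
      W *ˢ a S.- T *ˢ b ∎
      where
      open import Relation.Binary.Reasoning.Setoid S.setoid
      T = const t
      W = const w
      X = const c *ˢ monomial 1
      a = geometric (c * t)
      b = geometric (c * w)

    geometric-*-coefficient : ∀ {a b} c t w → a ≡ c * t → b ≡ c * w → ∀ n →
      (t - w) * (geometric a *ˢ geometric b) n ≡ w * geometric a n - t * geometric b n
    geometric-*-coefficient {a} {b} c t w p p′ n = begin
      (t - w) * G n                     ≡⟨ solve 3 (λ t w g → (t :- w) :* g := t :* g :+ :- (w :* g)) refl t w
          (G n) ⟩
      t * G n + - (w * G n)             ≡⟨ cong₂ (λ m k → m + - k) (const-* t G n) (const-* w G n) ⟨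
      (const t *ˢ G) n + - (const w *ˢ G) n
        ≡⟨ S.solve 3 (λ t w g → t :* g :+ :- (w :* g) := (t :- w) :* g) S.refl (const t) (const w) G n ⟩
      ((const t S.- const w) *ˢ G) n    ≡⟨ geometric-* c t w p p′ n ⟩
      (const w *ˢ geometric a) n - (const t *ˢ geometric b) n ≡⟨ cong₂ _-_ (const-* w _ n) (const-* t _ n) ⟩
      w * geometric a n - t * geometric b n ∎
      where
      open ≡.≡-Reasoning
      G = geometric a *ˢ geometric b

    geometric-apart : ∀ {a b} c t w → a ≡ c * t → b ≡ c * w → Apart t w → ∀ n →
      (geometric a *ˢ geometric b) n ≡ w * (t - w) ⁻¹ * geometric a n - t * (t - w) ⁻¹ * geometric b n
    geometric-apart {a} {b} c t w p p′ r n = *-cancelˡ r (begin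
      (t - w) * (geometric a *ˢ geometric b) n
        ≡⟨ geometric-*-coefficient c t w p p′ n ⟩
      w * geometric a n - t * geometric b n
        ≡⟨ *-identityˡ _ ⟨
      1# * (w * geometric a n - t * geometric b n)
        ≡⟨ cong (_* (w * geometric a n - t * geometric b n)) (inverseʳ r) ⟨
      (t - w) * i * (w * geometric a n - t * geometric b n)
        ≡⟨ solve 5 (λ t w i a b → (t :- w) :* i :* (w :* a :- t :* b) := (t :- w) :*
             (w :* i :* a :- t :* i :* b)) refl t w i _ _ ⟩
      (t - w) * (w * i * geometric a n - t * i * geometric b n) ∎)
      where
      open ≡.≡-Reasoning
      i = (t - w) ⁻¹

    geometric-sumApart : ∀ x u y → SumApart u y →
      geometric (x * u) *ˢ geometric (- x * y) ≈
      -ˢ (const (y * (u + y) ⁻¹) *ˢ geometric (x * u) +ˢ const (u * (u + y) ⁻¹) *ˢ geometric (- x * y))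
    geometric-sumApart x u y p n = begin
      (geometric (x * u) *ˢ geometric (- x * y)) n
        ≡⟨ geometric-apart x u (- y) refl (solve 2 (λ x y → :- x :* y := x :* :- y) refl x y)
             (λ e → p (trans (sym minus) e)) n ⟩
      - y * (u - - y) ⁻¹ * g - u * (u - - y) ⁻¹ * h
        ≡⟨ cong (λ m → - y * m ⁻¹ * g - u * m ⁻¹ * h) minus ⟩
      - y * j * g - u * j * h
        ≡⟨ solve 5 (λ y j g u h → :- y :* j :* g :- u :* j :* h := :- (y :* j :* g :+ u :* j :* h)) refl y j g u
             h ⟩
      - (y * j * g + u * j * h)
        ≡⟨ cong₂ (λ m k → - (m + k)) (const-* (y * j) _ n) (const-* (u * j) _ n) ⟨
      - ((const (y * j) *ˢ geometric (x * u)) n + (const (u * j) *ˢ geometric (- x * y)) n) ∎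
      where
      open ≡.≡-Reasoning
      g = geometric (x * u) n
      h = geometric (- x * y) n
      j = (u + y) ⁻¹
      minus : u - - y ≡ u + y
      minus = solve 2 (λ u y → u :- :- y := u :+ y) refl u y

  open import Relation.Binary.Reasoning.Setoid S.setoid

  const-2 : const 2# ≈ 2ˢ
  const-2 = const-add 1# 1#

  -- Adjoining a variable -y to the kernel therefore removes y. The proof of `kernel-recursion`
  -- removes variables on both sides in this way. The computation is the case t = 1, w = -1 of
  -- `geometric-*`.
  q-inverse : ∀ {c d} → d ≡ - c → q c *ˢ q d ≈ S.1#
  q-inverse {c} {d} p = begin
    q c *ˢ q d
      ≈⟨ S.solve 2 (λ g h → (:1 :+ :2 :* g) :* (:1 :+ :2 :* h) := :1 :+ :2 :*
           ((:1 :- :- :1) :* (g :* h) :- (:- :1 :* g :- :1 :* h))) S.refl g h ⟩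
    S.1# +ˢ 2ˢ *ˢ ((S.1# S.- (-ˢ S.1#)) *ˢ (g *ˢ h) S.- ((-ˢ S.1#) *ˢ g S.- S.1# *ˢ h))
      ≈⟨ S.+-congˡ (S.*-congˡ (S.+-cong (S.trans (S.*-congʳ (S.+-congˡ (S.-‿cong (S.sym (const-neg 1#)))))
           (geometric-* c 1# (- 1#) (sym (*-identityʳ c))
               (trans p (solve 1 (λ c → :- c := c :* :- :1) refl c))))
           (S.-‿cong (S.+-congʳ (S.*-congʳ (S.sym (const-neg 1#))))))) ⟩
    S.1# +ˢ 2ˢ *ˢ ((const (- 1#) *ˢ g S.- S.1# *ˢ h) S.- (const (- 1#) *ˢ g S.- S.1# *ˢ h))
      ≈⟨ S.solve 2 (λ a b → :1 :+ :2 :* ((a :- b) :- (a :- b)) := :1) S.refl (const (- 1#) *ˢ g) (S.1# *ˢ h) ⟩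
    S.1# ∎
    where
    g = geometric c
    h = geometric d

  -- This is `weight-expand` at t = 1/X and the points c y: there `v` becomes `q (c * y)` and x/(t -
  -- x) becomes a geometric series, while the weights do not change under scaling by c. As 1/X is
  -- not a power series, the induction is carried out anew.
  q-expand : ∀ c ys → AllPairs Apart ys →
    S.∏ (λ y → q (c * y)) ys ≈ S.1# +ˢ 2ˢ *ˢ S.∑ᵖ (λ y zs → const (weight y zs) *ˢ geometric (c * y)) ys
  q-expand c [] _ = S.solve 0 (:1 := :1 :+ :2 :* :0) S.refl
  q-expand c (t ∷ xs) (p ∷ ps) = begin
    q (c * t) *ˢ S.∏ (λ y → q (c * y)) xs
      ≈⟨ S.*-congˡ (q-expand c xs ps) ⟩
    (S.1# +ˢ 2ˢ *ˢ g) *ˢ (S.1# +ˢ 2ˢ *ˢ A)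
      ≈⟨ S.solve 2 (λ g a → (:1 :+ :2 :* g) :* (:1 :+ :2 :* a) := :1 :+ :2 :* (g :+ (:1 :+ :2 :* g) :* a))
           S.refl g A ⟩
    S.1# +ˢ 2ˢ *ˢ (g +ˢ (S.1# +ˢ 2ˢ *ˢ g) *ˢ A)
      ≈⟨ S.+-congˡ (S.*-congˡ (S.+-congˡ step)) ⟩
    S.1# +ˢ 2ˢ *ˢ (g +ˢ (g *ˢ (2ˢ *ˢ const B) +ˢ C))
      ≈⟨ S.solve 3 (λ g b c → :1 :+ :2 :* (g :+ (g :* (:2 :* b) :+ c)) := :1 :+ :2 :*
           ((:1 :+ :2 :* b) :* g :+ c)) S.refl g (const B) C ⟩
    S.1# +ˢ 2ˢ *ˢ ((S.1# +ˢ 2ˢ *ˢ const B) *ˢ g +ˢ C)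
      ≈⟨ S.+-congˡ (S.*-congˡ (S.+-congʳ (S.*-congʳ (S.sym coefficient)))) ⟩
    S.1# +ˢ 2ˢ *ˢ (const (weight t xs) *ˢ g +ˢ C) ∎
    where
    g = geometric (c * t)
    A = S.∑ᵖ (λ x ys → const (weight x ys) *ˢ geometric (c * x)) xs
    B = ∑ᵖ (λ x ys → weight x ys * (x * (t - x) ⁻¹)) xs
    C = S.∑ᵖ (λ x ys → const (v x t * weight x ys) *ˢ geometric (c * x)) xs
    coefficient : const (weight t xs) ≈ S.1# +ˢ 2ˢ *ˢ const B
    coefficient = S.trans (const-cong (weight-expand t xs p ps))
        (S.trans (const-add _ _) (S.+-congˡ (S.trans (const-mul _ _) (S.*-congʳ const-2))))
    term : ∀ {x} → Apart t x → ∀ w →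
      (S.1# +ˢ 2ˢ *ˢ g) *ˢ (const w *ˢ geometric (c * x)) ≈ (g *ˢ 2ˢ) *ˢ const (w * (x * (t - x) ⁻¹)) +ˢ const
          (v x t * w) *ˢ geometric (c * x)
    term {x} r w = λ n → trans (expand n) (trans (pointwise n) (sym (collect n)))
      where
      h = geometric (c * x)
      i = (t - x) ⁻¹
      expand : (S.1# +ˢ 2ˢ *ˢ g) *ˢ (const w *ˢ h) ≈ scale w (h +ˢ (g *ˢ h +ˢ g *ˢ h))
      expand = S.trans (S.solve 3 (λ g w h → (:1 :+ :2 :* g) :* (w :* h) := w :* (h :+ (g :* h :+ g :* h)))
          S.refl g (const w) h) (const-* w _)
      collect : (g *ˢ 2ˢ) *ˢ const (w * (x * i)) +ˢ const (v x t * w) *ˢ h ≈ scale (w * (x * i)) (g +ˢ g) +ˢ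
          scale (v x t * w) h
      collect = S.+-cong (S.trans (S.solve 2 (λ g w → (g :* :2) :* w := w :* (g :+ g)) S.refl g _)
          (const-* _ _)) (const-* _ _)
      pointwise : ∀ n → w * (h n + ((g *ˢ h) n + (g *ˢ h) n)) ≡ w * (x * i) * (g n + g n) + v x t * w * h n
      pointwise n = ≡-R.begin
        w * (h n + ((g *ˢ h) n + (g *ˢ h) n))
          ≡-R.≡⟨ cong (λ m → w * (h n + (m + m))) (geometric-apart c t x refl refl r n) ⟩
        w * (h n + ((x * i * g n - t * i * h n) + (x * i * g n - t * i * h n)))
          ≡-R.≡⟨ solve 6 (λ w x i g t h → w :*
              (h :+ ((x :* i :* g :- t :* i :* h) :+ (x :* i :* g :- t :* i :* h)))
               := w :* (x :* i) :* (g :+ g) :+ (:1 :+ :2 :* (t :* :- i)) :* w :* h) refl w x i (g n) t (h n) ⟩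
        w * (x * i) * (g n + g n) + (1# + 2# * (t * - i)) * w * h n
          ≡-R.≡⟨ cong (λ m → w * (x * i) * (g n + g n) + m * w * h n)
              (trans (cong (λ m → 1# + 2# * (t * m)) (sym (inverse-neg r))) (sym (v-expand (Apart-sym r)))) ⟩
        w * (x * i) * (g n + g n) + v x t * w * h n ≡-R.∎
        where module ≡-R = ≡.≡-Reasoning
    step : (S.1# +ˢ 2ˢ *ˢ g) *ˢ A ≈ g *ˢ (2ˢ *ˢ const B) +ˢ C
    step = begin
      (S.1# +ˢ 2ˢ *ˢ g) *ˢ A
        ≈⟨ S.∑ᵖ-*ˡ _ _ xs ⟨
      S.∑ᵖ (λ x ys → (S.1# +ˢ 2ˢ *ˢ g) *ˢ (const (weight x ys) *ˢ geometric (c * x))) xs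
        ≈⟨ S.∑ᵖ-cong xs (λ {x} {ys} π → term (proj₁ (Pick-All π p)) (weight x ys)) ⟩
      S.∑ᵖ (λ x ys → (g *ˢ 2ˢ) *ˢ const (weight x ys * (x * (t - x) ⁻¹)) +ˢ const (v x t * weight x ys) *ˢ
          geometric (c * x)) xs
        ≈⟨ S.trans (S.∑ᵖ-+ _ _ xs) (S.+-congʳ (S.∑ᵖ-*ˡ (g *ˢ 2ˢ) _ xs)) ⟩
      (g *ˢ 2ˢ) *ˢ S.∑ᵖ (λ x ys → const (weight x ys * (x * (t - x) ⁻¹))) xs +ˢ C
        ≈⟨ S.+-congʳ (S.trans (S.*-congˡ (S.sym (const-∑ᵖ _ xs))) (S.*-assoc _ _ _)) ⟩
      g *ˢ (2ˢ *ˢ const B) +ˢ C ∎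

  kernel : List Carrier → List Carrier → Series
  kernel ys xs = S.∏ (λ x → S.∏ (λ y → q (x * y)) ys) xs

  kernel-pick : ∀ {y zs ys} → Pick y zs ys → ∀ xs → kernel ys xs ≈ S.∏ (λ x → q (x * y)) xs *ˢ kernel zs xs
  kernel-pick π xs = S.trans (S.∏-cong xs (λ {x} _ → S.∏-pick (λ y → q (x * y)) π)) (S.∏-* _ _ xs)

  -- A vertex operator: a new part r in front is carried by the variable x, and `geometric (x * u)`
  -- sums x^r u^r over all r ≥ 1.
  vertex : Carrier → (List Carrier → Series) → List Carrier → Series
  vertex u h xs = S.∑ᵖ (λ x xs′ → const (weight x xs′) *ˢ (geometric (x * u) *ˢ h xs′)) xs

  -- The counterpart of `branching`. By `q-inverse`, each kernel with some x or y removed is `Φ`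
  -- times a product of factors q at negated arguments. Once these products are expanded by
  -- `q-expand`, the sums `Z` cancel and κ Φ (1 + 2E) remains, where 1 + 2E is the product of the
  -- factors that u adds.
  kernel-recursion : ∀ u ys xs → All (Apart u) ys → All (SumApart u) ys → Generic ys → AllPairs Apart xs →
    const (coweight u ys) *ˢ kernel (u ∷ ys) xs ≈
    2ˢ *ˢ vertex u (kernel ys) xs +ˢ 2ˢ *ˢ S.∑ᵖ (λ y zs → const (residue u y zs) *ˢ kernel zs xs) ys +ˢ const
        (weight 0# ys) *ˢ kernel ys xs
  kernel-recursion u ys xs ps qs gy ds = S.sym (begin
    2ˢ *ˢ vertex u (kernel ys) xs +ˢ 2ˢ *ˢ T +ˢ const (weight 0# ys) *ˢ Φ
      ≈⟨ S.+-congʳ (S.+-congʳ (S.*-congˡ vertex-kernel)) ⟩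
    2ˢ *ˢ (Φ *ˢ (κ *ˢ E S.- 2ˢ *ˢ Z)) +ˢ 2ˢ *ˢ T +ˢ const (weight 0# ys) *ˢ Φ
      ≈⟨ S.solve 6 (λ f k e z t w → :2 :* (f :* (k :* e :- :2 :* z)) :+ :2 :* t :+ w :* f
           := k :* (f :* (:1 :+ :2 :* e)) :- :2 :* (f :* (:2 :* z)) :+ :2 :* t :+ (w :- k) :* f) S.refl Φ κ E Z
               T (const (weight 0# ys)) ⟩
    κ *ˢ (Φ *ˢ (S.1# +ˢ 2ˢ *ˢ E)) S.- 2ˢ *ˢ (Φ *ˢ (2ˢ *ˢ Z)) +ˢ 2ˢ *ˢ T +ˢ (const (weight 0# ys) S.- κ) *ˢ Φ
      ≈⟨ S.+-cong (S.+-congʳ (S.+-cong (S.*-congˡ extend) (S.-‿cong (S.*-congˡ remove))))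
           (S.*-congʳ (S.+-congˡ (S.-‿cong κ-split))) ⟩
    κ *ˢ kernel (u ∷ ys) xs S.- 2ˢ *ˢ (T S.- const ρ *ˢ Φ) +ˢ 2ˢ *ˢ T +ˢ
        (const (weight 0# ys) S.- (2ˢ *ˢ const ρ +ˢ const (weight 0# ys))) *ˢ Φ
      ≈⟨ S.solve 5 (λ k t r f w → k :- :2 :* (t :- r :* f) :+ :2 :* t :+ (w :- (:2 :* r :+ w)) :* f := k) S.refl
           (κ *ˢ kernel (u ∷ ys) xs) T (const ρ) Φ (const (weight 0# ys)) ⟩
    κ *ˢ kernel (u ∷ ys) xs ∎)
    where
    Φ = kernel ys xs
    κ = const (coweight u ys)
    T = S.∑ᵖ (λ y zs → const (residue u y zs) *ˢ kernel zs xs) ys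
    ρ = ∑ᵖ (residue u) ys
    E = S.∑ᵖ (λ x xs′ → const (weight x xs′) *ˢ geometric (x * u)) xs
    G : Carrier → Series
    G y = S.∑ᵖ (λ x xs′ → const (weight x xs′) *ˢ geometric (- x * y)) xs
    Z = S.∑ᵖ (λ y zs → const (residue u y zs) *ˢ G y) ys
    κ-split : κ ≈ 2ˢ *ˢ const ρ +ˢ const (weight 0# ys)
    κ-split = S.trans (const-cong (coweight-residues u ys qs gy))
        (S.trans (const-add _ _) (S.+-congʳ (S.trans (const-mul _ _) (S.*-congʳ const-2))))
    expand-over-xs : ∀ c → S.∏ (λ x → q (x * c)) xs ≈ S.1# +ˢ 2ˢ *ˢ S.∑ᵖ
        (λ x xs′ → const (weight x xs′) *ˢ geometric (x * c)) xs
    expand-over-xs c = S.trans (S.∏-cong xs (λ {x} _ n → cong (λ m → q m n) (*-comm x c)))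
      (S.trans (q-expand c xs ds) (S.+-congˡ (S.*-congˡ
          (S.∑ᵖ-cong xs (λ {x} {xs′} _ → S.*-congˡ {const (weight x xs′)}
          (λ n → cong (λ m → geometric m n) (*-comm c x)))))))
    extend : Φ *ˢ (S.1# +ˢ 2ˢ *ˢ E) ≈ kernel (u ∷ ys) xs
    extend = S.trans (S.*-congˡ (S.sym (expand-over-xs u)))
        (S.trans (S.*-comm _ _) (S.sym (kernel-pick {u} {ys} here xs)))
    cancel : ∀ {y zs} → Pick y zs ys → Φ *ˢ (S.1# +ˢ 2ˢ *ˢ G y) ≈ kernel zs xs
    cancel {y} {zs} π = begin
      Φ *ˢ (S.1# +ˢ 2ˢ *ˢ G y)
        ≈⟨ S.*-congˡ (S.+-congˡ (S.*-congˡ (S.∑ᵖ-cong xs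
             (λ {x} {xs′} _ → S.*-congˡ {const (weight x xs′)}
             (λ n → cong (λ m → geometric m n) (solve 2 (λ x y → :- x :* y := x :* :- y) refl x y)))))) ⟩
      Φ *ˢ (S.1# +ˢ 2ˢ *ˢ S.∑ᵖ (λ x xs′ → const (weight x xs′) *ˢ geometric (x * - y)) xs)
        ≈⟨ S.*-cong (kernel-pick π xs) (S.sym (expand-over-xs (- y))) ⟩
      S.∏ (λ x → q (x * y)) xs *ˢ kernel zs xs *ˢ S.∏ (λ x → q (x * - y)) xs
        ≈⟨ S.solve 3 (λ a b c → a :* b :* c := (a :* c) :* b) S.refl _ _ _ ⟩
      (S.∏ (λ x → q (x * y)) xs *ˢ S.∏ (λ x → q (x * - y)) xs) *ˢ kernel zs xs
        ≈⟨ S.*-congʳ (S.trans (S.sym (S.∏-* _ _ xs))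
             (S.∏-one xs (λ {x} _ → q-inverse (solve 2 (λ x y → x :* :- y := :- (x :* y)) refl x y)))) ⟩
      S.1# *ˢ kernel zs xs
        ≈⟨ S.*-identityˡ _ ⟩
      kernel zs xs ∎
    remove : Φ *ˢ (2ˢ *ˢ Z) ≈ T S.- const ρ *ˢ Φ
    remove = begin
      Φ *ˢ (2ˢ *ˢ Z)
        ≈⟨ S.trans (S.sym (S.*-assoc _ _ _)) (S.sym (S.∑ᵖ-*ˡ (Φ *ˢ 2ˢ) _ ys)) ⟩
      S.∑ᵖ (λ y zs → Φ *ˢ 2ˢ *ˢ (const (residue u y zs) *ˢ G y)) ys
        ≈⟨ S.∑ᵖ-cong ys (λ {y} {zs} π → S.trans
             (S.solve 3 (λ f r g → f :* :2 :* (r :* g) := r :* (f :* (:1 :+ :2 :* g)) :+ (:- f) :* r) S.refl Φ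
                 (const (residue u y zs)) (G y))
             (S.+-congʳ (S.*-congˡ (cancel π)))) ⟩
      S.∑ᵖ (λ y zs → const (residue u y zs) *ˢ kernel zs xs +ˢ (-ˢ Φ) *ˢ const (residue u y zs)) ys
        ≈⟨ S.trans (S.∑ᵖ-+ _ _ ys) (S.+-congˡ
             (S.trans (S.∑ᵖ-*ˡ (-ˢ Φ) _ ys) (S.*-congˡ (S.sym (const-∑ᵖ _ ys))))) ⟩
      T +ˢ (-ˢ Φ) *ˢ const ρ
        ≈⟨ S.solve 3 (λ t f r → t :+ (:- f) :* r := t :- r :* f) S.refl T Φ (const ρ) ⟩
      T S.- const ρ *ˢ Φ ∎
    drop-x : ∀ {x xs′} → Pick x xs′ xs → kernel ys xs′ ≈ Φ *ˢ S.∏ (λ y → q (- x * y)) ys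
    drop-x {x} {xs′} π = S.sym (begin
      Φ *ˢ S.∏ (λ y → q (- x * y)) ys
        ≈⟨ S.*-congʳ (S.∏-pick _ π) ⟩
      S.∏ (λ y → q (x * y)) ys *ˢ kernel ys xs′ *ˢ S.∏ (λ y → q (- x * y)) ys
        ≈⟨ S.solve 3 (λ a b c → a :* b :* c := (a :* c) :* b) S.refl _ _ _ ⟩
      (S.∏ (λ y → q (x * y)) ys *ˢ S.∏ (λ y → q (- x * y)) ys) *ˢ kernel ys xs′
        ≈⟨ S.*-congʳ (S.trans (S.sym (S.∏-* _ _ ys))
             (S.∏-one ys (λ {y} _ → q-inverse (solve 2 (λ x y → :- x :* y := :- (x :* y)) refl x y)))) ⟩
      S.1# *ˢ kernel ys xs′
        ≈⟨ S.*-identityˡ _ ⟩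
      kernel ys xs′ ∎)
    -- The coefficient of `geometric (x * u)` collects to 1 - 2μ, which is `coweight u ys` by
    -- `coweight-expand`.
    split : ∀ x → geometric (x * u) *ˢ S.∏ (λ y → q (- x * y)) ys ≈
      κ *ˢ geometric (x * u) S.- 2ˢ *ˢ S.∑ᵖ (λ y zs → const (residue u y zs) *ˢ geometric (- x * y)) ys
    split x = begin
      g *ˢ S.∏ (λ y → q (- x * y)) ys
        ≈⟨ S.*-congˡ (q-expand (- x) ys (apart gy)) ⟩
      g *ˢ (S.1# +ˢ 2ˢ *ˢ S.∑ᵖ (λ y zs → const (weight y zs) *ˢ geometric (- x * y)) ys)
        ≈⟨ S.solve 2 (λ g a → g :* (:1 :+ :2 :* a) := g :+ :2 :* (g :* a)) S.refl g _ ⟩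
      g +ˢ 2ˢ *ˢ (g *ˢ S.∑ᵖ (λ y zs → const (weight y zs) *ˢ geometric (- x * y)) ys)
        ≈⟨ S.+-congˡ (S.*-congˡ (S.trans (S.sym (S.∑ᵖ-*ˡ g _ ys))
             (S.∑ᵖ-cong ys (λ {y} {zs} π → term (proj₁ (Pick-All π qs)) (weight y zs))))) ⟩
      g +ˢ 2ˢ *ˢ S.∑ᵖ (λ y zs → (-ˢ g) *ˢ const (weight y zs * (y * (u + y) ⁻¹)) +ˢ (-ˢ S.1#) *ˢ
          (const (residue u y zs) *ˢ geometric (- x * y))) ys
        ≈⟨ S.+-congˡ (S.*-congˡ (S.trans (S.∑ᵖ-+ _ _ ys)
             (S.+-cong (S.trans (S.∑ᵖ-*ˡ (-ˢ g) _ ys) (S.*-congˡ (S.sym (const-∑ᵖ _ ys))))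
             (S.∑ᵖ-*ˡ (-ˢ S.1#) _ ys)))) ⟩
      g +ˢ 2ˢ *ˢ ((-ˢ g) *ˢ const μ +ˢ (-ˢ S.1#) *ˢ V)
        ≈⟨ S.solve 3 (λ g m v → g :+ :2 :* ((:- g) :* m :+ (:- :1) :* v) := (:1 :+ (:- (:2 :* m))) :* g :- :2 :*
             v) S.refl g (const μ) V ⟩
      (S.1# +ˢ (-ˢ (2ˢ *ˢ const μ))) *ˢ g S.- 2ˢ *ˢ V
        ≈⟨ S.+-congʳ (S.*-congʳ (S.trans (S.+-congˡ
             (S.trans (S.-‿cong (S.trans (S.*-congʳ (S.sym const-2)) (S.sym (const-mul _ _))))
             (S.sym (const-neg _)))) (S.trans (S.sym (const-add _ _))
             (const-cong (sym (coweight-expand u ys qs (apart gy))))))) ⟩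
      κ *ˢ g S.- 2ˢ *ˢ V ∎
      where
      g = geometric (x * u)
      μ = ∑ᵖ (λ y zs → weight y zs * (y * (u + y) ⁻¹)) ys
      V = S.∑ᵖ (λ y zs → const (residue u y zs) *ˢ geometric (- x * y)) ys
      term : ∀ {y} → SumApart u y → ∀ w → g *ˢ (const w *ˢ geometric (- x * y)) ≈
        (-ˢ g) *ˢ const (w * (y * (u + y) ⁻¹)) +ˢ (-ˢ S.1#) *ˢ
            (const (w * (u * (u + y) ⁻¹)) *ˢ geometric (- x * y))
      term {y} r w = begin
        g *ˢ (const w *ˢ h)
          ≈⟨ S.solve 3 (λ g w h → g :* (w :* h) := w :* (g :* h)) S.refl g (const w) h ⟩
        const w *ˢ (g *ˢ h)
          ≈⟨ S.*-congˡ (geometric-sumApart x u y r) ⟩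
        const w *ˢ (-ˢ (const (y * j) *ˢ g +ˢ const (u * j) *ˢ h))
          ≈⟨ S.solve 5 (λ w a g b h → w :* (:- (a :* g :+ b :* h)) := (:- g) :* (w :* a) :+ (:- :1) :*
               ((w :* b) :* h)) S.refl (const w) (const (y * j)) g (const (u * j)) h ⟩
        (-ˢ g) *ˢ (const w *ˢ const (y * j)) +ˢ (-ˢ S.1#) *ˢ ((const w *ˢ const (u * j)) *ˢ h)
          ≈⟨ S.+-cong (S.*-congˡ (S.sym (const-mul _ _))) (S.*-congˡ (S.*-congʳ (S.sym (const-mul _ _)))) ⟩
        (-ˢ g) *ˢ const (w * (y * j)) +ˢ (-ˢ S.1#) *ˢ (const (w * (u * j)) *ˢ h) ∎
        where
        h = geometric (- x * y)
        j = (u + y) ⁻¹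
    vertex-kernel : vertex u (kernel ys) xs ≈ Φ *ˢ (κ *ˢ E S.- 2ˢ *ˢ Z)
    vertex-kernel = begin
      vertex u (kernel ys) xs
        ≈⟨ S.∑ᵖ-cong xs (λ {x} {xs′} π → S.trans
             (S.*-congˡ (S.trans (S.*-congˡ (drop-x π)) (S.trans (swap-factors _ _ _) (S.*-congˡ (split x)))))
             (S.solve 5 (λ w f k g v → w :* (f :* (k :* g :- :2 :* v)) := (f :* k) :* (w :* g) :+ (:- (:2 :* f))
                 :* (w :* v)) S.refl (const (weight x xs′)) Φ κ (geometric (x * u)) _)) ⟩
      S.∑ᵖ (λ x xs′ → (Φ *ˢ κ) *ˢ (const (weight x xs′) *ˢ geometric (x * u)) +ˢ (-ˢ (2ˢ *ˢ Φ)) *ˢ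
          (const (weight x xs′) *ˢ S.∑ᵖ (λ y zs → const (residue u y zs) *ˢ geometric (- x * y)) ys)) xs
        ≈⟨ S.trans (S.∑ᵖ-+ _ _ xs) (S.+-cong (S.∑ᵖ-*ˡ _ _ xs)
             (S.trans (S.∑ᵖ-*ˡ _ _ xs) (S.*-congˡ interchange))) ⟩
      (Φ *ˢ κ) *ˢ E +ˢ (-ˢ (2ˢ *ˢ Φ)) *ˢ Z
        ≈⟨ S.solve 4 (λ f k e z → (f :* k) :* e :+ (:- (:2 :* f)) :* z := f :* (k :* e :- :2 :* z)) S.refl Φ κ E
             Z ⟩
      Φ *ˢ (κ *ˢ E S.- 2ˢ *ˢ Z) ∎
      where
      swap-factors : ∀ a b c → a *ˢ (b *ˢ c) ≈ b *ˢ (a *ˢ c)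
      swap-factors = S.solve 3 (λ a b c → a :* (b :* c) := b :* (a :* c)) S.refl
      interchange : S.∑ᵖ (λ x xs′ → const (weight x xs′) *ˢ S.∑ᵖ
          (λ y zs → const (residue u y zs) *ˢ geometric (- x * y)) ys) xs ≈ Z
      interchange = begin
        S.∑ᵖ (λ x xs′ → const (weight x xs′) *ˢ S.∑ᵖ (λ y zs → const (residue u y zs) *ˢ geometric (- x * y))
            ys) xs
          ≈⟨ S.∑ᵖ-cong xs (λ _ → S.sym (S.∑ᵖ-*ˡ _ _ ys)) ⟩
        S.∑ᵖ (λ x xs′ → S.∑ᵖ (λ y zs → const (weight x xs′) *ˢ (const (residue u y zs) *ˢ geometric (- x * y)))
            ys) xs
          ≈⟨ S.∑ᵖ-comm _ xs ys ⟩
        S.∑ᵖ (λ y zs → S.∑ᵖ (λ x xs′ → const (weight x xs′) *ˢ (const (residue u y zs) *ˢ geometric (- x * y)))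
            xs) ys
          ≈⟨ S.∑ᵖ-cong ys (λ {y} {zs} _ → S.trans (S.∑ᵖ-cong xs (λ _ → swap-factors _ _ _)) (S.∑ᵖ-*ˡ _ _ xs)) ⟩
        Z ∎

-- Generating series of strict partitions and the Cauchy identity.

data Strict : ℕ → List ℕ → Set where
  []  : ∀ {b} → Strict b []
  _∷_ : ∀ {a b α} → a < b → Strict a α → Strict b (suc a ∷ α)

Strict-≤ : ∀ {a b α} → a ≤ b → Strict a α → Strict b α
Strict-≤ l [] = []
Strict-≤ l (m ∷ s) = ℕ.<-≤-trans m l ∷ s

module StrictSums (F : OrderedField) where
  open FieldTheory F
  open Symmetrised F
  open PowerSeries F
  open Kernel F
  open ≡.≡-Reasoning

  strictSum : ℕ → (List ℕ → Carrier) → Series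
  strictSum b G n = ∑ G (strictPartsB b n)

  strictSum-zero : ∀ G → strictSum 0 G ≈ const (G [])
  strictSum-zero G zero = +-identityʳ _
  strictSum-zero G (suc n) = refl

  -- All later inductions over strict partitions run along this recursion in the bound, according to
  -- whether the part b + 1 occurs.
  strictSum-suc : ∀ b G → strictSum (suc b) G ≈ strictSum b G +ˢ shift (suc b)
      (strictSum b (λ α → G (suc b ∷ α)))
  strictSum-suc b G n = trans (∑-++ G (strictPartsB b n) _) (cong (strictSum b G n +_) (rest (suc b ≤? n)))
    where
    H = strictSum b (λ α → G (suc b ∷ α))
    rest : Dec (suc b ≤ n) →
      ∑ G (if suc b ≤ᵇ n then map (suc b ∷_) (strictPartsB b (n ∸ suc b)) else []) ≡ shift (suc b) H n
    rest (yes l) with suc b ≤ᵇ n | ℕ.≤⇒≤ᵇ l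
    ... | true | _ = trans (∑-map G _ (strictPartsB b (n ∸ suc b)))
      (trans (sym (shift-≥ (suc b) H (n ∸ suc b))) (cong (shift (suc b) H) (ℕ.m+[n∸m]≡n l)))
    rest (no l) with suc b ≤ᵇ n in eq
    ... | true = contradiction (ℕ.≤ᵇ⇒≤ (suc b) n (subst Bool.T (sym eq) tt)) l
    ... | false = sym (shift-< (suc b) H (ℕ.≰⇒> l))

  strictSum-cong : ∀ b {G H} → (∀ {α} → Strict b α → G α ≡ H α) → strictSum b G ≈ strictSum b H
  strictSum-cong zero {G} {H} e = S.trans (strictSum-zero G)
      (S.trans (const-cong (e [])) (S.sym (strictSum-zero H)))
  strictSum-cong (suc b) {G} {H} e = S.trans (strictSum-suc b G) (S.trans
    (S.+-cong (strictSum-cong b (λ s → e (Strict-≤ (ℕ.n≤1+n b) s)))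
        (shift-cong (suc b) (strictSum-cong b (λ s → e (ℕ.n<1+n b ∷ s)))))
    (S.sym (strictSum-suc b H)))

  strictSum-vanish : ∀ b {G} → (∀ α → G α ≡ 0#) → ∀ n → strictSum b G n ≡ 0#
  strictSum-vanish b e n = ∑-zero (strictPartsB b n) (λ _ → e _)

  strictSum-+ : ∀ b G H → strictSum b (λ α → G α + H α) ≈ strictSum b G +ˢ strictSum b H
  strictSum-+ b G H n = ∑-+ G H (strictPartsB b n)

  strictSum-scale : ∀ b c G → strictSum b (λ α → c * G α) ≈ scale c (strictSum b G)
  strictSum-scale b c G n = ∑-*ˡ c G (strictPartsB b n)

  -- Both sides sum over a strict partition with a marked part; G (r ∷ α) vanishes when r already occurs in α.
  marked-part : ∀ pw u b (G H : List ℕ → Carrier) → Alternating G → ∀ n →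
    strictSum b (λ α → G α * signedDeletion pw u H α) n ≡
    sumTo b (λ r → pw u r * shift r (strictSum b (λ α → G (r ∷ α) * H α)) n)
  marked-part pw u zero G H alt n = strictSum-vanish-[] n
    where
    strictSum-vanish-[] : ∀ n → strictSum 0 (λ α → G α * signedDeletion pw u H α) n ≡ 0#
    strictSum-vanish-[] zero = solve 1 (λ g → g :* :0 :+ :0 := :0) refl (G [])
    strictSum-vanish-[] (suc n) = refl
  marked-part pw u (suc b) G H alt n = begin
    strictSum (suc b) (λ α → G α * signedDeletion pw u H α) n
      ≡⟨ strictSum-suc b _ n ⟩
    strictSum b (λ α → G α * signedDeletion pw u H α) n
      + shift (suc b) (strictSum b (λ α → G (suc b ∷ α) * (p * H α - signedDeletion pw u H′ α))) n
      ≡⟨ cong₂ _+_ (marked-part pw u b G H alt n) (trans (shift-cong (suc b) split n) (shift-+ (suc b) _ _ n)) ⟩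
    sumTo b (λ r → pw u r * shift r (strictSum b (λ α → G (r ∷ α) * H α)) n)
      + (shift (suc b) (scale p top) n + shift (suc b) rest n)
      ≡⟨ cong (λ m → A + m) (cong₂ _+_ (shift-scale (suc b) p top n) (shift-sumTo b rest f n rest-expand)) ⟩
    A + (p * shift (suc b) top n + sumTo b (λ r → shift (suc b) (f r) n))
      ≡⟨ solve 3 (λ a b c → a :+ (b :+ c) := (a :+ c) :+ b) refl _ _ _ ⟩
    (A + sumTo b (λ r → shift (suc b) (f r) n)) + p * shift (suc b) top n
      ≡⟨ cong₂ _+_ (trans (sym (sumTo-+ b _ _)) (sumTo-cong b collect))
           (cong (p *_) (shift-cong (suc b) (S.sym top-collect) n)) ⟩
    sumTo (suc b) (λ r → pw u r * shift r (strictSum (suc b) (λ α → G (r ∷ α) * H α)) n) ∎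
    where
    p = pw u (suc b)
    H′ : List ℕ → Carrier
    H′ α = H (suc b ∷ α)
    A = sumTo b (λ r → pw u r * shift r (strictSum b (λ α → G (r ∷ α) * H α)) n)
    top = strictSum b (λ α → G (suc b ∷ α) * H α)
    rest : Series
    rest k = - 1# * strictSum b (λ α → G (suc b ∷ α) * signedDeletion pw u H′ α) k
    f : ℕ → Series
    f r k = pw u r * shift r (strictSum b (λ α → G (r ∷ suc b ∷ α) * H′ α)) k
    shift-sumTo : ∀ m g (f : ℕ → Series) n → (∀ k → g k ≡ sumTo m (λ r → f r k)) → shift (suc b) g n ≡ sumTo m
        (λ r → shift (suc b) (f r) n)
    shift-sumTo m g f n e = trans (shift-cong (suc b) e n) (go m n)
      where
      go : ∀ m n → shift (suc b) (λ k → sumTo m (λ r → f r k)) n ≡ sumTo m (λ r → shift (suc b) (f r) n)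
      go zero n = shift-zero (suc b) (λ _ → refl) n
      go (suc m) n = trans (shift-+ (suc b) _ (f (suc m)) n) (cong (_+ shift (suc b) (f (suc m)) n) (go m n))
    split : strictSum b (λ α → G (suc b ∷ α) * (p * H α - signedDeletion pw u H′ α)) ≈ scale p top +ˢ rest
    split n = trans (∑-cong (strictPartsB b n)
        (λ {α} _ → solve 4 (λ g p h d → g :* (p :* h :- d) := p :* (g :* h) :+ :- :1 :* (g :* d)) refl
        (G (suc b ∷ α)) p _ _))
      (trans (strictSum-+ b _ _ n) (cong₂ _+_ (strictSum-scale b p _ n) (strictSum-scale b (- 1#) _ n)))
    rest-expand : ∀ k → rest k ≡ sumTo b (λ r → f r k)
    rest-expand k = trans (cong (- 1# *_) (marked-part pw u b (λ α → G (suc b ∷ α)) H′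
        (Alternating-∷ {G} alt (suc b)) k))
      (trans (sym (sumTo-*ˡ b (- 1#) _)) (sumTo-cong b (λ i → swap-sign (suc i))))
      where
      -- Moving r in front of the part b + 1 absorbs the sign from `signedDeletion`.
      swap-sign : ∀ r → - 1# * (pw u r * shift r (strictSum b (λ α → G (suc b ∷ r ∷ α) * H′ α)) k) ≡ f r k
      swap-sign r = trans (solve 2 (λ p s → :- :1 :* (p :* s) := p :* (:- :1 :* s)) refl (pw u r) _)
        (cong (pw u r *_) (trans (sym (shift-scale r (- 1#) _ k))
            (shift-cong r (λ i → trans (sym (strictSum-scale b (- 1#) _ i))
          (∑-cong (strictPartsB b i) (λ {α} _ → trans (cong (λ m → - 1# * (m * H′ α)) (alt [] (suc b) r α))
            (solve 2 (λ g h → :- :1 :* (:- g :* h) := g :* h) refl _ _)))) k)))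
    collect : ∀ i → let r = suc i in
      pw u r * shift r (strictSum b (λ α → G (r ∷ α) * H α)) n + shift (suc b) (f r) n ≡
      pw u r * shift r (strictSum (suc b) (λ α → G (r ∷ α) * H α)) n
    collect i = begin
      pw u r * X + shift (suc b) (f r) n
        ≡⟨ cong (pw u r * X +_) (trans (shift-scale (suc b) (pw u r) _ n)
             (cong (pw u r *_) (shift-comm (suc b) r _ n))) ⟩
      pw u r * X + pw u r * shift r (shift (suc b) Y) n
        ≡⟨ distribˡ _ _ _ ⟨
      pw u r * (X + shift r (shift (suc b) Y) n)
        ≡⟨ cong (pw u r *_) (trans (sym (shift-+ r _ _ n)) (shift-cong r (S.sym (strictSum-suc b _)) n)) ⟩
      pw u r * shift r (strictSum (suc b) (λ α → G (r ∷ α) * H α)) n ∎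
      where
      r = suc i
      X = shift r (strictSum b (λ α → G (r ∷ α) * H α)) n
      Y = strictSum b (λ α → G (r ∷ suc b ∷ α) * H′ α)
    top-collect : strictSum (suc b) (λ α → G (suc b ∷ α) * H α) ≈ top
    top-collect n = trans (strictSum-suc b _ n) (trans
      (cong (top n +_) (shift-zero (suc b) (strictSum-vanish b
          (λ α → trans (cong (_* H′ α) (Alternating-repeat {G} alt (suc b) α)) (zeroˡ _))) n))
      (+-identityʳ _))

  P : List ℕ → List Carrier → Carrier
  P = R _^_

  cauchySum : ℕ → List Carrier → List Carrier → Series
  cauchySum b ys xs = strictSum b (λ α → 2# ^ length α * P α xs * P α ys)

  private
    scaled-alternating : ∀ xs → AllPairs Apart xs → Alternating (λ α → 2# ^ length α * P α xs)
    scaled-alternating xs ds ps a b β = begin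
      2# ^ length (ps ++ a ∷ b ∷ β) * P (ps ++ a ∷ b ∷ β) xs
        ≡⟨ cong₂ (λ m k → 2# ^ m * k) (trans (List.length-++ ps) (sym (List.length-++ ps)))
             (R-alternating _^_ xs ds ps a b β) ⟩
      2# ^ length (ps ++ b ∷ a ∷ β) * - P (ps ++ b ∷ a ∷ β) xs
        ≡⟨ solve 2 (λ a b → a :* :- b := :- (a :* b)) refl _ _ ⟩
      - (2# ^ length (ps ++ b ∷ a ∷ β) * P (ps ++ b ∷ a ∷ β) xs) ∎

    -- The power u^r of the deleted part meets x^r from the same part, now at the head of
    -- `P (r ∷ α) xs`, and the sum over r is `geometric (x * u)`. The marked part also contributes
    -- the factor 2. Parts up to b suffice in degrees up to b.
    vertex-part : ∀ b u ys xs → AllPairs Apart xs → ∀ n → n ≤ b →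
      strictSum b (λ α → 2# ^ length α * P α xs * signedDeletion _^_ u (λ β → P β ys) α) n ≡
          (2ˢ *ˢ vertex u (cauchySum b ys) xs) n
    vertex-part b u ys xs ds n l = begin
      strictSum b (λ α → 2# ^ length α * P α xs * signedDeletion _^_ u (λ β → P β ys) α) n
        ≡⟨ marked-part _^_ u b _ _ (scaled-alternating xs ds) n ⟩
      sumTo b (λ r → u ^ r * shift r (strictSum b (λ α → 2# ^ suc (length α) * P (r ∷ α) xs * P α ys)) n)
        ≡⟨ sumTo-cong b (λ i → cong (u ^ suc i *_)
             (trans (shift-cong (suc i) (head (suc i)) n)
             (shift-∑ᵖ (suc i) (λ x xs′ → scale (2# * (x ^ suc i * weight x xs′)) (Ψ xs′)) xs n))) ⟩
      sumTo b (λ r → u ^ r * ∑ᵖ (λ x xs′ → shift r (scale (2# * (x ^ r * weight x xs′)) (Ψ xs′)) n) xs)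
        ≡⟨ sumTo-cong b (λ i → ∑ᵖ-*ˡ _ _ xs) ⟨
      sumTo b (λ r → ∑ᵖ (λ x xs′ → u ^ r * shift r (scale (2# * (x ^ r * weight x xs′)) (Ψ xs′)) n) xs)
        ≡⟨ sumTo-∑ᵖ b _ xs ⟩
      ∑ᵖ (λ x xs′ → sumTo b (λ r → u ^ r * shift r (scale (2# * (x ^ r * weight x xs′)) (Ψ xs′)) n)) xs
        ≡⟨ ∑ᵖ-cong xs (λ {x} {xs′} _ → term x xs′) ⟩
      ∑ᵖ (λ x xs′ → 2# * (const (weight x xs′) *ˢ (geometric (x * u) *ˢ Ψ xs′)) n) xs
        ≡⟨ ∑ᵖ-*ˡ 2# _ xs ⟩
      2# * ∑ᵖ (λ x xs′ → (const (weight x xs′) *ˢ (geometric (x * u) *ˢ Ψ xs′)) n) xs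
        ≡⟨ cong (2# *_) (S-∑ᵖ-coefficient _ xs n) ⟨
      2# * vertex u Ψ xs n
        ≡⟨ solve 1 (λ a → :2 :* a := a :+ a) refl _ ⟩
      vertex u Ψ xs n + vertex u Ψ xs n
        ≡⟨ 2ˢ-* (vertex u Ψ xs) n ⟨
      (2ˢ *ˢ vertex u Ψ xs) n ∎
      where
      Ψ = cauchySum b ys
      head : ∀ r k → strictSum b (λ α → 2# ^ suc (length α) * P (r ∷ α) xs * P α ys) k ≡ ∑ᵖ
          (λ x xs′ → scale (2# * (x ^ r * weight x xs′)) (Ψ xs′) k) xs
      head r k = begin
        strictSum b (λ α → 2# ^ suc (length α) * P (r ∷ α) xs * P α ys) k
          ≡⟨ ∑-cong (strictPartsB b k) (λ {α} _ → trans
               (solve 4 (λ t l p q → t :* l :* p :* q := (t :* l :* q) :* p) refl 2# (2# ^ length α) _ _)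
               (sym (∑ᵖ-*ˡ _ _ xs))) ⟩
        strictSum b (λ α → ∑ᵖ (λ x xs′ → (2# * 2# ^ length α * P α ys) * (x ^ r * weight x xs′ * P α xs′)) xs) k
          ≡⟨ ∑ᵖ-∑ _ (strictPartsB b k) xs ⟨
        ∑ᵖ (λ x xs′ → strictSum b (λ α → (2# * 2# ^ length α * P α ys) * (x ^ r * weight x xs′ * P α xs′)) k) xs
          ≡⟨ ∑ᵖ-cong xs (λ {x} {xs′} _ → trans (∑-cong (strictPartsB b k) (λ {α} _ →
               solve 6 (λ t l q c w p → (t :* l :* q) :* (c :* w :* p) := (t :* (c :* w)) :* (l :* p :* q)) refl
                   2# (2# ^ length α) (P α ys) (x ^ r) (weight x xs′) (P α xs′)))
               (strictSum-scale b _ _ k)) ⟩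
        ∑ᵖ (λ x xs′ → scale (2# * (x ^ r * weight x xs′)) (Ψ xs′) k) xs ∎
      term : ∀ x xs′ → sumTo b (λ r → u ^ r * shift r (scale (2# * (x ^ r * weight x xs′)) (Ψ xs′)) n) ≡
        2# * (const (weight x xs′) *ˢ (geometric (x * u) *ˢ Ψ xs′)) n
      term x xs′ = begin
        sumTo b (λ r → u ^ r * shift r (scale (2# * (x ^ r * weight x xs′)) (Ψ xs′)) n)
          ≡⟨ sumTo-cong b (λ i → coefficient (suc i)) ⟩
        sumTo b (λ r → 2# * weight x xs′ * ((x * u) ^ r * shift r (Ψ xs′) n))
          ≡⟨ sumTo-*ˡ b _ _ ⟩
        2# * weight x xs′ * sumTo b (λ r → (x * u) ^ r * shift r (Ψ xs′) n)
          ≡⟨ cong (2# * weight x xs′ *_) (trans (sym (+-identityˡ _)) (trans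
               (cong₂ _+_ (sym (zeroˡ (Ψ xs′ n))) (sumTo-cong b (λ _ → refl)))
               (sym (product-shifts (geometric (x * u)) (Ψ xs′) b n l)))) ⟩
        2# * weight x xs′ * (geometric (x * u) *ˢ Ψ xs′) n
          ≡⟨ trans (*-assoc _ _ _) (cong (2# *_)
               (sym (const-* (weight x xs′) (geometric (x * u) *ˢ Ψ xs′) n))) ⟩
        2# * (const (weight x xs′) *ˢ (geometric (x * u) *ˢ Ψ xs′)) n ∎
        where
        coefficient : ∀ r → u ^ r * shift r (scale (2# * (x ^ r * weight x xs′)) (Ψ xs′)) n ≡ 2# * weight x xs′
            * ((x * u) ^ r * shift r (Ψ xs′) n)
        coefficient r = begin
          u ^ r * shift r (scale (2# * (x ^ r * weight x xs′)) (Ψ xs′)) n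
            ≡⟨ cong (u ^ r *_) (shift-scale r _ (Ψ xs′) n) ⟩
          u ^ r * (2# * (x ^ r * weight x xs′) * shift r (Ψ xs′) n)
            ≡⟨ solve 4 (λ u x w s → u :* (:2 :* (x :* w) :* s) := :2 :* w :* ((x :* u) :* s)) refl (u ^ r)
                 (x ^ r) _ _ ⟩
          2# * weight x xs′ * (x ^ r * u ^ r * shift r (Ψ xs′) n)
            ≡⟨ cong (λ m → 2# * weight x xs′ * (m * shift r (Ψ xs′) n)) (^-* x u r) ⟨
          2# * weight x xs′ * ((x * u) ^ r * shift r (Ψ xs′) n) ∎

    -- The branching rule in the variables y, multiplied by 2^ℓ(α) P_α(x) and summed over α.
    cauchySum-recursion : ∀ b u ys xs → All (Apart u) ys → All (SumApart u) ys → Generic ys → AllPairs Apart xs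
        → ∀ n → n ≤ b →
      coweight u ys * cauchySum b (u ∷ ys) xs n ≡
      (2ˢ *ˢ vertex u (cauchySum b ys) xs +ˢ 2ˢ *ˢ S.∑ᵖ (λ y zs → const (residue u y zs) *ˢ cauchySum b zs xs)
          ys +ˢ const (weight 0# ys) *ˢ cauchySum b ys xs) n
    cauchySum-recursion b u ys xs ps qs g ds n l = begin
      coweight u ys * cauchySum b (u ∷ ys) xs n
        ≡⟨ strictSum-scale b (coweight u ys) _ n ⟨
      strictSum b (λ α → coweight u ys * (2# ^ length α * P α xs * P α (u ∷ ys))) n
        ≡⟨ ∑-cong (strictPartsB b n) (λ {α} _ → term α) ⟩
      strictSum b (λ α → 2# ^ length α * P α xs * Del α +
          (∑ᵖ (λ y zs → 2# * residue u y zs * (2# ^ length α * P α xs * P α zs)) ys + weight 0# ys *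
          (2# ^ length α * P α xs * P α ys))) n
        ≡⟨ trans (strictSum-+ b _ _ n) (cong (strictSum b (λ α → 2# ^ length α * P α xs * Del α) n +_)
             (strictSum-+ b _ _ n)) ⟩
      strictSum b (λ α → 2# ^ length α * P α xs * Del α) n +
          (strictSum b (λ α → ∑ᵖ (λ y zs → 2# * residue u y zs * (2# ^ length α * P α xs * P α zs)) ys) n +
          strictSum b (λ α → weight 0# ys * (2# ^ length α * P α xs * P α ys)) n)
        ≡⟨ cong₂ _+_ (vertex-part b u ys xs ds n l)
             (cong₂ _+_ residues (trans (strictSum-scale b _ _ n) (sym (const-* _ _ n)))) ⟩
      (2ˢ *ˢ vertex u (cauchySum b ys) xs) n +
          ((2ˢ *ˢ S.∑ᵖ (λ y zs → const (residue u y zs) *ˢ cauchySum b zs xs) ys) n +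
          (const (weight 0# ys) *ˢ cauchySum b ys xs) n)
        ≡⟨ +-assoc _ _ _ ⟨
      (2ˢ *ˢ vertex u (cauchySum b ys) xs +ˢ 2ˢ *ˢ S.∑ᵖ (λ y zs → const (residue u y zs) *ˢ cauchySum b zs xs)
          ys +ˢ const (weight 0# ys) *ˢ cauchySum b ys xs) n ∎
      where
      Del : List ℕ → Carrier
      Del = signedDeletion _^_ u (λ β → P β ys)
      term : ∀ α → coweight u ys * (2# ^ length α * P α xs * P α (u ∷ ys)) ≡
        2# ^ length α * P α xs * Del α + (∑ᵖ (λ y zs → 2# * residue u y zs * (2# ^ length α * P α xs * P α zs))
            ys + weight 0# ys * (2# ^ length α * P α xs * P α ys))
      term α = begin
        coweight u ys * (c * P α (u ∷ ys))
          ≡⟨ solve 3 (λ k c p → k :* (c :* p) := c :* (k :* p)) refl _ c _ ⟩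
        c * (coweight u ys * P α (u ∷ ys))
          ≡⟨ cong (c *_) (branching _^_ u ys ps qs g α) ⟩
        c * (Del α + 2# * ∑ᵖ (λ y zs → residue u y zs * P α zs) ys + weight 0# ys * P α ys)
          ≡⟨ solve 5 (λ c d s w p → c :* (d :+ :2 :* s :+ w :* p) := c :* d :+
               ((:2 :* c) :* s :+ w :* (c :* p))) refl c _ _ _ _ ⟩
        c * Del α + ((2# * c) * ∑ᵖ (λ y zs → residue u y zs * P α zs) ys + weight 0# ys * (c * P α ys))
          ≡⟨ cong (λ m → c * Del α + (m + weight 0# ys * (c * P α ys))) (trans (sym (∑ᵖ-*ˡ (2# * c) _ ys))
               (∑ᵖ-cong ys (λ _ → solve 4 (λ t c r p → (t :* c) :* (r :* p) := t :* r :* (c :* p)) refl 2# c _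
                   _))) ⟩
        c * Del α + (∑ᵖ (λ y zs → 2# * residue u y zs * (c * P α zs)) ys + weight 0# ys * (c * P α ys)) ∎
        where c = 2# ^ length α * P α xs
      residues : strictSum b (λ α → ∑ᵖ (λ y zs → 2# * residue u y zs * (2# ^ length α * P α xs * P α zs)) ys) n
          ≡
        (2ˢ *ˢ S.∑ᵖ (λ y zs → const (residue u y zs) *ˢ cauchySum b zs xs) ys) n
      residues = begin
        strictSum b (λ α → ∑ᵖ (λ y zs → 2# * residue u y zs * (2# ^ length α * P α xs * P α zs)) ys) n
          ≡⟨ ∑ᵖ-∑ _ (strictPartsB b n) ys ⟨
        ∑ᵖ (λ y zs → strictSum b (λ α → 2# * residue u y zs * (2# ^ length α * P α xs * P α zs)) n) ys
          ≡⟨ ∑ᵖ-cong ys (λ {y} {zs} _ → trans (strictSum-scale b (2# * residue u y zs) _ n)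
               (trans (*-assoc _ _ _) (cong (2# *_) (sym (const-* _ (cauchySum b zs xs) n))))) ⟩
        ∑ᵖ (λ y zs → 2# * (const (residue u y zs) *ˢ cauchySum b zs xs) n) ys
          ≡⟨ trans (∑ᵖ-*ˡ 2# _ ys) (cong (2# *_)
               (sym (S-∑ᵖ-coefficient (λ y zs → const (residue u y zs) *ˢ cauchySum b zs xs) ys n))) ⟩
        2# * V n
          ≡⟨ solve 1 (λ a → :2 :* a := a :+ a) refl _ ⟩
        V n + V n
          ≡⟨ 2ˢ-* V n ⟨
        (2ˢ *ˢ V) n ∎
        where V = S.∑ᵖ (λ y zs → const (residue u y zs) *ˢ cauchySum b zs xs) ys

  -- kernel and cauchySum satisfy the same recursion in the list of the ys.
  cauchy : ∀ b ys xs → Generic ys → Generic xs → kernel ys xs ≈[ b ] cauchySum b ys xs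
  cauchy b ys = go (length ys) ys ℕ.≤-refl
    where
    -- The induction is on a bound for the length, since the residue terms involve `ys` with an
    -- arbitrary entry removed, which need not be its tail.
    go : ∀ m ys → length ys ≤ m → ∀ xs → Generic ys → Generic xs → kernel ys xs ≈[ b ] cauchySum b ys xs
    go _ [] _ xs gy gx n _ = trans (S.∏-one xs (λ _ → S.refl) n)
        (sym (trans (strictSum-cong b only-empty n) (constant b n)))
      where
      empty : List ℕ → Carrier
      empty [] = 1#
      empty (_ ∷ _) = 0#
      only-empty : ∀ {α} → Strict b α → 2# ^ length α * P α xs * P α [] ≡ empty α
      only-empty [] = solve 0 (:1 :* :1 :* :1 := :1) refl
      only-empty (_ ∷ _) = zeroʳ _
      constant : ∀ b → strictSum b empty ≈ const 1#
      constant zero = strictSum-zero _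
      constant (suc b) n = trans (strictSum-suc b _ n)
          (trans (cong₂ _+_ (constant b n) (shift-zero (suc b) (strictSum-vanish b (λ _ → refl)) n))
          (+-identityʳ _))
    go (suc m) (u ∷ ys) (s≤s l) xs (generic (_ ∷ nz) (p ∷ ps) (q ∷ qs)) gx n n≤b = *-cancelˡ κ≢0 (begin
      coweight u ys * kernel (u ∷ ys) xs n
        ≡⟨ const-* (coweight u ys) _ n ⟨
      (const (coweight u ys) *ˢ kernel (u ∷ ys) xs) n
        ≡⟨ kernel-recursion u ys xs p q gy (apart gx) n ⟩
      (2ˢ *ˢ vertex u (kernel ys) xs +ˢ 2ˢ *ˢ S.∑ᵖ (λ y zs → const (residue u y zs) *ˢ kernel zs xs) ys +ˢ const
          (weight 0# ys) *ˢ kernel ys xs) n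
        ≡⟨ cong₂ _+_ (cong₂ _+_
             (*-cong-≤ {2ˢ} {2ˢ} (λ _ _ → refl) vertex-agree n n≤b)
             (*-cong-≤ {2ˢ} {2ˢ} (λ _ _ → refl)
                 (∑ᵖ-agree (λ y zs → const (residue u y zs) *ˢ kernel zs xs)
                 (λ y zs → const (residue u y zs) *ˢ cauchySum b zs xs) ys
               (λ {y} {zs} π → *-cong-≤ {const (residue u y zs)} (λ _ _ → refl)
                   (go m zs (shorter π) xs (Generic-pick π gy) gx))) n n≤b))
             (*-cong-≤ {const (weight 0# ys)} (λ _ _ → refl) (go m ys l xs gy gx) n n≤b) ⟩
      (2ˢ *ˢ vertex u (cauchySum b ys) xs +ˢ 2ˢ *ˢ S.∑ᵖ (λ y zs → const (residue u y zs) *ˢ cauchySum b zs xs)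
          ys +ˢ const (weight 0# ys) *ˢ cauchySum b ys xs) n
        ≡⟨ cauchySum-recursion b u ys xs p q gy (apart gx) n n≤b ⟨
      coweight u ys * cauchySum b (u ∷ ys) xs n ∎)
      where
      gy = generic nz ps qs
      κ≢0 : coweight u ys ≢ 0#
      κ≢0 e = 1≢0 (trans (sym (weight-coweight u ys p q)) (trans (cong (_* weight u ys) e) (zeroˡ _)))
      shorter : ∀ {y zs} → Pick y zs ys → length zs ≤ m
      shorter π = ℕ.≤-trans (ℕ.n≤1+n _) (ℕ.≤-trans (ℕ.≤-reflexive (sym (Pick-length π))) l)
      ∑ᵖ-agree : ∀ (f h : Carrier → List Carrier → Series) zs → (∀ {y ws} → Pick y ws zs → f y ws ≈[ b ] h y ws)
          → S.∑ᵖ f zs ≈[ b ] S.∑ᵖ h zs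
      ∑ᵖ-agree f h zs e k k≤b = trans (S-∑ᵖ-coefficient f zs k)
          (trans (∑ᵖ-cong zs (λ π → e π k k≤b)) (sym (S-∑ᵖ-coefficient h zs k)))
      vertex-agree : vertex u (kernel ys) xs ≈[ b ] vertex u (cauchySum b ys) xs
      vertex-agree = ∑ᵖ-agree (λ x xs′ → const (weight x xs′) *ˢ (geometric (x * u) *ˢ kernel ys xs′))
          (λ x xs′ → const (weight x xs′) *ˢ (geometric (x * u) *ˢ cauchySum b ys xs′)) xs
        (λ {x} {xs′} π → *-cong-≤ {const (weight x xs′)} (λ _ _ → refl)
          (*-cong-≤ {geometric (x * u)} (λ _ _ → refl) (go m ys l xs′ gy (Generic-pick π gx))))

-- Odd partitions, insertion of a part, and z.

-- oddPartsB keeps its recursion in a local function; repeatedPart is a copy that can be named.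
repeatedPart : ℕ → ℕ → ℕ → List (List ℕ)
repeatedPart b zero m = []
repeatedPart b (suc f) m =
  if isOdd (suc b) ∧ (suc b ≤ᵇ m)
  then map (suc b ∷_) (oddPartsB b (m ∸ suc b)) ++ map (suc b ∷_) (repeatedPart b f (m ∸ suc b))
  else []

-- The hole is the local function of oddPartsB (b, N are its context), found by unification in oddPartsB-suc.
repeatedPart-agrees : ∀ b N f m → _ ≡ repeatedPart b f m

oddPartsB-suc : ∀ b n → oddPartsB (suc b) n ≡ oddPartsB b n ++ repeatedPart b n n
oddPartsB-suc b zero = refl
oddPartsB-suc b (suc k) with suc k | k ∸ b
... | N | m = cong (λ l → oddPartsB b N ++ (if isOdd (suc b) ∧ (suc b ≤ᵇ N) then map (suc b ∷_) (oddPartsB b m)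
      ++ map (suc b ∷_) l else []))
  (repeatedPart-agrees b N k m)

repeatedPart-agrees b N zero m = refl
repeatedPart-agrees b N (suc f) m =
  cong (λ l → if isOdd (suc b) ∧ (suc b ≤ᵇ m) then map (suc b ∷_) (oddPartsB b (m ∸ suc b)) ++ map (suc b ∷_) l
      else [])
    (repeatedPart-agrees b N f (m ∸ suc b))

repeatedPart-fuel : ∀ b f f′ m → m ≤ f → m ≤ f′ → repeatedPart b f m ≡ repeatedPart b f′ m
repeatedPart-fuel b zero zero m _ _ = refl
repeatedPart-fuel b zero (suc f′) zero _ _ with isOdd (suc b)
... | true = refl
... | false = refl
repeatedPart-fuel b (suc f) zero zero _ _ with isOdd (suc b)
... | true = refl
... | false = refl
repeatedPart-fuel b (suc f) (suc f′) m l l′ =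
  cong (λ l → if isOdd (suc b) ∧ (suc b ≤ᵇ m) then map (suc b ∷_) (oddPartsB b (m ∸ suc b)) ++ map (suc b ∷_) l
      else [])
    (repeatedPart-fuel b f f′ (m ∸ suc b) (smaller m l) (smaller m l′))
  where
  smaller : ∀ m {f} → m ≤ suc f → m ∸ suc b ≤ f
  smaller zero _ = z≤n
  smaller (suc m) (s≤s l) = ℕ.≤-trans (ℕ.m∸n≤m m b) l

oddPartsB-even : ∀ b n → isOdd (suc b) ≡ false → oddPartsB (suc b) n ≡ oddPartsB b n
oddPartsB-even b n e = trans (oddPartsB-suc b n)
    (trans (cong (oddPartsB b n ++_) (none n)) (List.++-identityʳ _))
  where
  none : ∀ f → repeatedPart b f n ≡ []
  none zero = refl
  none (suc f) = cong (λ t → if t ∧ (suc b ≤ᵇ n) then map (suc b ∷_) (oddPartsB b (n ∸ suc b)) ++ map (suc b ∷_)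
      (repeatedPart b f (n ∸ suc b)) else []) e

≤ᵇ-true : ∀ {m n} → m ≤ n → (m ≤ᵇ n) ≡ true
≤ᵇ-true {m} {n} l with m ≤ᵇ n | ℕ.≤⇒≤ᵇ l
... | true | _ = refl

≤ᵇ-false : ∀ {m n} → n < m → (m ≤ᵇ n) ≡ false
≤ᵇ-false {m} {n} l with m ≤ᵇ n in eq
... | true = contradiction (ℕ.≤ᵇ⇒≤ m n (subst Bool.T (sym eq) tt)) (ℕ.<⇒≱ l)
... | false = refl

oddPartsB-< : ∀ b n → n < suc b → oddPartsB (suc b) n ≡ oddPartsB b n
oddPartsB-< b n l = trans (oddPartsB-suc b n) (trans (cong (oddPartsB b n ++_) (none n)) (List.++-identityʳ _))
  where
  none : ∀ f → repeatedPart b f n ≡ []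
  none zero = refl
  none (suc f) with isOdd (suc b)
  ... | false = refl
  ... | true = cong (λ t → if t then map (suc b ∷_) (oddPartsB b (n ∸ suc b)) ++ map (suc b ∷_)
        (repeatedPart b f (n ∸ suc b)) else []) (≤ᵇ-false l)

-- Replaces the loop over the multiplicity of b + 1 by the removal of a single copy, with the bound
-- unchanged. Induction on odd partitions then adds one part at a time.
oddPartsB-≥ : ∀ b n → isOdd (suc b) ≡ true → suc b ≤ n →
  oddPartsB (suc b) n ≡ oddPartsB b n ++ map (suc b ∷_) (oddPartsB (suc b) (n ∸ suc b))
oddPartsB-≥ b (suc n) e l = trans (oddPartsB-suc b (suc n)) (cong (oddPartsB b (suc n) ++_) (trans
  (cong₂ (λ s t → if s ∧ t then map (suc b ∷_) (oddPartsB b (n ∸ b)) ++ map (suc b ∷_)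
      (repeatedPart b n (n ∸ b)) else []) e (≤ᵇ-true l))
  (trans (sym (List.map-++ (suc b ∷_) (oddPartsB b (n ∸ b)) _))
    (cong (map (suc b ∷_)) (trans (cong (oddPartsB b (n ∸ b) ++_)
        (repeatedPart-fuel b n (n ∸ b) (n ∸ b) (ℕ.m∸n≤m n b) ℕ.≤-refl))
      (sym (oddPartsB-suc b (n ∸ b))))))))

data OddParts : ℕ → List ℕ → Set where
  []   : ∀ {b} → OddParts b []
  cons : ∀ {a b ρ} → isOdd (suc a) ≡ true → a < b → OddParts (suc a) ρ → OddParts b (suc a ∷ ρ)

OddParts-≤ : ∀ {a b ρ} → a ≤ b → OddParts a ρ → OddParts b ρ
OddParts-≤ l [] = []
OddParts-≤ l (cons o m s) = cons o (ℕ.<-≤-trans m l) s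

∈⇒OddParts : ∀ b n {ρ} → ρ ∈ oddPartsB b n → OddParts b ρ × size ρ ≡ n
∈⇒OddParts b n m = go b n n ℕ.≤-refl m
  where
  go : ∀ b f n → n ≤ f → ∀ {ρ} → ρ ∈ oddPartsB b n → OddParts b ρ × size ρ ≡ n
  go zero f zero l (here refl) = [] , refl
  go (suc b) f n l m with isOdd (suc b) in o | suc b ≤? n
  go (suc b) f n l m | false | _ with go b f n l (subst (_ ∈_) (oddPartsB-even b n o) m)
  ... | p , e = OddParts-≤ (ℕ.n≤1+n b) p , e
  go (suc b) f n l m | true | no b≮n with go b f n l (subst (_ ∈_) (oddPartsB-< b n (ℕ.≰⇒> b≮n)) m)
  ... | p , e = OddParts-≤ (ℕ.n≤1+n b) p , e
  go (suc b) f n l m | true | yes b<n with ∈.∈-++⁻ (oddPartsB b n) (subst (_ ∈_) (oddPartsB-≥ b n o b<n) m)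
  ... | inj₁ m′ with go b f n l m′
  ...   | p , e = OddParts-≤ (ℕ.n≤1+n b) p , e
  go (suc b) zero zero l m | true | yes () | inj₂ m′
  go (suc b) (suc f) (suc n) (s≤s l) m | true | yes b<n | inj₂ m′ with ∈.∈-map⁻ (suc b ∷_) m′
  ... | ρ , m″ , refl with go (suc b) f (n ∸ b) (ℕ.≤-trans (ℕ.m∸n≤m n b) l) m″
  ...   | p , e = cons o ℕ.≤-refl p , trans (cong (suc b ℕ.+_) e) (ℕ.m+[n∸m]≡n b<n)

oddPartsB-suc-⊆ : ∀ b n {ρ} → ρ ∈ oddPartsB b n → ρ ∈ oddPartsB (suc b) n
oddPartsB-suc-⊆ b n m = subst (_ ∈_) (sym (oddPartsB-suc b n)) (∈.∈-++⁺ˡ m)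

oddPartsB-⊆ : ∀ {a b} n {ρ} → a ≤ b → ρ ∈ oddPartsB a n → ρ ∈ oddPartsB b n
oddPartsB-⊆ n l m = go (ℕ.≤⇒≤′ l) m
  where
  go : ∀ {a b ρ} → a ℕ.≤′ b → ρ ∈ oddPartsB a n → ρ ∈ oddPartsB b n
  go ℕ.≤′-refl m = m
  go (ℕ.≤′-step l) m = oddPartsB-suc-⊆ _ n (go l m)

OddParts⇒∈ : ∀ {b ρ} → OddParts b ρ → ρ ∈ oddPartsB b (size ρ)
OddParts⇒∈ {b} [] = oddPartsB-⊆ {0} {b} 0 z≤n (here refl)
OddParts⇒∈ {b} (cons {a} {_} {ρ} o l p) = oddPartsB-⊆ (suc a ℕ.+ size ρ) l
  (subst ((suc a ∷ ρ) ∈_) (sym (oddPartsB-≥ a (suc a ℕ.+ size ρ) o (ℕ.m≤m+n (suc a) (size ρ))))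
    (∈.∈-++⁺ʳ (oddPartsB a (suc a ℕ.+ size ρ))
        (∈.∈-map⁺ (suc a ∷_) (subst (λ k → ρ ∈ oddPartsB (suc a) k) (sym (ℕ.m+n∸m≡n a (size ρ)))
        (OddParts⇒∈ p)))))

OddParts-size : ∀ {b ρ} → OddParts b ρ → OddParts (size ρ) ρ
OddParts-size [] = []
OddParts-size (cons {a} {_} {ρ} o l p) = cons o (ℕ.m≤m+n (suc a) (size ρ)) p

∈-OP : ∀ {b ρ} → OddParts b ρ → ρ ∈ OP (size ρ)
∈-OP p = OddParts⇒∈ (OddParts-size p)

oddPartsB-unique : ∀ b n → Unique (oddPartsB b n)
oddPartsB-unique b n = go b n n ℕ.≤-refl
  where
  go : ∀ b f n → n ≤ f → Unique (oddPartsB b n)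
  go zero f zero l = [] ∷ []
  go zero f (suc n) l = []
  go (suc b) f n l with isOdd (suc b) in o | suc b ≤? n
  ... | false | _ = subst Unique (sym (oddPartsB-even b n o)) (go b f n l)
  ... | true | no b≮n = subst Unique (sym (oddPartsB-< b n (ℕ.≰⇒> b≮n))) (go b f n l)
  go (suc b) zero zero l | true | yes ()
  go (suc b) (suc f) (suc n) (s≤s l) | true | yes b<n = subst Unique (sym (oddPartsB-≥ b (suc n) o b<n))
    (Unique.++⁺ (go b (suc f) (suc n) (s≤s l))
        (Unique.map⁺ List.∷-injectiveʳ (go (suc b) f (n ∸ b) (ℕ.≤-trans (ℕ.m∸n≤m n b) l))) disjoint)
    where
    disjoint : ∀ {ρ} → ¬ (ρ ∈ oddPartsB b (suc n) × ρ ∈ map (suc b ∷_) (oddPartsB (suc b) (n ∸ b)))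
    disjoint (m , m′) with ∈.∈-map⁻ (suc b ∷_) m′
    ... | _ , _ , refl with proj₁ (∈⇒OddParts b (suc n) m)
    ...   | cons _ b<b _ = ℕ.<-irrefl refl b<b

-- On partitions this is ρ ∪ (r), so that products of power sums get multiplied by p_r.
insertPart : ℕ → List ℕ → List ℕ
insertPart r [] = r ∷ []
insertPart r (a ∷ ρ) = if r <ᵇ a then a ∷ insertPart r ρ else r ∷ a ∷ ρ

insertPart-< : ∀ {r a} ρ → r < a → insertPart r (a ∷ ρ) ≡ a ∷ insertPart r ρ
insertPart-< {r} {a} ρ l with r <ᵇ a | ℕ.<⇒<ᵇ l
... | true | _ = refl

insertPart-≥ : ∀ {r b ρ} → b ≤ r → OddParts b ρ → insertPart r ρ ≡ r ∷ ρ
insertPart-≥ l [] = refl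
insertPart-≥ {r} l (cons {a} _ a<b _) with r <ᵇ suc a in eq
... | true = contradiction (ℕ.<ᵇ⇒< r (suc a) (subst Bool.T (sym eq) tt)) (ℕ.≤⇒≯ (ℕ.≤-trans a<b l))
... | false = refl

OddParts-insertPart : ∀ {b c ρ} → isOdd (suc c) ≡ true → c < b → OddParts b ρ → OddParts b
    (insertPart (suc c) ρ)
OddParts-insertPart o l [] = cons o l []
OddParts-insertPart {c = c} o l (cons {a} o′ l′ p) with suc c <ᵇ suc a in eq
... | true = cons o′ l′ (OddParts-insertPart o (ℕ.<-trans (ℕ.<ᵇ⇒< c a (subst Bool.T (sym eq) tt)) (ℕ.n<1+n a))
      p)
... | false = cons o l (cons o′ (s≤s (ℕ.≮⇒≥ (λ c<a → subst Bool.T eq (ℕ.<⇒<ᵇ c<a)))) p)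

size-insertPart : ∀ r ρ → size (insertPart r ρ) ≡ r ℕ.+ size ρ
size-insertPart r [] = refl
size-insertPart r (a ∷ ρ) with r <ᵇ a
... | false = refl
... | true = trans (cong (a ℕ.+_) (size-insertPart r ρ))
      (trans (sym (ℕ.+-assoc a r _)) (trans (cong (ℕ._+ size ρ) (ℕ.+-comm a r)) (ℕ.+-assoc r a _)))

length-insertPart : ∀ r ρ → length (insertPart r ρ) ≡ suc (length ρ)
length-insertPart r [] = refl
length-insertPart r (a ∷ ρ) with r <ᵇ a
... | false = refl
... | true = cong suc (length-insertPart r ρ)

mult-here : ∀ r ρ → mult r (r ∷ ρ) ≡ suc (mult r ρ)
mult-here r ρ with r ≟ r
... | yes _ = refl
... | no r≢r = contradiction refl r≢r

mult-there : ∀ {r a} ρ → r ≢ a → mult r (a ∷ ρ) ≡ mult r ρ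
mult-there {r} {a} ρ r≢a with r ≟ a
... | yes r≡a = contradiction r≡a r≢a
... | no _ = refl

mult-swap : ∀ r a b ρ → mult r (a ∷ b ∷ ρ) ≡ mult r (b ∷ a ∷ ρ)
mult-swap r a b ρ with r ≟ a in p | r ≟ b in q
... | yes _ | yes _ rewrite p | q = refl
... | yes _ | no _ rewrite p | q = refl
... | no _ | yes _ rewrite p | q = refl
... | no _ | no _ rewrite p | q = refl

mult-cons-cong : ∀ r a {ρ σ} → mult r ρ ≡ mult r σ → mult r (a ∷ ρ) ≡ mult r (a ∷ σ)
mult-cons-cong r a e with r ≟ a
... | yes _ = cong suc e
... | no _ = e

mult-insertPart : ∀ s r ρ → mult s (insertPart r ρ) ≡ mult s (r ∷ ρ)
mult-insertPart s r [] = refl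
mult-insertPart s r (a ∷ ρ) with r <ᵇ a
... | false = refl
... | true = trans (mult-cons-cong s a (mult-insertPart s r ρ)) (mult-swap s a r ρ)

mult-> : ∀ r ρ → size ρ < r → mult r ρ ≡ 0
mult-> r [] l = refl
mult-> r (a ∷ ρ) l = trans (mult-there ρ (λ { refl → ℕ.<-irrefl refl (ℕ.≤-<-trans (ℕ.m≤m+n a (size ρ)) l) }))
    (mult-> r ρ (ℕ.≤-<-trans (ℕ.m≤n+m (size ρ) a) l))

mult-OddParts-> : ∀ {b r ρ} → b < r → OddParts b ρ → mult r ρ ≡ 0
mult-OddParts-> l [] = refl
mult-OddParts-> l (cons {ρ = ρ} _ a<b p) =
  trans (mult-there ρ (λ { refl → ℕ.<-irrefl refl (ℕ.<-≤-trans l a<b) }))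
      (mult-OddParts-> (ℕ.≤-<-trans a<b l) p)

mult-even : ∀ {b ρ} r → isOdd r ≡ false → OddParts b ρ → mult r ρ ≡ 0
mult-even r e [] = refl
mult-even r e (cons {ρ = ρ} o _ p) = trans (mult-there ρ (λ { refl → contradiction (trans (sym o) e) (λ ()) }))
    (mult-even r e p)

-- In `z` the range of the product is tied to the size of ρ, which an insertion changes. Here the
-- range is free, so that products for two partitions can be compared factor by factor.
zUpTo : ℕ → List ℕ → ℕ
zUpTo zero ρ = 1
zUpTo (suc n) ρ = zUpTo n ρ ℕ.* (suc n ℕ.^ mult (suc n) ρ ℕ.* (mult (suc n) ρ !))

z≡zUpTo : ∀ ρ → Defs.z ρ ≡ zUpTo (size ρ) ρ
z≡zUpTo ρ = go (size ρ)
  where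
  f : ℕ → ℕ
  f i = suc i ℕ.^ mult (suc i) ρ ℕ.* (mult (suc i) ρ !)
  snoc : ∀ xs i → foldr ℕ._*_ 1 (map f (xs ++ i ∷ [])) ≡ foldr ℕ._*_ 1 (map f xs) ℕ.* f i
  snoc [] i = trans (ℕ.*-identityʳ (f i)) (sym (ℕ.*-identityˡ (f i)))
  snoc (x ∷ xs) i = trans (cong (f x ℕ.*_) (snoc xs i)) (sym (ℕ.*-assoc (f x) _ (f i)))
  go : ∀ n → foldr ℕ._*_ 1 (map f (upTo n)) ≡ zUpTo n ρ
  go zero = refl
  go (suc n) = trans (cong (λ l → foldr ℕ._*_ 1 (map f l)) (sym (List.upTo-∷ʳ n)))
      (trans (snoc (upTo n) n) (cong (ℕ._* f n) (go n)))

zUpTo-≥ : ∀ ρ {n} → size ρ ≤ n → zUpTo n ρ ≡ zUpTo (size ρ) ρ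
zUpTo-≥ ρ l = go (ℕ.≤⇒≤′ l)
  where
  go : ∀ {n} → size ρ ℕ.≤′ n → zUpTo n ρ ≡ zUpTo (size ρ) ρ
  go ℕ.≤′-refl = refl
  go (ℕ.≤′-step {n} l) = trans (cong (λ m → zUpTo n ρ ℕ.* (suc n ℕ.^ m ℕ.* (m !)))
      (mult-> (suc n) ρ (s≤s (ℕ.≤′⇒≤ l)))) (trans (ℕ.*-identityʳ _) (go l))

-- Only the factor at r = c + 1 changes: its exponent and its factorial move from m to m + 1, which
-- gives r (m + 1).
z-insertPart : ∀ c ρ → Defs.z (insertPart (suc c) ρ) ≡ suc c ℕ.* suc (mult (suc c) ρ) ℕ.* Defs.z ρ
z-insertPart c ρ = trans (z≡zUpTo (insertPart r ρ))
    (trans (cong (λ n → zUpTo n (insertPart r ρ)) (size-insertPart r ρ))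
  (trans (after (r ℕ.+ size ρ) (ℕ.m≤m+n r (size ρ)))
      (cong (r ℕ.* suc m ℕ.*_) (trans (zUpTo-≥ ρ (ℕ.m≤n+m (size ρ) r)) (sym (z≡zUpTo ρ))))))
  where
  r = suc c
  m = mult r ρ
  factor : ∀ {n} → suc n ≢ r → mult (suc n) (insertPart r ρ) ≡ mult (suc n) ρ
  factor {n} n≢c = trans (mult-insertPart (suc n) r ρ) (mult-there ρ n≢c)
  before : ∀ n → n ≤ c → zUpTo n (insertPart r ρ) ≡ zUpTo n ρ
  before zero _ = refl
  before (suc n) l = cong₂ (λ s m → s ℕ.* (suc n ℕ.^ m ℕ.* (m !))) (before n (ℕ.≤-trans (ℕ.n≤1+n n) l))
      (factor (λ { refl → ℕ.<-irrefl refl l }))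
  after : ∀ n → r ≤ n → zUpTo n (insertPart r ρ) ≡ r ℕ.* suc m ℕ.* zUpTo n ρ
  after (suc n) l with suc n ≟ r
  ... | yes refl = trans (cong₂ (λ s m → s ℕ.* (r ℕ.^ m ℕ.* (m !))) (before n ℕ.≤-refl)
        (trans (mult-insertPart r r ρ) (mult-here r ρ)))
        (rearrange (zUpTo n ρ) r (r ℕ.^ m) (suc m) (m !))
    where
    rearrange : ∀ z r p s f → z ℕ.* (r ℕ.* p ℕ.* (s ℕ.* f)) ≡ r ℕ.* s ℕ.* (z ℕ.* (p ℕ.* f))
    rearrange = solve-∀
  ... | no n≢c = trans (cong₂ (λ s m → s ℕ.* (suc n ℕ.^ m ℕ.* (m !)))
        (after n (ℕ.≤-pred (ℕ.≤∧≢⇒< l (λ e → n≢c (sym e))))) (factor n≢c))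
        (ℕ.*-assoc (r ℕ.* suc m) (zUpTo n ρ) _)

-- Power-sum expansion of the kernel by logarithmic derivatives.

module OddSums (F : OrderedField) where
  open FieldTheory F
  open PowerSeries F
  open Kernel F
  open ≡.≡-Reasoning

  oddSum : ℕ → (List ℕ → Carrier) → Series
  oddSum b G n = ∑ G (oddPartsB b n)

  oddSum-cong : ∀ b {G H} n → (∀ {ρ} → OddParts b ρ → size ρ ≡ n → G ρ ≡ H ρ) → oddSum b G n ≡ oddSum b H n
  oddSum-cong b n e = ∑-cong (oddPartsB b n) (λ m → e (proj₁ (∈⇒OddParts b n m)) (proj₂ (∈⇒OddParts b n m)))

  oddSum-even : ∀ b G → isOdd (suc b) ≡ false → oddSum (suc b) G ≈ oddSum b G
  oddSum-even b G o n = cong (∑ G) (oddPartsB-even b n o)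

  oddSum-odd : ∀ b G → isOdd (suc b) ≡ true →
    oddSum (suc b) G ≈ oddSum b G +ˢ shift (suc b) (oddSum (suc b) (λ ρ → G (suc b ∷ ρ)))
  oddSum-odd b G o n with suc b ≤? n
  ... | no b≮n = trans (cong (∑ G) (oddPartsB-< b n (ℕ.≰⇒> b≮n)))
        (trans (sym (+-identityʳ _)) (cong (oddSum b G n +_) (sym (shift-< (suc b) _ (ℕ.≰⇒> b≮n)))))
  ... | yes b<n = trans (cong (∑ G) (oddPartsB-≥ b n o b<n))
        (trans (∑-++ G (oddPartsB b n) _) (cong (oddSum b G n +_)
        (trans (∑-map G (suc b ∷_) (oddPartsB (suc b) (n ∸ suc b)))
          (trans (sym (shift-≥ (suc b) H (n ∸ suc b))) (cong (shift (suc b) H) (ℕ.m+[n∸m]≡n b<n))))))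
    where H = oddSum (suc b) (λ ρ → G (suc b ∷ ρ))

  private
    shift-cong-≤ : ∀ r {f g m} → f ≈[ m ] g → shift r f ≈[ m ] shift r g
    shift-cong-≤ zero e = e
    shift-cong-≤ (suc r) e zero l = refl
    shift-cong-≤ (suc r) e (suc n) l = shift-cong-≤ r e n (ℕ.≤-trans (ℕ.n≤1+n n) l)

    shift-cong-< : ∀ r {f g} n → (∀ k → k < n → f k ≡ g k) → shift (suc r) f n ≡ shift (suc r) g n
    shift-cong-< r zero e = refl
    shift-cong-< r (suc n) e = shift-cong-≤ r (λ k k≤n → e k (s≤s k≤n)) n ℕ.≤-refl

  -- Removing one part equal to r is inverse to insertPart r.
  oddSum-insertPart : ∀ b c G → isOdd (suc c) ≡ true → c < b → (∀ {ρ} → mult (suc c) ρ ≡ 0 → G ρ ≡ 0#) →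
    oddSum b G ≈ shift (suc c) (oddSum b (λ ρ → G (insertPart (suc c) ρ)))
  oddSum-insertPart b c G o l v n = go b n G l v n ℕ.≤-refl
    where
    r = suc c
    go : ∀ b f G → c < b → (∀ {ρ} → mult r ρ ≡ 0 → G ρ ≡ 0#) → ∀ n → n ≤ f →
      oddSum b G n ≡ shift r (oddSum b (λ ρ → G (insertPart r ρ))) n
    go (suc b) f G l v n l′ with c ≟ b
    ... | yes refl = begin
      oddSum r G n
        ≡⟨ oddSum-odd c G o n ⟩
      oddSum c G n + shift r (oddSum r (λ ρ → G (r ∷ ρ))) n
        ≡⟨ cong₂ _+_ (∑-zero (oddPartsB c n) (λ m → v (mult-OddParts-> ℕ.≤-refl (proj₁ (∈⇒OddParts c n m)))))
             (shift-cong r (λ k → oddSum-cong r k (λ p _ → cong G (sym (insertPart-≥ ℕ.≤-refl p)))) n) ⟩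
      0# + shift r (oddSum r (λ ρ → G (insertPart r ρ))) n
        ≡⟨ +-identityˡ _ ⟩
      shift r (oddSum r (λ ρ → G (insertPart r ρ))) n ∎
    ... | no c≢b with isOdd (suc b) in o′
    ...   | false = trans (oddSum-even b G o′ n) (trans (go b f G (ℕ.≤∧≢⇒< (ℕ.≤-pred l) c≢b) v n l′)
              (shift-cong r (S.sym (oddSum-even b _ o′)) n))
    ...   | true = begin
      oddSum (suc b) G n
        ≡⟨ oddSum-odd b G o′ n ⟩
      oddSum b G n + shift (suc b) (oddSum (suc b) (λ ρ → G (suc b ∷ ρ))) n
        ≡⟨ cong₂ _+_ (go b f G (ℕ.≤∧≢⇒< (ℕ.≤-pred l) c≢b) v n l′) (tail f n l′) ⟩
      shift r (oddSum b (λ ρ → G (insertPart r ρ))) n + shift (suc b)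
          (shift r (oddSum (suc b) (λ ρ → G (suc b ∷ insertPart r ρ)))) n
        ≡⟨ cong (shift r (oddSum b (λ ρ → G (insertPart r ρ))) n +_) (trans (shift-comm (suc b) r _ n)
             (shift-cong r (shift-cong (suc b)
                 (λ k → ∑-cong (oddPartsB (suc b) k)
                 (λ {ρ} _ → cong G (sym (insertPart-< ρ (s≤s (ℕ.≤∧≢⇒< (ℕ.≤-pred l) c≢b))))))) n)) ⟩
      shift r (oddSum b (λ ρ → G (insertPart r ρ))) n + shift r
          (shift (suc b) (oddSum (suc b) (λ ρ → G (insertPart r (suc b ∷ ρ))))) n
        ≡⟨ shift-+ r _ _ n ⟨
      shift r (oddSum b (λ ρ → G (insertPart r ρ)) +ˢ shift (suc b)
          (oddSum (suc b) (λ ρ → G (insertPart r (suc b ∷ ρ))))) n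
        ≡⟨ shift-cong r (oddSum-odd b _ o′) n ⟨
      shift r (oddSum (suc b) (λ ρ → G (insertPart r ρ))) n ∎
      where
      v′ : ∀ {ρ} → mult r ρ ≡ 0 → G (suc b ∷ ρ) ≡ 0#
      v′ {ρ} e = v (trans (mult-there ρ (λ e → c≢b (ℕ.suc-injective e))) e)
      tail : ∀ f n → n ≤ f → shift (suc b) (oddSum (suc b) (λ ρ → G (suc b ∷ ρ))) n ≡
        shift (suc b) (shift r (oddSum (suc b) (λ ρ → G (suc b ∷ insertPart r ρ)))) n
      tail zero zero l′ = refl
      tail (suc f) n l′ = shift-cong-< b n (λ k k<n → go (suc b) f (λ ρ → G (suc b ∷ ρ)) l v′ k
          (ℕ.≤-pred (ℕ.≤-trans k<n l′)))

  -- 1 / ⟨p_ρ, p_ρ⟩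
  zWeight : List ℕ → Carrier
  zWeight ρ = 2# ^ length ρ * fromℕ (Defs.z ρ) ⁻¹

  z≢0 : ∀ {b ρ} → fromℕ (zUpTo b ρ) ≢ 0#
  z≢0 {zero} = fromℕ-suc≢0 0
  z≢0 {suc b} {ρ} e = *-≢0 (z≢0 {b} {ρ}) (λ e′ → *-≢0 (fromℕ-^ (mult (suc b) ρ))
      (fromℕ-pos≢0 (ℕ.1≤n! (mult (suc b) ρ))) (trans (sym (fromℕ-* (suc b ℕ.^ mult (suc b) ρ) _)) e′))
    (trans (sym (fromℕ-* (zUpTo b ρ) _)) e)
    where
    fromℕ-^ : ∀ m → fromℕ (suc b ℕ.^ m) ≢ 0#
    fromℕ-^ zero = fromℕ-suc≢0 0
    fromℕ-^ (suc m) e = *-≢0 (fromℕ-suc≢0 b) (fromℕ-^ m) (trans (sym (fromℕ-* (suc b) (suc b ℕ.^ m))) e)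

  fromℕ-z≢0 : ∀ ρ → fromℕ (Defs.z ρ) ≢ 0#
  fromℕ-z≢0 ρ e = z≢0 {size ρ} {ρ} (trans (cong fromℕ (sym (z≡zUpTo ρ))) e)

  zWeight≢0 : ∀ ρ → zWeight ρ ≢ 0#
  zWeight≢0 ρ = *-≢0 (^-≢0 (length ρ) 2≢0) (λ e → 1≢0
      (trans (sym (inverseʳ (fromℕ-z≢0 ρ))) (trans (cong (fromℕ (Defs.z ρ) *_) e) (zeroʳ _))))

  -- The multiplicity counted by a marked part r cancels against z, and 2 remains from the
  -- additional part.
  zWeight-insertPart : ∀ c ρ → fromℕ (suc c ℕ.* suc (mult (suc c) ρ)) * zWeight (insertPart (suc c) ρ) ≡ 2# *
      zWeight ρ
  zWeight-insertPart c ρ = *-cancelˡ (fromℕ-z≢0 ρ) (begin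
    fromℕ (Defs.z ρ) * (k * (2# ^ length ρ′ * i))
      ≡⟨ solve 4 (λ z k t i → z :* (k :* (t :* i)) := t :* ((k :* z) :* i)) refl (fromℕ (Defs.z ρ)) k _ i ⟩
    2# ^ length ρ′ * ((k * fromℕ (Defs.z ρ)) * i)
      ≡⟨ cong₂ (λ m n → 2# ^ m * (n * i)) (length-insertPart (suc c) ρ)
           (trans (sym (fromℕ-* (suc c ℕ.* suc (mult (suc c) ρ)) (Defs.z ρ)))
           (cong fromℕ (sym (z-insertPart c ρ)))) ⟩
    2# ^ suc (length ρ) * (fromℕ (Defs.z ρ′) * i)
      ≡⟨ cong (2# ^ suc (length ρ) *_) (trans (inverseʳ (fromℕ-z≢0 ρ′)) (sym (inverseʳ (fromℕ-z≢0 ρ)))) ⟩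
    2# * 2# ^ length ρ * (fromℕ (Defs.z ρ) * fromℕ (Defs.z ρ) ⁻¹)
      ≡⟨ solve 4 (λ t l z i → t :* l :* (z :* i) := z :* (t :* (l :* i))) refl 2# (2# ^ length ρ) _ _ ⟩
    fromℕ (Defs.z ρ) * (2# * zWeight ρ) ∎)
    where
    ρ′ = insertPart (suc c) ρ
    k = fromℕ (suc c ℕ.* suc (mult (suc c) ρ))
    i = fromℕ (Defs.z ρ′) ⁻¹

  ∏-insertPart : ∀ w r ρ → ∏ w (insertPart r ρ) ≡ w r * ∏ w ρ
  ∏-insertPart w r [] = refl
  ∏-insertPart w r (a ∷ ρ) with r <ᵇ a
  ... | false = refl
  ... | true = trans (cong (w a *_) (∏-insertPart w r ρ))
        (solve 3 (λ a b c → a :* (b :* c) := b :* (a :* c)) refl (w a) (w r) (∏ w ρ))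

  -- The logarithmic derivative of exp(2 Σ w_r X^r / r), the sum running over odd r.
  oddPower : (ℕ → Carrier) → Series
  oddPower w r = if isOdd r then 2# * w r else 0#

  -- The expansion of that exponential over odd partitions, with parts bounded by b. The exponential
  -- itself is never formed; it is characterised by its logarithmic derivative.
  zSum : ℕ → (ℕ → Carrier) → Series
  zSum b w = oddSum b (λ ρ → zWeight ρ * ∏ w ρ)

  private
    sumTo-∑ : ∀ {A : Set} m (f : ℕ → A → Carrier) xs → sumTo m (λ r → ∑ (f r) xs) ≡ ∑
        (λ x → sumTo m (λ r → f r x)) xs
    sumTo-∑ zero f xs = sym (∑-zero xs (λ _ → refl))
    sumTo-∑ (suc m) f xs = trans (cong (_+ ∑ (f (suc m)) xs) (sumTo-∑ m f xs)) (sym (∑-+ _ _ xs))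

    parts-sum : ∀ {b ρ} → OddParts b ρ → sumTo b (λ r → fromℕ (r ℕ.* mult r ρ)) ≡ fromℕ (size ρ)
    parts-sum {b} [] = zeros b
      where
      zeros : ∀ b → sumTo b (λ r → fromℕ (r ℕ.* 0)) ≡ 0#
      zeros zero = refl
      zeros (suc b) = trans (cong₂ (λ m n → m + fromℕ n) (zeros b) (ℕ.*-zeroʳ b)) (+-identityˡ 0#)
    parts-sum {b} (cons {a} {_} {ρ} o l p) = trans (split b l)
        (trans (cong (fromℕ (suc a) +_) (trans (extend b l) (parts-sum p))) (sym (fromℕ-+ (suc a) (size ρ))))
      where
      f : ℕ → Carrier
      f r = fromℕ (r ℕ.* mult r ρ)
      extend : ∀ b → a < b → sumTo b f ≡ sumTo (suc a) f
      extend (suc b) l with a ≟ b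
      ... | yes refl = refl
      ... | no a≢b = trans (cong₂ _+_ (extend b (ℕ.≤∧≢⇒< (ℕ.≤-pred l) a≢b))
              (cong fromℕ (trans (cong (suc b ℕ.*_) (mult-OddParts-> (s≤s (ℕ.≤∧≢⇒< (ℕ.≤-pred l) a≢b)) p))
                  (ℕ.*-zeroʳ (suc b))))) (+-identityʳ _)
      below : ∀ b → b ≤ a → sumTo b (λ r → fromℕ (r ℕ.* mult r (suc a ∷ ρ))) ≡ sumTo b f
      below zero _ = refl
      below (suc b) l = cong₂ _+_ (below b (ℕ.≤-trans (ℕ.n≤1+n b) l))
          (cong (λ m → fromℕ (suc b ℕ.* m)) (mult-there {suc b} {suc a} ρ (λ { refl → ℕ.<-irrefl refl l })))
      split : ∀ b → a < b → sumTo b (λ r → fromℕ (r ℕ.* mult r (suc a ∷ ρ))) ≡ fromℕ (suc a) + sumTo b f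
      split (suc b) l with a ≟ b
      ... | yes refl = trans (cong₂ _+_ (below b ℕ.≤-refl)
            (trans (cong fromℕ (trans (cong (suc a ℕ.*_) (mult-here (suc a) ρ))
            (ℕ.*-suc (suc a) (mult (suc a) ρ)))) (fromℕ-+ (suc a) (suc a ℕ.* mult (suc a) ρ))))
              (solve 3 (λ a b c → a :+ (b :+ c) := b :+ (a :+ c)) refl _ (fromℕ (suc a)) (f (suc a)))
      ... | no a≢b = trans (cong₂ _+_ (split b (ℕ.≤∧≢⇒< (ℕ.≤-pred l) a≢b))
            (cong (λ m → fromℕ (suc b ℕ.* m))
            (mult-there {suc b} {suc a} ρ (λ e → a≢b (sym (ℕ.suc-injective e)))))) (+-assoc _ _ _)

  -- The degree n is written as the sum of r m_r(ρ), that is, one part of ρ is marked with weight r.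
  -- Removing the marked part leaves 2 w_r times the term of the smaller partition, by
  -- `zWeight-insertPart`.
  D-zSum : ∀ b w → D (zSum b w) ≈[ b ] oddPower w *ˢ zSum b w
  D-zSum b w n l = begin
    fromℕ n * zSum b w n
      ≡⟨ ∑-*ˡ (fromℕ n) C (oddPartsB b n) ⟨
    ∑ (λ ρ → fromℕ n * C ρ) (oddPartsB b n)
      ≡⟨ ∑-cong (oddPartsB b n) (λ {ρ} m → let p , e = ∈⇒OddParts b n m in
           trans (cong (_* C ρ) (trans (cong fromℕ (sym e)) (sym (parts-sum p))))
               (trans (*-comm _ _) (sym (sumTo-*ˡ b (C ρ) _)))) ⟩
    ∑ (λ ρ → sumTo b (λ r → C ρ * fromℕ (r ℕ.* mult r ρ))) (oddPartsB b n)
      ≡⟨ sumTo-∑ b _ (oddPartsB b n) ⟨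
    sumTo b (λ r → oddSum b (λ ρ → C ρ * fromℕ (r ℕ.* mult r ρ)) n)
      ≡⟨ terms b ℕ.≤-refl ⟩
    sumTo b (λ r → oddPower w r * shift r (zSum b w) n)
      ≡⟨ trans (cong (_+ sumTo b (λ r → oddPower w r * shift r (zSum b w) n)) (zeroˡ (zSum b w n)))
           (+-identityˡ _) ⟨
    0# * zSum b w n + sumTo b (λ r → oddPower w r * shift r (zSum b w) n)
      ≡⟨ product-shifts (oddPower w) (zSum b w) b n l ⟨
    (oddPower w *ˢ zSum b w) n ∎
    where
    C : List ℕ → Carrier
    C ρ = zWeight ρ * ∏ w ρ
    term : ∀ c → c < b → oddSum b (λ ρ → C ρ * fromℕ (suc c ℕ.* mult (suc c) ρ)) n ≡ oddPower w (suc c) * shift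
        (suc c) (zSum b w) n
    term c c<b with isOdd (suc c) in o
    ... | false = trans (∑-zero (oddPartsB b n)
          (λ {ρ} m → trans (cong (λ k → C ρ * fromℕ k)
          (trans (cong (suc c ℕ.*_) (mult-even (suc c) o (proj₁ (∈⇒OddParts b n m)))) (ℕ.*-zeroʳ (suc c))))
          (zeroʳ _)))
          (sym (zeroˡ _))
    ... | true = trans (oddSum-insertPart b c _ o c<b
          (λ {ρ} e → trans (cong (λ k → C ρ * fromℕ k) (trans (cong (suc c ℕ.*_) e) (ℕ.*-zeroʳ (suc c))))
          (zeroʳ _)) n)
          (trans (shift-cong (suc c) (λ k → trans (∑-cong (oddPartsB b k) (λ {ρ} _ → inserted ρ))
              (∑-*ˡ (2# * w (suc c)) C (oddPartsB b k))) n) (shift-scale (suc c) (2# * w (suc c)) (zSum b w) n))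
      where
      inserted : ∀ ρ → C (insertPart (suc c) ρ) * fromℕ (suc c ℕ.* mult (suc c) (insertPart (suc c) ρ)) ≡ 2# * w
          (suc c) * C ρ
      inserted ρ = begin
        zWeight ρ′ * ∏ w ρ′ * fromℕ (suc c ℕ.* mult (suc c) ρ′)
          ≡⟨ cong₂ (λ m n → zWeight ρ′ * m * fromℕ (suc c ℕ.* n)) (∏-insertPart w (suc c) ρ)
               (trans (mult-insertPart (suc c) (suc c) ρ) (mult-here (suc c) ρ)) ⟩
        zWeight ρ′ * (w (suc c) * ∏ w ρ) * k
          ≡⟨ solve 4 (λ z w p k → z :* (w :* p) :* k := k :* z :* (w :* p)) refl (zWeight ρ′) (w (suc c))
               (∏ w ρ) k ⟩
        k * zWeight ρ′ * (w (suc c) * ∏ w ρ)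
          ≡⟨ cong (_* (w (suc c) * ∏ w ρ)) (zWeight-insertPart c ρ) ⟩
        2# * zWeight ρ * (w (suc c) * ∏ w ρ)
          ≡⟨ solve 3 (λ z w p → :2 :* z :* (w :* p) := :2 :* w :* (z :* p)) refl (zWeight ρ) (w (suc c))
               (∏ w ρ) ⟩
        2# * w (suc c) * C ρ ∎
        where
        ρ′ = insertPart (suc c) ρ
        k = fromℕ (suc c ℕ.* suc (mult (suc c) ρ))
    terms : ∀ m → m ≤ b → sumTo m (λ r → oddSum b (λ ρ → C ρ * fromℕ (r ℕ.* mult r ρ)) n) ≡ sumTo m
        (λ r → oddPower w r * shift r (zSum b w) n)
    terms zero _ = refl
    terms (suc m) l = cong₂ _+_ (terms m (ℕ.≤-trans (ℕ.n≤1+n m) l)) (term m l)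

  -- With g = `geometric c` and h = `geometric (- c)` the proof compares two forms of q² - 1. It is
  -- 4(g + g²), twice D q; and since q(c) q(-c) = 1 it is also 2(g - h) q, where g - h is the odd
  -- part 2 Σ c^r X^r. Doubling both sides avoids a division by 2.
  D-q : ∀ c → D (q c) ≈ oddPower (c ^_) *ˢ q c
  D-q c n = *-cancelˡ 2≢0 (trans (sym (double (D (q c)) n))
      (trans (equal n) (double (oddPower (c ^_) *ˢ q c) n)))
    where
    double : ∀ f → 2ˢ *ˢ f ≈ scale 2# f
    double f n = trans (2ˢ-* f n) (solve 1 (λ a → a :+ a := :2 :* a) refl (f n))
    g = geometric c
    h = geometric (- c)
    K = const c *ˢ (const 1# *ˢ monomial 1)
    K-coefficient : K ≈ scale c (monomial 1)
    K-coefficient n = trans (const-* c _ n) (cong (c *_) (S.*-identityˡ (monomial 1) n))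
    g-step : g ≈ K *ˢ (S.1# +ˢ g)
    g-step = S.trans (λ n → cong (λ m → geometric m n) (sym (*-identityˡ c))) (S.trans (geometric-step 1# c)
      (S.*-congˡ (S.+-congˡ (λ n → cong (λ m → geometric m n) (*-identityˡ c)))))
    D-K : D K ≈ K
    D-K n = trans (cong (fromℕ n *_) (K-coefficient n)) (trans (linear n) (sym (K-coefficient n)))
      where
      linear : ∀ n → fromℕ n * (c * monomial 1 n) ≡ c * monomial 1 n
      linear zero = solve 1 (λ c → :0 :* (c :* :0) := c :* :0) refl c
      linear (suc zero) = solve 1 (λ c → (:1 :+ :0) :* (c :* :1) := c :* :1) refl c
      linear (suc (suc n)) = solve 2 (λ m c → m :* (c :* :0) := c :* :0) refl _ c
    D-one : ∀ f → D (S.1# +ˢ f) ≈ D f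
    D-one f zero = solve 1 (λ a → :0 :* (:1 :+ a) := :0 :* a) refl (f 0)
    D-one f (suc n) = cong (fromℕ (suc n) *_) (+-identityˡ _)
    -- As g = K/(1 - K) with K = cX, the claim is checked after multiplication by 1 - K.
    D-g : D g ≈ g +ˢ g *ˢ g
    D-g n = *-cancelʳ-≤ (S.1# S.- K) unit n (λ k _ → both k) n ℕ.≤-refl
      where
      unit : (S.1# S.- K) 0 ≡ 1#
      unit = trans (cong (λ m → 1# + - m) (K-coefficient 0)) (solve 1 (λ c → :1 :+ :- (c :* :0) := :1) refl c)
      open import Relation.Binary.Reasoning.Setoid S.setoid renaming (begin_ to beginˢ_; _∎ to _∎ˢ)
      both : D g *ˢ (S.1# S.- K) ≈ (g +ˢ g *ˢ g) *ˢ (S.1# S.- K)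
      both = beginˢ
        D g *ˢ (S.1# S.- K)
          ≈⟨ S.solve 2 (λ d k → d :* (:1 :- k) := d :- k :* d) S.refl (D g) K ⟩
        D g S.- K *ˢ D g
          ≈⟨ S.+-congʳ (S.trans (D-cong g-step)
               (S.trans (D-product K (S.1# +ˢ g)) (S.+-cong (S.*-congʳ D-K) (S.*-congˡ (D-one g))))) ⟩
        (K *ˢ (S.1# +ˢ g) +ˢ K *ˢ D g) S.- K *ˢ D g
          ≈⟨ S.solve 2 (λ a b → (a :+ b) :- b := a) S.refl _ _ ⟩
        K *ˢ (S.1# +ˢ g)
          ≈⟨ S.sym g-step ⟩
        g
          ≈⟨ S.solve 2 (λ g a → g := g :+ a :* g :- g :* a) S.refl g (S.1# +ˢ g) ⟩
        g +ˢ (S.1# +ˢ g) *ˢ g S.- g *ˢ (S.1# +ˢ g)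
          ≈⟨ S.+-congˡ (S.-‿cong (S.*-congʳ g-step)) ⟩
        g +ˢ (S.1# +ˢ g) *ˢ g S.- K *ˢ (S.1# +ˢ g) *ˢ (S.1# +ˢ g)
          ≈⟨ S.+-congʳ (S.+-congʳ g-step) ⟩
        K *ˢ (S.1# +ˢ g) +ˢ (S.1# +ˢ g) *ˢ g S.- K *ˢ (S.1# +ˢ g) *ˢ (S.1# +ˢ g)
          ≈⟨ S.solve 2 (λ g k → k :* (:1 :+ g) :+ (:1 :+ g) :* g :- k :* (:1 :+ g) :* (:1 :+ g) := (g :+ g :* g)
               :* (:1 :- k)) S.refl g K ⟩
        (g +ˢ g *ˢ g) *ˢ (S.1# S.- K) ∎ˢ
    odd-part : oddPower (c ^_) ≈ g S.- h
    odd-part zero = solve 0 (:0 := :0 :- :0) refl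
    odd-part (suc n) = trans (parity (suc n)) (cong (λ m → c ^ suc n - m) (sym (neg-power (suc n))))
      where
      sign : ℕ → Carrier
      sign n = if isOdd n then - 1# else 1#
      sign-suc : ∀ n → sign (suc n) ≡ - sign n
      sign-suc zero = refl
      sign-suc (suc zero) = solve 0 (:1 := :- :- :1) refl
      sign-suc (suc (suc n)) = sign-suc n
      neg-power : ∀ n → (- c) ^ n ≡ sign n * c ^ n
      neg-power zero = sym (*-identityˡ 1#)
      neg-power (suc n) = trans (cong (- c *_) (neg-power n))
          (trans (solve 3 (λ c s p → :- c :* (s :* p) := :- s :* (c :* p)) refl c (sign n) (c ^ n))
        (cong (_* (c * c ^ n)) (sym (sign-suc n))))
      parity : ∀ n → oddPower (c ^_) n ≡ c ^ n - sign n * c ^ n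
      parity n with isOdd n
      ... | true = solve 1 (λ p → :2 :* p := p :- :- :1 :* p) refl (c ^ n)
      ... | false = solve 1 (λ p → :0 := p :- :1 :* p) refl (c ^ n)
    D-q′ : D (q c) ≈ 2ˢ *ˢ (g +ˢ g *ˢ g)
    D-q′ = S.trans (D-one (2ˢ *ˢ g)) (λ n → trans (cong (fromℕ n *_) (double g n))
      (trans (solve 3 (λ m t g → m :* (t :* g) := t :* (m :* g)) refl (fromℕ n) 2# (g n))
          (trans (cong (2# *_) (D-g n)) (sym (double _ n)))))
    equal : 2ˢ *ˢ D (q c) ≈ 2ˢ *ˢ (oddPower (c ^_) *ˢ q c)
    equal = S.trans (S.*-congˡ D-q′) (S.trans
      (S.solve 1 (λ g → :2 :* (:2 :* (g :+ g :* g)) := (:1 :+ :2 :* g) :* (:1 :+ :2 :* g) :- :1) S.refl g)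
      (S.trans (S.+-congˡ (S.-‿cong (S.sym (q-inverse refl))))
      (S.trans (S.solve 2 (λ g h → (:1 :+ :2 :* g) :* (:1 :+ :2 :* g) :- (:1 :+ :2 :* g) :* (:1 :+ :2 :* h) :=
          :2 :* ((g :- h) :* (:1 :+ :2 :* g))) S.refl g h)
      (S.*-congˡ (S.*-congʳ (S.sym odd-part))))))

  D-∏ : ∀ {A : Set} (f L : A → Series) xs → (∀ x → D (f x) ≈ L x *ˢ f x) → D (S.∏ f xs) ≈ S.∑ L xs *ˢ S.∏ f xs
  D-∏ f L [] e = S.trans one (S.sym (S.zeroˡ _))
    where
    one : D S.1# ≈ S.0#
    one zero = zeroˡ _
    one (suc n) = zeroʳ _
  D-∏ f L (x ∷ xs) e = S.trans (D-product (f x) (S.∏ f xs))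
      (S.trans (S.+-cong (S.*-congʳ (e x)) (S.*-congˡ (D-∏ f L xs e)))
    (S.solve 4 (λ l f s p → l :* f :* p :+ f :* (s :* p) := (l :+ s) :* (f :* p)) S.refl (L x) (f x) (S.∑ L xs)
        (S.∏ f xs)))

  powerSum : List Carrier → ℕ → Carrier
  powerSum xs r = ∑ (_^ r) xs

  -- Both series start with 1. The logarithmic derivative of the kernel is the sum of those of its
  -- factors `q (x * y)`, and in odd degree r these add up to 2 p_r(x) p_r(y).
  kernel-zSum : ∀ b ys xs → kernel ys xs ≈[ b ] zSum b (λ r → powerSum xs r * powerSum ys r)
  kernel-zSum b ys xs = D-unique (oddPower w) b refl constant-term
    (λ n _ → trans (D-∏ (λ x → S.∏ (λ y → q (x * y)) ys) (λ x → S.∑ (λ y → oddPower ((x * y) ^_)) ys) xs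
        (λ x → D-∏ _ (λ y → oddPower ((x * y) ^_)) ys (λ y → D-q (x * y))) n)
      (S.*-congʳ {kernel ys xs} logarithmic n))
    (D-zSum b w)
    where
    w : ℕ → Carrier
    w r = powerSum xs r * powerSum ys r
    S-∑-coefficient : ∀ {A : Set} (f : A → Series) zs n → S.∑ f zs n ≡ ∑ (λ y → f y n) zs
    S-∑-coefficient f [] n = refl
    S-∑-coefficient f (x ∷ zs) n = cong (f x n +_) (S-∑-coefficient f zs n)
    S-∏-constant : ∀ {A : Set} (f : A → Series) zs → (∀ z → f z 0 ≡ 1#) → S.∏ f zs 0 ≡ 1#
    S-∏-constant f [] e = refl
    S-∏-constant f (x ∷ zs) e = trans (cong₂ _*_ (e x) (S-∏-constant f zs e)) (*-identityˡ 1#)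
    logarithmic : S.∑ (λ x → S.∑ (λ y → oddPower ((x * y) ^_)) ys) xs ≈ oddPower w
    logarithmic n = trans (trans (S-∑-coefficient _ xs n)
        (∑-cong xs (λ {x} _ → S-∑-coefficient (λ y → oddPower ((x * y) ^_)) ys n))) collect
      where
      collect : ∑ (λ x → ∑ (λ y → oddPower ((x * y) ^_) n) ys) xs ≡ oddPower w n
      collect with isOdd n
      ... | false = ∑-zero xs (λ _ → ∑-zero ys (λ _ → refl))
      ... | true = begin
        ∑ (λ x → ∑ (λ y → 2# * (x * y) ^ n) ys) xs
          ≡⟨ ∑-cong xs (λ {x} _ → trans (∑-cong ys
               (λ {y} _ → trans (cong (2# *_) (^-* x y n))
               (solve 3 (λ t a b → t :* (a :* b) := t :* a :* b) refl 2# (x ^ n) (y ^ n))))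
               (∑-*ˡ (2# * x ^ n) _ ys)) ⟩
        ∑ (λ x → 2# * x ^ n * powerSum ys n) xs
          ≡⟨ trans (∑-*ʳ (powerSum ys n) _ xs) (cong (_* powerSum ys n) (∑-*ˡ 2# (_^ n) xs)) ⟩
        2# * powerSum xs n * powerSum ys n
          ≡⟨ *-assoc _ _ _ ⟩
        2# * w n ∎
    oddPartsB-0 : ∀ b → oddPartsB b 0 ≡ [] ∷ []
    oddPartsB-0 zero = refl
    oddPartsB-0 (suc b) = trans (oddPartsB-< b 0 (s≤s z≤n)) (oddPartsB-0 b)
    constant-term : kernel ys xs 0 ≡ zSum b w 0
    constant-term = begin
      kernel ys xs 0
        ≡⟨ S-∏-constant _ xs (λ x → S-∏-constant _ ys (λ y → solve 0 (:1 :+ (:1 :+ :1) :* :0 := :1) refl)) ⟩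
      1#
        ≡⟨ trans (cong (λ m → 1# * m) (trans (cong (_⁻¹) (+-identityʳ 1#))
             (trans (sym (*-identityˡ _)) (inverseʳ 1≢0)))) (*-identityˡ 1#) ⟨
      zWeight []
        ≡⟨ solve 1 (λ a → a := a :* :1 :+ :0) refl (zWeight []) ⟩
      zWeight [] * 1# + 0#
        ≡⟨ cong (∑ (λ ρ → zWeight ρ * ∏ w ρ)) (oddPartsB-0 b) ⟨
      zSum b w 0 ∎

-- Linear independence of products of power sums.

insertPart-surjective : ∀ {b r ρ} → OddParts b ρ → mult r ρ ≢ 0 → ∃[ σ ] OddParts b σ × ρ ≡ insertPart r σ
insertPart-surjective [] m = contradiction refl m
insertPart-surjective {r = r} (cons {a} {_} {ρ} o l p) m with r ≟ suc a
... | yes refl = ρ , OddParts-≤ l p , sym (insertPart-≥ ℕ.≤-refl p)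
... | no r≢a with insertPart-surjective p m
...   | σ , p′ , refl = suc a ∷ σ , cons o l p′ , sym (insertPart-< σ r<a)
  where
  r<a : r < suc a
  r<a with r ≤? suc a
  ... | yes r≤a = ℕ.≤∧≢⇒< r≤a r≢a
  ... | no r≰a = contradiction (mult-OddParts-> (ℕ.≰⇒> r≰a) p) m

oddPartsB≡OP : ∀ {b n} → n ≤ b → oddPartsB b n ≡ OP n
oddPartsB≡OP l = go (ℕ.≤⇒≤′ l)
  where
  go : ∀ {n b} → n ℕ.≤′ b → oddPartsB b n ≡ OP n
  go ℕ.≤′-refl = refl
  go (ℕ.≤′-step l) = trans (oddPartsB-< _ _ (s≤s (ℕ.≤′⇒≤ l))) (go l)

smaller-part : ∀ r ρ → All (r ℕ.≤_) ρ ⊎ (∃[ s ] s < r × mult s ρ ≢ 0)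
smaller-part r [] = inj₁ []
smaller-part r (a ∷ ρ) with r ≤? a | smaller-part r ρ
... | no r≰a | _ = inj₂ (a , ℕ.≰⇒> r≰a , λ e → contradiction (trans (sym (mult-here a ρ)) e) (λ ()))
... | yes r≤a | inj₁ ps = inj₁ (r≤a ∷ ps)
... | yes r≤a | inj₂ (s , s<r , m) = inj₂ (s , s<r , λ e → m
      (trans (sym (mult-there {s} {a} ρ (λ { refl → ℕ.<-irrefl refl (ℕ.<-≤-trans s<r r≤a) }))) e))

-- A strict partition is itself such a list, so the same condition covers the variables of P and the
-- arguments of P*.
record Points (ns : List ℕ) : Set where
  constructor points
  field
    positive : All (0 ℕ.<_) ns
    distinct : AllPairs _≢_ ns

∈-size : ∀ {n} ns → n ∈ ns → n ≤ size ns
∈-size (n ∷ ns) (here refl) = ℕ.m≤m+n n (size ns)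
∈-size (m ∷ ns) (there p) = ℕ.≤-trans (∈-size ns p) (ℕ.m≤n+m (size ns) m)

-- Every m above the sum of the others is a new point. One variable can thus run through infinitely
-- many values while the others stay fixed.
Points-∷ : ∀ {m ns} → size ns < m → Points ns → Points (m ∷ ns)
Points-∷ {m} {ns} l (points p d) = points (ℕ.≤-<-trans z≤n l ∷ p)
    (All.tabulate (λ i → λ { refl → ℕ.<-irrefl refl (ℕ.≤-<-trans (∈-size ns i) l) }) ∷ d)

some-points : ∀ n → ∃[ ns ] Points ns × length ns ≡ n
some-points zero = [] , points [] [] , refl
some-points (suc n) with some-points n
... | ns , p , e = suc (size ns) ∷ ns , Points-∷ ℕ.≤-refl p , cong suc e

module LinearIndependence (F : OrderedField) where
  open FieldTheory F
  open Symmetrised F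
  open PowerSeries F
  open OddSums F
  open ≡.≡-Reasoning

  points-generic : ∀ {ns} → Points ns → Generic (map fromℕ ns)
  points-generic (points p d) = generic (All.map⁺ (All.map fromℕ-pos≢0 p))
    (AllPairs.map⁺ (AllPairs.map (λ m≢n e → m≢n (fromℕ-injective (x-y≡0⇒x≡y e))) d))
    (AllPairs.map⁺ (sums p d))
    where
    sums : ∀ {ns} → All (0 ℕ.<_) ns → AllPairs _≢_ ns → AllPairs (λ m n → fromℕ m + fromℕ n ≢ 0#) ns
    sums [] [] = []
    sums (_∷_ {m} p ps) (d ∷ ds) = All.map (λ {n} _ e → fromℕ-pos≢0 (ℕ.<-≤-trans p (ℕ.m≤m+n m n))
        (trans (fromℕ-+ m n) e)) d ∷ sums ps ds

  Polynomial : Set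
  Polynomial = List Carrier

  eval : Polynomial → Carrier → Carrier
  eval [] t = 0#
  eval (a ∷ p) t = a + t * eval p t

  coefficient : Polynomial → ℕ → Carrier
  coefficient [] j = 0#
  coefficient (a ∷ p) zero = a
  coefficient (a ∷ p) (suc j) = coefficient p j

  private
    -- horner t p is the quotient of (c + X p) by (X - t), by synthetic division.
    horner : Carrier → Polynomial → Polynomial
    horner t [] = []
    horner t (a ∷ p) = eval (a ∷ p) t ∷ horner t p

    horner-eval : ∀ s t p → t * eval p t - s * eval p s ≡ (t - s) * eval (horner s p) t
    horner-eval s t [] = solve 2 (λ s t → t :* :0 :- s :* :0 := (t :- s) :* :0) refl s t
    horner-eval s t (a ∷ p) = begin
      t * (a + t * eval p t) - s * (a + s * eval p s)
        ≡⟨ solve 5 (λ s t a e f → t :* (a :+ t :* e) :- s :* (a :+ s :* f) := (t :- s) :* (a :+ s :* f) :+ t :*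
             (t :* e :- s :* f)) refl s t a (eval p t) (eval p s) ⟩
      (t - s) * (a + s * eval p s) + t * (t * eval p t - s * eval p s)
        ≡⟨ cong (λ m → (t - s) * (a + s * eval p s) + t * m) (horner-eval s t p) ⟩
      (t - s) * (a + s * eval p s) + t * ((t - s) * eval (horner s p) t)
        ≡⟨ solve 4 (λ d a t e → d :* a :+ t :* (d :* e) := d :* (a :+ t :* e)) refl (t - s) (a + s * eval p s) t
             _ ⟩
      (t - s) * (a + s * eval p s + t * eval (horner s p) t) ∎

    horner-length : ∀ s p → length (horner s p) ≡ length p
    horner-length s [] = refl
    horner-length s (a ∷ p) = cong suc (horner-length s p)

    horner-zero : ∀ s p → All (_≡ 0#) (horner s p) → All (_≡ 0#) p × eval p s ≡ 0#
    horner-zero s [] [] = [] , refl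
    horner-zero s (a ∷ p) (e ∷ es) with horner-zero s p es
    ... | ps , e′ = trans (sym (trans (cong (λ m → a + s * m) e′)
          (solve 2 (λ a s → a :+ s :* :0 := a) refl a s))) e ∷ ps , e

  -- Division by X - (b + 1) gives a shorter polynomial that vanishes at all integers above b + 1,
  -- and induction on the length applies to it.
  polynomial-zero : ∀ p b → (∀ m → b < m → eval p (fromℕ m) ≡ 0#) → All (_≡ 0#) p
  polynomial-zero p b h = go (length p) p b ℕ.≤-refl h
    where
    go : ∀ n p b → length p ≤ n → (∀ m → b < m → eval p (fromℕ m) ≡ 0#) → All (_≡ 0#) p
    go n [] b l h = []
    go (suc n) (a ∷ p) b (s≤s l) h with horner-zero s p
        (go n (horner s p) (suc b) (ℕ.≤-trans (ℕ.≤-reflexive (horner-length s p)) l) quotient)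
      where
      s = fromℕ (suc b)
      quotient : ∀ m → suc b < m → eval (horner s p) (fromℕ m) ≡ 0#
      quotient m b<m = *-zero-cancelˡ {fromℕ m - s} (λ e → ℕ.<-irrefl (sym (fromℕ-injective (x-y≡0⇒x≡y e))) b<m)
          (begin
        (fromℕ m - s) * eval (horner s p) (fromℕ m)
          ≡⟨ horner-eval s (fromℕ m) p ⟨
        fromℕ m * eval p (fromℕ m) - s * eval p s
          ≡⟨ solve 3 (λ a e f → e :- f := (a :+ e) :- (a :+ f)) refl a _ _ ⟩
        eval (a ∷ p) (fromℕ m) - eval (a ∷ p) s
          ≡⟨ cong₂ _-_ (h m (ℕ.<-trans (ℕ.n<1+n b) b<m)) (h (suc b) (ℕ.n<1+n b)) ⟩
        0# - 0#
          ≡⟨ -‿inverseʳ 0# ⟩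
        0# ∎)
    ... | ps , e = trans (sym (trans (cong (λ m → a + fromℕ (suc b) * m) e)
          (solve 2 (λ a s → a :+ s :* :0 := a) refl a _))) (h (suc b) (ℕ.n<1+n b)) ∷ ps

  coefficient-zero : ∀ {p} j → All (_≡ 0#) p → coefficient p j ≡ 0#
  coefficient-zero j [] = refl
  coefficient-zero zero (e ∷ _) = e
  coefficient-zero (suc j) (_ ∷ es) = coefficient-zero j es

  infixl 6 _⊞_
  _⊞_ : Polynomial → Polynomial → Polynomial
  [] ⊞ q = q
  (a ∷ p) ⊞ [] = a ∷ p
  (a ∷ p) ⊞ (b ∷ q) = a + b ∷ p ⊞ q

  _⊡_ : Carrier → Polynomial → Polynomial
  c ⊡ p = map (c *_) p

  raise : ℕ → Polynomial → Polynomial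
  raise zero p = p
  raise (suc n) p = 0# ∷ raise n p

  eval-⊞ : ∀ p q t → eval (p ⊞ q) t ≡ eval p t + eval q t
  eval-⊞ [] q t = sym (+-identityˡ _)
  eval-⊞ (a ∷ p) [] t = sym (+-identityʳ _)
  eval-⊞ (a ∷ p) (b ∷ q) t = trans (cong (λ m → a + b + t * m) (eval-⊞ p q t))
    (solve 5 (λ a b t x y → a :+ b :+ t :* (x :+ y) := a :+ t :* x :+ (b :+ t :* y)) refl a b t _ _)

  eval-⊡ : ∀ c p t → eval (c ⊡ p) t ≡ c * eval p t
  eval-⊡ c [] t = sym (zeroʳ c)
  eval-⊡ c (a ∷ p) t = trans (cong (λ m → c * a + t * m) (eval-⊡ c p t))
      (solve 4 (λ c a t x → c :* a :+ t :* (c :* x) := c :* (a :+ t :* x)) refl c a t _)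

  eval-raise : ∀ n p t → eval (raise n p) t ≡ t ^ n * eval p t
  eval-raise zero p t = sym (*-identityˡ _)
  eval-raise (suc n) p t = trans (cong (λ m → 0# + t * m) (eval-raise n p t))
      (solve 3 (λ t a b → :0 :+ t :* (a :* b) := t :* a :* b) refl t (t ^ n) _)

  coefficient-⊞ : ∀ p q j → coefficient (p ⊞ q) j ≡ coefficient p j + coefficient q j
  coefficient-⊞ [] q j = sym (+-identityˡ _)
  coefficient-⊞ (a ∷ p) [] j = sym (+-identityʳ _)
  coefficient-⊞ (a ∷ p) (b ∷ q) zero = refl
  coefficient-⊞ (a ∷ p) (b ∷ q) (suc j) = coefficient-⊞ p q j

  coefficient-⊡ : ∀ c p j → coefficient (c ⊡ p) j ≡ c * coefficient p j
  coefficient-⊡ c [] j = sym (zeroʳ c)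
  coefficient-⊡ c (a ∷ p) zero = refl
  coefficient-⊡ c (a ∷ p) (suc j) = coefficient-⊡ c p j

  coefficient-raise-< : ∀ {n} p j → j < n → coefficient (raise n p) j ≡ 0#
  coefficient-raise-< {suc n} p zero l = refl
  coefficient-raise-< {suc n} p (suc j) (s≤s l) = coefficient-raise-< p j l

  coefficient-raise-≡ : ∀ n p → coefficient (raise n p) n ≡ coefficient p 0
  coefficient-raise-≡ zero p = refl
  coefficient-raise-≡ (suc n) p = coefficient-raise-≡ n p

  -- The polynomial ∏ (w a + Xᵃ); for w the power sums of xs, its value at t is the product of the power sums of t ∷ xs.
  shiftedProduct : (ℕ → Carrier) → List ℕ → Polynomial
  shiftedProduct w [] = 1# ∷ []
  shiftedProduct w (a ∷ ρ) = (w a ⊡ shiftedProduct w ρ) ⊞ raise a (shiftedProduct w ρ)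

  eval-shiftedProduct : ∀ w ρ t → eval (shiftedProduct w ρ) t ≡ ∏ (λ a → t ^ a + w a) ρ
  eval-shiftedProduct w [] t = solve 1 (λ t → :1 :+ t :* :0 := :1) refl t
  eval-shiftedProduct w (a ∷ ρ) t = begin
    eval ((w a ⊡ shiftedProduct w ρ) ⊞ raise a (shiftedProduct w ρ)) t
      ≡⟨ trans (eval-⊞ (w a ⊡ shiftedProduct w ρ) (raise a (shiftedProduct w ρ)) t)
           (cong₂ _+_ (eval-⊡ (w a) (shiftedProduct w ρ) t) (eval-raise a (shiftedProduct w ρ) t)) ⟩
    w a * eval (shiftedProduct w ρ) t + t ^ a * eval (shiftedProduct w ρ) t
      ≡⟨ solve 3 (λ w t e → w :* e :+ t :* e := (t :+ w) :* e) refl (w a) (t ^ a) _ ⟩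
    (t ^ a + w a) * eval (shiftedProduct w ρ) t
      ≡⟨ cong ((t ^ a + w a) *_) (eval-shiftedProduct w ρ t) ⟩
    (t ^ a + w a) * ∏ (λ a → t ^ a + w a) ρ ∎

  -- The partial derivative of the product with respect to `w r`, by the Leibniz rule;
  -- `mult r (a ∷ [])` is 1 if a = r and 0 otherwise.
  derivative : ℕ → (ℕ → Carrier) → List ℕ → Carrier
  derivative r w [] = 0#
  derivative r w (a ∷ ρ) = w a * derivative r w ρ + fromℕ (mult r (a ∷ [])) * ∏ w ρ

  private
    multiplicity-here : ∀ r → fromℕ (mult r (r ∷ [])) ≡ 1#
    multiplicity-here r = trans (cong fromℕ (mult-here r [])) (+-identityʳ 1#)

    coefficient-0 : ∀ c w ρ → All (suc c ℕ.≤_) ρ → coefficient (shiftedProduct w ρ) 0 ≡ ∏ w ρ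
    coefficient-0 c w [] [] = refl
    coefficient-0 c w (suc a ∷ ρ) (l ∷ ls) = trans (coefficient-⊞ (w (suc a) ⊡ shiftedProduct w ρ) _ 0)
      (trans (cong (_+ 0#) (trans (coefficient-⊡ (w (suc a)) (shiftedProduct w ρ) 0)
          (cong (w (suc a) *_) (coefficient-0 c w ρ ls)))) (+-identityʳ _))

    -- If no part is below r, then t^r arises only by choosing t^r in one factor with part r and `w`
    -- in all other factors.
    coefficient-least : ∀ c w ρ → All (suc c ℕ.≤_) ρ → coefficient (shiftedProduct w ρ) (suc c) ≡ derivative
        (suc c) w ρ
    coefficient-least c w [] [] = refl
    coefficient-least c w (a ∷ ρ) (l ∷ ls) = trans (coefficient-⊞ (w a ⊡ shiftedProduct w ρ) _ (suc c))
      (cong₂ _+_ (trans (coefficient-⊡ (w a) (shiftedProduct w ρ) (suc c))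
          (cong (w a *_) (coefficient-least c w ρ ls))) last)
      where
      last : coefficient (raise a (shiftedProduct w ρ)) (suc c) ≡ fromℕ (mult (suc c) (a ∷ [])) * ∏ w ρ
      last with suc c ≟ a in eq
      ... | yes refl = trans (coefficient-raise-≡ (suc c) (shiftedProduct w ρ))
            (trans (coefficient-0 c w ρ ls) (solve 1 (λ p → p := (:1 :+ :0) :* p) refl _))
      ... | no c≢a = trans (coefficient-raise-< (shiftedProduct w ρ) (suc c) (ℕ.≤∧≢⇒< l c≢a)) (sym (zeroˡ _))

    derivative-multiple : ∀ r w ρ → w r * derivative r w ρ ≡ fromℕ (mult r ρ) * ∏ w ρ
    derivative-multiple r w [] = trans (zeroʳ _) (sym (zeroˡ _))
    derivative-multiple r w (a ∷ ρ) with r ≟ a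
    ... | yes refl = trans (solve 3 (λ w d p → w :* (w :* d :+ (:1 :+ :0) :* p) := w :* (w :* d) :+ w :* p) refl
          (w r) (derivative r w ρ) (∏ w ρ))
          (trans (cong (λ m → w r * m + w r * ∏ w ρ) (derivative-multiple r w ρ))
              (solve 3 (λ w m p → w :* (m :* p) :+ w :* p := (:1 :+ m) :* (w :* p)) refl (w r)
              (fromℕ (mult r ρ)) (∏ w ρ)))
    ... | no _ = trans (solve 4 (λ w x d p → w :* (x :* d :+ :0 :* p) := x :* (w :* d)) refl (w r) (w a)
          (derivative r w ρ) (∏ w ρ))
          (trans (cong (w a *_) (derivative-multiple r w ρ))
              (solve 3 (λ x m p → x :* (m :* p) := m :* (x :* p)) refl (w a) (fromℕ (mult r ρ)) (∏ w ρ)))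

    derivative-insert : ∀ r w ρ → derivative r w (insertPart r ρ) ≡ derivative r w (r ∷ ρ)
    derivative-insert r w [] = refl
    derivative-insert r w (a ∷ ρ) with r <ᵇ a
    ... | false = refl
    ... | true = trans (cong₂ (λ m n → w a * m + fromℕ (mult r (a ∷ [])) * n) (derivative-insert r w ρ)
          (∏-insertPart w r ρ))
          (solve 7 (λ a r d p m n z → a :* (r :* d :+ m :* p) :+ n :* (r :* p) := r :* (a :* d :+ n :* p) :+ m
              :* (a :* p)) refl (w a) (w r) (derivative r w ρ) (∏ w ρ) (fromℕ (mult r (r ∷ [])))
              (fromℕ (mult r (a ∷ []))) 0#)

  derivative-insertPart : ∀ r w ρ → derivative r w (insertPart r ρ) ≡ fromℕ (suc (mult r ρ)) * ∏ w ρ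
  derivative-insertPart r w ρ = trans (derivative-insert r w ρ)
      (trans (cong₂ (λ m n → m + n * ∏ w ρ) (derivative-multiple r w ρ) (multiplicity-here r))
    (solve 2 (λ m p → m :* p :+ :1 :* p := (:1 :+ m) :* p) refl (fromℕ (mult r ρ)) (∏ w ρ)))

  derivative-absent : ∀ r w ρ → mult r ρ ≡ 0 → derivative r w ρ ≡ 0#
  derivative-absent r w [] e = refl
  derivative-absent r w (a ∷ ρ) e with r ≟ a
  ... | no _ = trans (cong (λ m → w a * m + 0# * ∏ w ρ) (derivative-absent r w ρ e))
        (solve 2 (λ a p → a :* :0 :+ :0 :* p := :0) refl (w a) (∏ w ρ))

  powerProduct : List ℕ → List ℕ → Carrier
  powerProduct ns ρ = ∏ (powerSum (map fromℕ ns)) ρ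

  -- One variable t is split off, and a relation becomes a polynomial in t whose coefficients all
  -- vanish. Its coefficient at t^r, for the least relevant r, is a relation in one variable fewer
  -- and in degree lower by r. The partition σ = ρ without one r appears there with the nonzero
  -- factor m_r(σ) + 1. Since r ≥ 1, the number of variables stays at least the degree.
  powerProducts-independent : ∀ k N → k ≤ N → (a : List ℕ → Carrier) →
    (∀ ns → Points ns → length ns ≡ N → ∑ (λ ρ → a ρ * powerProduct ns ρ) (OP k) ≡ 0#) →
    ∀ {ρ} → ρ ∈ OP k → a ρ ≡ 0#
  powerProducts-independent k N l a h = go k k ℕ.≤-refl N l a h
    where
    go : ∀ f k → k ≤ f → ∀ N → k ≤ N → (a : List ℕ → Carrier) →
      (∀ ns → Points ns → length ns ≡ N → ∑ (λ ρ → a ρ * powerProduct ns ρ) (OP k) ≡ 0#) →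
      ∀ {ρ} → ρ ∈ OP k → a ρ ≡ 0#
    go f zero _ N l a h (here refl) with some-points N
    ... | ns , p , e = trans (solve 1 (λ a → a := a :* :1 :+ :0) refl (a [])) (h ns p e)
    go (suc f) (suc k) (s≤s k≤f) (suc N) (s≤s k≤N) a h {ρ} m = any-part ρ m
        (proj₁ (∈⇒OddParts (suc k) (suc k) m)) (proj₂ (∈⇒OddParts (suc k) (suc k) m))
      where
      L = OP (suc k)
      total : List ℕ → List (List ℕ) → Polynomial
      total ns [] = []
      total ns (ρ ∷ L) = (a ρ ⊡ shiftedProduct (powerSum (map fromℕ ns)) ρ) ⊞ total ns L
      eval-total : ∀ ns L t → eval (total ns L) t ≡ ∑
          (λ ρ → a ρ * ∏ (λ r → t ^ r + powerSum (map fromℕ ns) r) ρ) L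
      eval-total ns [] t = refl
      eval-total ns (ρ ∷ L) t = trans (eval-⊞ (a ρ ⊡ shiftedProduct (powerSum (map fromℕ ns)) ρ) _ t)
        (cong₂ _+_ (trans (eval-⊡ (a ρ) (shiftedProduct (powerSum (map fromℕ ns)) ρ) t)
            (cong (a ρ *_) (eval-shiftedProduct (powerSum (map fromℕ ns)) ρ t))) (eval-total ns L t))
      coefficient-total : ∀ ns L j → coefficient (total ns L) j ≡ ∑
          (λ ρ → a ρ * coefficient (shiftedProduct (powerSum (map fromℕ ns)) ρ) j) L
      coefficient-total ns [] j = refl
      coefficient-total ns (ρ ∷ L) j = trans (coefficient-⊞ (a ρ ⊡ shiftedProduct (powerSum (map fromℕ ns)) ρ) _
          j)
        (cong₂ _+_ (coefficient-⊡ (a ρ) (shiftedProduct (powerSum (map fromℕ ns)) ρ) j)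
            (coefficient-total ns L j))
      total-zero : ∀ ns → Points ns → length ns ≡ N → ∀ j → coefficient (total ns L) j ≡ 0#
      total-zero ns p e j = coefficient-zero j (polynomial-zero (total ns L) (size ns)
        (λ t l → trans (eval-total ns L (fromℕ t)) (h (t ∷ ns) (Points-∷ l p) (cong suc e))))
      -- The coefficient of tʳ only involves the parts equal to r once the coefficients a ρ with a smaller part vanish.
      with-part : ∀ R r → r < R → ∀ {ρ} → ρ ∈ L → mult r ρ ≢ 0 → a ρ ≡ 0#
      with-part (suc R) zero _ {ρ} m μ = contradiction (mult-even 0 refl (proj₁ (∈⇒OddParts (suc k) (suc k) m)))
          μ
      with-part (suc R) (suc c) (s≤s c<R) {ρ} m μ with isOdd (suc c) in o
      ... | false = contradiction (mult-even (suc c) o (proj₁ (∈⇒OddParts (suc k) (suc k) m))) μ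
      ... | true with insertPart-surjective (proj₁ (∈⇒OddParts (suc k) (suc k) m)) μ
      ...   | σ , pσ , refl = *-zero-cancelˡ (fromℕ-suc≢0 (mult (suc c) σ)) (trans (*-comm _ _)
                (go f (k ∸ c) (ℕ.≤-trans (ℕ.m∸n≤m k c) k≤f) N (ℕ.≤-trans (ℕ.m∸n≤m k c) k≤N)
                  (λ σ → a (insertPart (suc c) σ) * fromℕ (suc (mult (suc c) σ))) reduced σ∈))
        where
        sizes : suc c ℕ.+ size σ ≡ suc k
        sizes = trans (sym (size-insertPart (suc c) σ)) (proj₂ (∈⇒OddParts (suc k) (suc k) m))
        c≤k : c ≤ k
        c≤k = subst (c ℕ.≤_) (ℕ.suc-injective sizes) (ℕ.m≤m+n c (size σ))
        σ∈ : σ ∈ OP (k ∸ c)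
        σ∈ = subst (λ n → σ ∈ OP n) (trans (sym (ℕ.m+n∸m≡n c (size σ))) (cong (_∸ c) (ℕ.suc-injective sizes)))
            (∈-OP pσ)
        reduced : ∀ ns → Points ns → length ns ≡ N → ∑
            (λ σ → a (insertPart (suc c) σ) * fromℕ (suc (mult (suc c) σ)) * powerProduct ns σ) (OP (k ∸ c)) ≡
            0#
        reduced ns p e = begin
          ∑ (λ σ → a (insertPart (suc c) σ) * fromℕ (suc (mult (suc c) σ)) * powerProduct ns σ) (OP (k ∸ c))
            ≡⟨ cong (∑ _) (oddPartsB≡OP (ℕ.≤-trans (ℕ.m∸n≤m k c) (ℕ.n≤1+n k))) ⟨
          oddSum (suc k) (λ σ → a (insertPart (suc c) σ) * fromℕ (suc (mult (suc c) σ)) * powerProduct ns σ)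
              (k ∸ c)
            ≡⟨ ∑-cong (oddPartsB (suc k) (k ∸ c))
                 (λ {σ} _ → trans (*-assoc _ _ _)
                 (cong (a (insertPart (suc c) σ) *_) (sym (derivative-insertPart (suc c) w σ)))) ⟩
          oddSum (suc k) (λ σ → G (insertPart (suc c) σ)) (k ∸ c)
            ≡⟨ shift-≥ (suc c) (oddSum (suc k) (λ σ → G (insertPart (suc c) σ))) (k ∸ c) ⟨
          shift (suc c) (oddSum (suc k) (λ σ → G (insertPart (suc c) σ))) (suc c ℕ.+ (k ∸ c))
            ≡⟨ cong (shift (suc c) (oddSum (suc k) (λ σ → G (insertPart (suc c) σ))))
                 (cong suc (ℕ.m+[n∸m]≡n c≤k)) ⟩
          shift (suc c) (oddSum (suc k) (λ σ → G (insertPart (suc c) σ))) (suc k)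
            ≡⟨ oddSum-insertPart (suc k) c G o (s≤s c≤k)
                 (λ {ρ} e → trans (cong (a ρ *_) (derivative-absent (suc c) w ρ e)) (zeroʳ _)) (suc k) ⟨
          ∑ G L
            ≡⟨ ∑-cong L (λ {ρ} m → least ρ m) ⟩
          ∑ (λ ρ → a ρ * coefficient (shiftedProduct w ρ) (suc c)) L
            ≡⟨ coefficient-total ns L (suc c) ⟨
          coefficient (total ns L) (suc c)
            ≡⟨ total-zero ns p e (suc c) ⟩
          0# ∎
          where
          w = powerSum (map fromℕ ns)
          G : List ℕ → Carrier
          G ρ = a ρ * derivative (suc c) w ρ
          least : ∀ ρ → ρ ∈ L → G ρ ≡ a ρ * coefficient (shiftedProduct w ρ) (suc c)
          least ρ m with smaller-part (suc c) ρ
          ... | inj₁ ps = cong (a ρ *_) (sym (coefficient-least c w ρ ps))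
          ... | inj₂ (s , s<c , μ) = trans (cong (_* derivative (suc c) w ρ) vanish)
                (trans (zeroˡ _) (sym (trans (cong (_* coefficient (shiftedProduct w ρ) (suc c)) vanish)
                (zeroˡ _))))
            where
            vanish : a ρ ≡ 0#
            vanish = with-part R s (ℕ.<-≤-trans s<c c<R) m μ
      any-part : ∀ ρ → ρ ∈ L → OddParts (suc k) ρ → size ρ ≡ suc k → a ρ ≡ 0#
      any-part (r ∷ ρ) m _ _ = with-part (suc r) r ℕ.≤-refl m
          (λ e → contradiction (trans (sym (mult-here r ρ)) e) (λ ()))

-- Strict partitions as lists, and removal of a box.

strictPartsB-≥ : ∀ b n → suc b ≤ n → strictPartsB (suc b) n ≡ strictPartsB b n ++ map (suc b ∷_)
    (strictPartsB b (n ∸ suc b))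
strictPartsB-≥ b n l = cong (λ t → strictPartsB b n ++
    (if t then map (suc b ∷_) (strictPartsB b (n ∸ suc b)) else [])) (≤ᵇ-true l)

strictPartsB-< : ∀ b n → n < suc b → strictPartsB (suc b) n ≡ strictPartsB b n
strictPartsB-< b n l = trans (cong (λ t → strictPartsB b n ++
    (if t then map (suc b ∷_) (strictPartsB b (n ∸ suc b)) else [])) (≤ᵇ-false l)) (List.++-identityʳ _)

strictPartsB≡SP : ∀ {b n} → n ≤ b → strictPartsB b n ≡ SP n
strictPartsB≡SP l = go (ℕ.≤⇒≤′ l)
  where
  go : ∀ {n b} → n ℕ.≤′ b → strictPartsB b n ≡ SP n
  go ℕ.≤′-refl = refl
  go (ℕ.≤′-step l) = trans (strictPartsB-< _ _ (s≤s (ℕ.≤′⇒≤ l))) (go l)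

∈⇒Strict : ∀ b n {α} → α ∈ strictPartsB b n → Strict b α × size α ≡ n
∈⇒Strict zero zero (here refl) = [] , refl
∈⇒Strict (suc b) n m with suc b ≤? n
... | no b≮n with ∈⇒Strict b n (subst (_ ∈_) (strictPartsB-< b n (ℕ.≰⇒> b≮n)) m)
...   | s , e = Strict-≤ (ℕ.n≤1+n b) s , e
∈⇒Strict (suc b) n m | yes b<n with ∈.∈-++⁻ (strictPartsB b n) (subst (_ ∈_) (strictPartsB-≥ b n b<n) m)
... | inj₁ m′ with ∈⇒Strict b n m′
...   | s , e = Strict-≤ (ℕ.n≤1+n b) s , e
∈⇒Strict (suc b) n m | yes b<n | inj₂ m′ with ∈.∈-map⁻ (suc b ∷_) m′
... | α , m″ , refl with ∈⇒Strict b (n ∸ suc b) m″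
...   | s , e = ℕ.≤-refl ∷ s , trans (cong (suc b ℕ.+_) e) (ℕ.m+[n∸m]≡n b<n)

strictPartsB-unique : ∀ b n → Unique (strictPartsB b n)
strictPartsB-unique zero zero = [] ∷ []
strictPartsB-unique zero (suc n) = []
strictPartsB-unique (suc b) n with suc b ≤? n
... | no b≮n = subst Unique (sym (strictPartsB-< b n (ℕ.≰⇒> b≮n))) (strictPartsB-unique b n)
... | yes b<n = subst Unique (sym (strictPartsB-≥ b n b<n))
    (Unique.++⁺ (strictPartsB-unique b n) (Unique.map⁺ List.∷-injectiveʳ (strictPartsB-unique b (n ∸ suc b)))
        disjoint)
  where
  disjoint : ∀ {α} → ¬ (α ∈ strictPartsB b n × α ∈ map (suc b ∷_) (strictPartsB b (n ∸ suc b)))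
  disjoint (m , m′) with ∈.∈-map⁻ (suc b ∷_) m′
  ... | _ , _ , refl with proj₁ (∈⇒Strict b n m)
  ...   | b<b ∷ _ = ℕ.<-irrefl refl b<b

Strict-bound : ∀ {b α} → Strict b α → All (ℕ._≤ b) α
Strict-bound [] = []
Strict-bound (l ∷ s) = l ∷ All.map (λ m → ℕ.≤-trans m (ℕ.<⇒≤ l)) (Strict-bound s)

Strict-points : ∀ {b α} → Strict b α → Points α
Strict-points [] = points [] []
Strict-points (l ∷ s) with Strict-points s
... | points p d = points (s≤s z≤n ∷ p) (All.map (λ m → λ { refl → ℕ.<-irrefl refl m }) (Strict-bound s) ∷ d)

-- `Pˢ-vanish` excludes rearrangements, and for strict partitions these are equalities.
Strict-↭ : ∀ {a b α β} → Strict a α → Strict b β → α ↭ β → α ≡ β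
Strict-↭ [] [] p = refl
Strict-↭ [] (_ ∷ _) p = contradiction (↭-sym p) ↭.¬x∷xs↭[]
Strict-↭ (_ ∷ _) [] p = contradiction p ↭.¬x∷xs↭[]
Strict-↭ (_ ∷ s) (_ ∷ t) p with ℕ.≤-antisym (bounded s t p) (bounded t s (↭-sym p))
  where
  bounded : ∀ {a b α β} → Strict a α → Strict b β → suc a ∷ α ↭ suc b ∷ β → a ≤ b
  bounded s t p = ℕ.≤-pred (All.lookup (Strict-bound (ℕ.≤-refl ∷ t)) (↭.∈-resp-↭ p (here refl)))
... | refl = cong (_ ∷_) (Strict-↭ s t (↭.drop-∷ p))

Strict⇒isStrict : ∀ {b α} → Strict b α → isStrict α ≡ true
Strict⇒isStrict [] = refl
Strict⇒isStrict (_ ∷ []) = refl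
Strict⇒isStrict (_∷_ {a} _ (_∷_ {c} {α = α} c<a s)) = trans (cong (_∧ isStrict (suc c ∷ α)) (<ᵇ-true c<a))
    (Strict⇒isStrict (c<a ∷ s))
  where
  <ᵇ-true : ∀ {m n} → m < n → (m <ᵇ n) ≡ true
  <ᵇ-true {m} {n} l with m <ᵇ n | ℕ.<⇒<ᵇ l
  ... | true | _ = refl

private
  data HeadBound (b : ℕ) : List ℕ → Set where
    []  : HeadBound b []
    _∷_ : ∀ {a} → a ≤ b → ∀ α → HeadBound b (a ∷ α)

  removeBox-bound : ∀ {b α} → Strict b α → ∀ {β} → β ∈ removeBox α → HeadBound b β
  removeBox-bound (_∷_ {zero} _ []) (here refl) = []
  removeBox-bound (_∷_ {suc a} l s) (here refl) = ℕ.<⇒≤ l ∷ _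
  removeBox-bound (_∷_ {zero} l s) (there m) with ∈.∈-map⁻ (1 ∷_) m
  ... | β , _ , refl = l ∷ β
  removeBox-bound (_∷_ {suc a} l s) (there m) with ∈.∈-map⁻ (suc (suc a) ∷_) m
  ... | β , _ , refl = l ∷ β

  isStrict-∷ : ∀ {b α} → HeadBound b α → isStrict (suc b ∷ α) ≡ isStrict α
  isStrict-∷ [] = refl
  isStrict-∷ {b} (_∷_ {a} l α) with a <ᵇ suc b | ℕ.<⇒<ᵇ (s≤s l)
  ... | true | _ = refl

  isStrict-repeat : ∀ a α → isStrict (suc a ∷ suc a ∷ α) ≡ false
  isStrict-repeat a α with a <ᵇ a in eq
  ... | false = refl
  ... | true = contradiction (ℕ.<ᵇ⇒< a a (subst Bool.T (sym eq) tt)) (ℕ.<-irrefl refl)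

  -- What a first part b + 1 leaves when it loses a box: a first part b, or no part at all if b = 0.
  top : ℕ → List ℕ → List ℕ
  top zero α = α
  top (suc b) α = suc b ∷ α

-- Duality of adding and removing boxes, Euler's theorem, vanishing of P*.

module Boxes (F : OrderedField) where
  open FieldTheory F
  open Symmetrised F
  open PowerSeries F
  open Kernel F
  open StrictSums F
  open OddSums F
  open ≡.≡-Reasoning

  -- The adjoint of `addBox`: it acts on coefficients as adding a box acts on functions. The filter
  -- is that of `gAux`, so the numbers g are iterates of `up`.
  up : (List ℕ → Carrier) → List ℕ → Carrier
  up Y α = ∑ Y (filter (λ μ → Bool.T? (isStrict μ)) (removeBox α))

  private
    strictPart : (List ℕ → Carrier) → List ℕ → Carrier
    strictPart Y μ = if isStrict μ then Y μ else 0#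

    up-strictPart : ∀ Y α → up Y α ≡ ∑ (strictPart Y) (removeBox α)
    up-strictPart Y α = go (removeBox α)
      where
      go : ∀ L → ∑ Y (filter (λ μ → Bool.T? (isStrict μ)) L) ≡ ∑ (strictPart Y) L
      go [] = refl
      go (μ ∷ L) with isStrict μ
      ... | true = cong (Y μ +_) (go L)
      ... | false = trans (go L) (sym (+-identityˡ _))

    up-∷ : ∀ Y {b α} → Strict b α → up Y (suc b ∷ α) ≡ strictPart Y (top b α) + up (λ μ → Y (suc b ∷ μ)) α
    up-∷ Y {b} {α} s = trans (up-strictPart Y (suc b ∷ α)) (trans (unfold b s) (cong (strictPart Y (top b α) +_)
      (trans (∑-map (strictPart Y) (suc b ∷_) (removeBox α))
          (trans (∑-cong (removeBox α) (λ {μ} m → cong (λ t → if t then Y (suc b ∷ μ) else 0#)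
          (isStrict-∷ (removeBox-bound s m))))
        (sym (up-strictPart (λ μ → Y (suc b ∷ μ)) α))))))
      where
      unfold : ∀ b → Strict b α → ∑ (strictPart Y) (removeBox (suc b ∷ α)) ≡ strictPart Y (top b α) + ∑
          (strictPart Y) (map (suc b ∷_) (removeBox α))
      unfold zero _ = refl
      unfold (suc b) _ = refl

    -- The terms in which the new box raises the first part from b to b + 1, beyond the bound; for b
    -- = 0 the box is a new first part.
    overflow : ℕ → (List ℕ → Carrier) → (List ℕ → Carrier) → Series
    overflow b Y G = shift (suc b) (strictSum (ℕ.pred b) (λ μ → Y (top b μ) * G (suc b ∷ μ)))

    top-part : ∀ b Y (G : List ℕ → Carrier) → strictSum b (λ α → strictPart Y (top b α) * G (suc b ∷ α)) ≈
        strictSum (ℕ.pred b) (λ μ → Y (top b μ) * G (suc b ∷ μ))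
    top-part zero Y G = strictSum-cong 0 (λ {α} s → cong (λ t → (if t then Y α else 0#) * G (1 ∷ α))
        (Strict⇒isStrict s))
    top-part (suc b) Y G n = trans (strictSum-suc b _ n) (trans (cong₂ _+_
      (strictSum-cong b (λ {α} s → cong (λ t → (if t then Y (suc b ∷ α) else 0#) * G (suc (suc b) ∷ α))
          (Strict⇒isStrict (ℕ.≤-refl ∷ s))) n)
      (shift-zero (suc b) (strictSum-vanish b
          (λ α → trans (cong (λ t → (if t then Y (suc b ∷ suc b ∷ α) else 0#) * G (suc (suc b) ∷ suc b ∷ α))
          (isStrict-repeat b α)) (zeroˡ _))) n))
      (+-identityʳ _))

    -- Both sides sum over pairs of partitions that differ by one box; the shift accounts for that
    -- box. Pairs whose larger member is not strict are absent from `up` and contribute zero to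
    -- `addBox`, by alternation.
    addBox-series : ∀ b Y G → Alternating G →
      shift 1 (strictSum b (λ α → Y α * addBox G α)) ≈ strictSum b (λ α → up Y α * G α) +ˢ overflow b Y G
    addBox-series zero Y G alt n = sym (trans (cong (_+ overflow 0 Y G n) (strictSum-zero-vanish n))
        (trans (+-identityˡ _)
      (shift-cong 1 (λ k → strictSum-cong 0 (λ { [] → refl }) k) n)))
      where
      strictSum-zero-vanish : ∀ n → strictSum 0 (λ α → up Y α * G α) n ≡ 0#
      strictSum-zero-vanish zero = solve 1 (λ g → :0 :* g :+ :0 := :0) refl (G [])
      strictSum-zero-vanish (suc n) = refl
    addBox-series (suc b) Y G alt n = begin
      shift 1 (strictSum (suc b) (λ α → Y α * addBox G α)) n
        ≡⟨ trans (shift-cong 1 (strictSum-suc b _) n) (shift-+ 1 _ _ n) ⟩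
      shift 1 (strictSum b (λ α → Y α * addBox G α)) n + shift 1
          (shift (suc b) (strictSum b (λ α → Y′ α * (G (suc (suc b) ∷ α) + addBox G′ α)))) n
        ≡⟨ cong₂ _+_ (addBox-series b Y G alt n)
             (trans (trans (shift-comm 1 (suc b) _ n)
             (shift-cong (suc b) (S.trans (shift-cong 1 split) (shift-+ 1 _ _)) n)) (shift-+ (suc b) _ _ n)) ⟩
      (A n + overflow b Y G n) + (shift (suc b) (shift 1 over) n + shift (suc b)
          (shift 1 (strictSum b (λ α → Y′ α * addBox G′ α))) n)
        ≡⟨ cong₂ (λ x y → (A n + overflow b Y G n) + (x + y)) (shift-shift′ n)
             (shift-cong (suc b) (S.trans (addBox-series b Y′ G′ (Alternating-∷ {G} alt (suc b)))
             (λ k → trans (cong (strictSum b (λ α → up Y′ α * G′ α) k +_) (no-overflow k)) (+-identityʳ _)))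
             n) ⟩
      (A n + overflow b Y G n) + (overflow (suc b) Y G n + shift (suc b) (strictSum b (λ α → up Y′ α * G′ α)) n)
        ≡⟨ solve 4 (λ a o p c → (a :+ o) :+ (p :+ c) := (a :+ (o :+ c)) :+ p) refl (A n) _ _ _ ⟩
      (A n + (overflow b Y G n + shift (suc b) (strictSum b (λ α → up Y′ α * G′ α)) n)) + overflow (suc b) Y G n
        ≡⟨ cong (λ m → (A n + m) + overflow (suc b) Y G n)
             (trans (sym (shift-+ (suc b) _ _ n)) (shift-cong (suc b) (S.sym collect) n)) ⟩
      (A n + shift (suc b) (strictSum b (λ α → up Y (suc b ∷ α) * G′ α)) n) + overflow (suc b) Y G n
        ≡⟨ cong (_+ overflow (suc b) Y G n) (strictSum-suc b _ n) ⟨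
      strictSum (suc b) (λ α → up Y α * G α) n + overflow (suc b) Y G n ∎
      where
      Y′ G′ : List ℕ → Carrier
      Y′ α = Y (suc b ∷ α)
      G′ α = G (suc b ∷ α)
      A = strictSum b (λ α → up Y α * G α)
      over = strictSum b (λ α → Y′ α * G (suc (suc b) ∷ α))
      split : strictSum b (λ α → Y′ α * (G (suc (suc b) ∷ α) + addBox G′ α)) ≈ over +ˢ strictSum b
          (λ α → Y′ α * addBox G′ α)
      split n = trans (∑-cong (strictPartsB b n) (λ _ → distribˡ _ _ _)) (strictSum-+ b _ _ n)
      shift-shift′ : shift (suc b) (shift 1 over) ≈ overflow (suc b) Y G
      shift-shift′ n = trans (shift-shift (suc b) 1 over n) (cong (λ r → shift r over n) (ℕ.+-comm (suc b) 1))
      -- Behind a first part b + 1, an overflow to b + 1 would repeat that part.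
      no-overflow : ∀ k → overflow b Y′ G′ k ≡ 0#
      no-overflow = shift-zero (suc b) (strictSum-vanish (ℕ.pred b)
          (λ α → trans (cong (Y′ (top b α) *_) (Alternating-repeat {G} alt (suc b) α)) (zeroʳ _)))
      collect : strictSum b (λ α → up Y (suc b ∷ α) * G′ α) ≈ strictSum (ℕ.pred b)
          (λ μ → Y (top b μ) * G (suc b ∷ μ)) +ˢ strictSum b (λ α → up Y′ α * G′ α)
      collect n = trans (strictSum-cong b (λ s → trans (cong (_* G′ _) (up-∷ Y s)) (distribʳ _ _ _)) n)
        (trans (strictSum-+ b _ _ n) (cong (_+ strictSum b (λ α → up Y′ α * G′ α) n) (top-part b Y G n)))

  -- With parts bounded by k + 1 the overflow starts in degree k + 2 and is invisible in degree k +
  -- 1.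
  addBox-up : ∀ k Y G → Alternating G → ∑ (λ α → Y α * addBox G α) (SP k) ≡ ∑ (λ α → up Y α * G α) (SP (suc k))
  addBox-up k Y G alt = begin
    ∑ (λ α → Y α * addBox G α) (SP k)
      ≡⟨ cong (∑ (λ α → Y α * addBox G α)) (strictPartsB≡SP (ℕ.n≤1+n k)) ⟨
    strictSum (suc k) (λ α → Y α * addBox G α) k
      ≡⟨ addBox-series (suc k) Y G alt (suc k) ⟩
    ∑ (λ α → up Y α * G α) (SP (suc k)) + overflow (suc k) Y G (suc k)
      ≡⟨ cong (∑ (λ α → up Y α * G α) (SP (suc k)) +_) (shift-< (suc (suc k)) _ (ℕ.n<1+n (suc k))) ⟩
    ∑ (λ α → up Y α * G α) (SP (suc k)) + 0#
      ≡⟨ +-identityʳ _ ⟩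
    ∑ (λ α → up Y α * G α) (SP (suc k)) ∎

  -- Euler's theorem, from (1 + Xⁱ)(1 - Xⁱ) = 1 - X²ⁱ.
  euler : ∀ n → ∑ (λ _ → 1#) (SP n) ≡ ∑ (λ _ → 1#) (OP n)
  euler n = trans (cong (∑ (λ _ → 1#)) (sym (strictPartsB≡SP (n≤double n)))) (trans
    (*-cancelʳ-≤ (e (double n)) (e-constant (double n)) n agree n ℕ.≤-refl)
    (cong (∑ (λ _ → 1#)) (oddPartsB≡OP (n≤double n))))
    where
    double : ℕ → ℕ
    double zero = zero
    double (suc m) = suc (suc (double m))
    n≤double : ∀ m → m ≤ double m
    n≤double zero = z≤n
    n≤double (suc m) = s≤s (ℕ.m≤n⇒m≤1+n (n≤double m))
    double≡ : ∀ m → m ℕ.+ m ≡ double m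
    double≡ zero = refl
    double≡ (suc m) = cong suc (trans (ℕ.+-suc m m) (cong suc (double≡ m)))
    double-odd : ∀ m → isOdd (suc (double m)) ≡ true
    double-odd zero = refl
    double-odd (suc m) = double-odd m
    double-even : ∀ m → isOdd (double m) ≡ false
    double-even zero = refl
    double-even (suc m) = double-even m
    -- `e b` is the product of 1 - X^i for i ≤ b, and `E b` that of 1 - X^(2i). The bound 2n on the
    -- parts is even, so that the even factors of `e (double n)` are exactly `E n`; `E (double n)`
    -- agrees with it up to degree n.
    s o e E : ℕ → Series
    s b = strictSum b (λ _ → 1#)
    o b = oddSum b (λ _ → 1#)
    e zero = S.1#
    e (suc b) = e b *ˢ (S.1# S.- monomial (suc b))
    E zero = S.1#
    E (suc m) = E m *ˢ (S.1# S.- monomial (double (suc m)))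
    e-constant : ∀ b → e b 0 ≡ 1#
    e-constant zero = refl
    e-constant (suc b) = trans (cong (_* (1# + - 0#)) (e-constant b)) (solve 0 (:1 :* (:1 :+ :- :0) := :1) refl)
    square : ∀ b → monomial b *ˢ monomial b ≈ monomial (double b)
    square b = S.trans (monomial-* b (monomial b))
        (S.trans (shift-shift b b (const 1#)) (λ n → cong (λ r → monomial r n) (double≡ b)))
    s-product : ∀ b → s b *ˢ e b ≈ E b
    s-product zero = S.trans (S.*-congʳ (strictSum-zero (λ _ → 1#))) (S.*-identityˡ _)
    s-product (suc b) = S.trans (S.*-congʳ (S.trans (strictSum-suc b (λ _ → 1#))
        (S.+-congˡ (S.sym (monomial-* (suc b) (s b))))))
      (S.trans (S.solve 3 (λ s e m → (s :+ m :* s) :* (e :* (:1 :- m)) := (s :* e) :* (:1 :- m :* m)) S.refl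
          (s b) (e b) (monomial (suc b)))
      (S.*-cong (s-product b) (S.+-congˡ (S.-‿cong (square (suc b))))))
    o-product : ∀ m → o (double m) *ˢ e (double m) ≈ E m
    o-product zero = S.trans (S.*-congʳ (λ { zero → +-identityʳ 1# ; (suc n) → refl })) (S.*-identityˡ _)
    o-product (suc m) = S.trans (S.*-congʳ (oddSum-even (suc (double m)) (λ _ → 1#) (double-even m)))
      (S.trans (S.solve 4 (λ a e m k → a :* (e :* (:1 :- m) :* k) := ((a :- m :* a) :* e) :* k) S.refl
          (o (suc (double m))) (e (double m)) (monomial (suc (double m))) (S.1# S.- monomial (double (suc m))))
      (S.*-congʳ (S.trans (S.*-congʳ difference) (o-product m))))
      where
      O = o (suc (double m))
      difference : O S.- monomial (suc (double m)) *ˢ O ≈ o (double m)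
      difference = S.trans (S.+-cong (oddSum-odd (double m) (λ _ → 1#) (double-odd m))
          (S.-‿cong (monomial-* (suc (double m)) O)))
        (S.solve 2 (λ a b → (a :+ b) :- b := a) S.refl (o (double m)) (shift (suc (double m)) O))
    E-stable : ∀ j → E (j ℕ.+ n) ≈[ n ] E n
    E-stable zero k l = refl
    E-stable (suc j) k l = begin
      (E (j ℕ.+ n) *ˢ (S.1# S.- monomial r)) k
        ≡⟨ S.solve 2 (λ e m → e :* (:1 :- m) := e :- m :* e) S.refl (E (j ℕ.+ n)) (monomial r) k ⟩
      E (j ℕ.+ n) k - (monomial r *ˢ E (j ℕ.+ n)) k
        ≡⟨ cong₂ _-_ (E-stable j k l) (trans (monomial-* r (E (j ℕ.+ n)) k)
             (shift-< r (E (j ℕ.+ n)) (ℕ.≤-<-trans l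
             (ℕ.≤-<-trans (ℕ.m≤n+m n j) (ℕ.<-≤-trans (ℕ.n<1+n (j ℕ.+ n)) (n≤double (suc (j ℕ.+ n)))))))) ⟩
      E n k - 0#
        ≡⟨ solve 1 (λ a → a :- :0 := a) refl (E n k) ⟩
      E n k ∎
      where r = double (suc (j ℕ.+ n))
    agree : s (double n) *ˢ e (double n) ≈[ n ] o (double n) *ˢ e (double n)
    agree k l = trans (s-product (double n) k)
        (trans (cong (λ m → E m k) (sym (double≡ n))) (trans (E-stable n k l) (sym (o-product n k))))

  falling : Carrier → ℕ → Carrier
  falling x zero = 1#
  falling x (suc k) = falling x k * (x - fromℕ k)

  Pˢ : List ℕ → List ℕ → Carrier
  Pˢ α ns = R falling α (map fromℕ ns)

  private
    falling-zero : ∀ {m a} → m < a → falling (fromℕ m) a ≡ 0#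
    falling-zero {m} {suc a} (s≤s l) with m ≟ a
    ... | yes refl = trans (cong (falling (fromℕ m) m *_) (-‿inverseʳ _)) (zeroʳ _)
    ... | no m≢a = trans (cong (_* (fromℕ m - fromℕ a)) (falling-zero (ℕ.≤∧≢⇒< l m≢a))) (zeroˡ _)

    ∑ᵖ-map : ∀ {A B : Set} (f : B → List B → Carrier) (h : A → B) xs → ∑ᵖ f (map h xs) ≡ ∑ᵖ
        (λ y ys → f (h y) (map h ys)) xs
    ∑ᵖ-map f h [] = refl
    ∑ᵖ-map f h (x ∷ xs) = cong (f (h x) (map h xs) +_) (∑ᵖ-map (λ y ys → f y (h x ∷ ys)) h xs)

    Pick-size : ∀ {m ms ns} → Pick m ms ns → size ns ≡ m ℕ.+ size ms
    Pick-size here = refl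
    Pick-size (there {x} {m} {ms} π) = trans (cong (x ℕ.+_) (Pick-size π))
        (trans (sym (ℕ.+-assoc x m _)) (trans (cong (ℕ._+ size ms) (ℕ.+-comm x m)) (ℕ.+-assoc m x _)))

    -- The falling power of a variable m vanishes for a > m, so every part must fit into the
    -- variable that it picks.
    Pˢ-head : ∀ a α ns → (∀ {m ms} → Pick m ms ns → a ≤ m → Pˢ α ms ≡ 0#) → Pˢ (a ∷ α) ns ≡ 0#
    Pˢ-head a α ns h = trans (∑ᵖ-map _ fromℕ ns) (∑ᵖ-zero ns (λ {m} {ms} π → term π (a ≤? m)))
      where
      term : ∀ {m ms} → Pick m ms ns → Dec (a ≤ m) → falling (fromℕ m) a * weight (fromℕ m) (map fromℕ ms) * Pˢ
          α ms ≡ 0#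
      term π (yes l) = trans (cong (_ *_) (h π l)) (zeroʳ _)
      term {m} {ms} π (no l) = trans (cong (λ k → k * weight (fromℕ m) (map fromℕ ms) * Pˢ α ms)
          (falling-zero (ℕ.≰⇒> l)))
        (solve 2 (λ a b → :0 :* a :* b := :0) refl _ _)

  Pˢ-size : ∀ α ns → size ns < size α → Pˢ α ns ≡ 0#
  Pˢ-size (a ∷ α) ns l = Pˢ-head a α ns (λ {m} {ms} π a≤m → Pˢ-size α ms (ℕ.+-cancelˡ-< a (size ms) (size α)
    (ℕ.≤-<-trans (ℕ.+-monoˡ-≤ (size ms) a≤m) (subst (ℕ._< a ℕ.+ size α) (Pick-size π) l))))

  -- With equal sizes every part must fill its variable completely. As no variable is 0, none is
  -- left over, and α would be a rearrangement of the variables.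
  Pˢ-vanish : ∀ α ns → size ns ≡ size α → All (0 ℕ.<_) ns → ¬ (α ↭ ns) → Pˢ α ns ≡ 0#
  Pˢ-vanish [] [] e p n = contradiction ↭-refl n
  Pˢ-vanish [] (suc _ ∷ ns) () p n
  Pˢ-vanish [] (zero ∷ ns) e (() ∷ _) n
  Pˢ-vanish (a ∷ α) ns e p n = Pˢ-head a α ns (λ {m} {ms} π a≤m → picked π a≤m (a ≟ m))
    where
    picked : ∀ {m ms} → Pick m ms ns → a ≤ m → Dec (a ≡ m) → Pˢ α ms ≡ 0#
    picked {m} {ms} π a≤m (yes refl) = Pˢ-vanish α ms
        (ℕ.+-cancelˡ-≡ a (size ms) (size α) (trans (sym (Pick-size π)) e)) (proj₂ (Pick-All π p))
      (λ q → n (↭-trans (prep a q) (Pick-↭ π)))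
    picked {m} {ms} π a≤m (no a≢m) = Pˢ-size α ms (ℕ.+-cancelˡ-< a (size ms) (size α)
      (subst (a ℕ.+ size ms ℕ.<_) (trans (sym (Pick-size π)) e) (ℕ.+-monoˡ-< (size ms) (ℕ.≤∧≢⇒< a≤m a≢m))))

-- Adjoining parts equal to 1.

insertOnes : ℕ → List ℕ → List ℕ
insertOnes zero ρ = ρ
insertOnes (suc m) ρ = insertPart 1 (insertOnes m ρ)

OddParts-insertOnes : ∀ m {b ρ} → 0 < b → OddParts b ρ → OddParts b (insertOnes m ρ)
OddParts-insertOnes zero l p = p
OddParts-insertOnes (suc m) l p = OddParts-insertPart refl l (OddParts-insertOnes m l p)

size-insertOnes : ∀ m ρ → size (insertOnes m ρ) ≡ m ℕ.+ size ρ
size-insertOnes zero ρ = refl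
size-insertOnes (suc m) ρ = trans (size-insertPart 1 (insertOnes m ρ)) (cong suc (size-insertOnes m ρ))

length-insertOnes : ∀ m ρ → length (insertOnes m ρ) ≡ m ℕ.+ length ρ
length-insertOnes zero ρ = refl
length-insertOnes (suc m) ρ = trans (length-insertPart 1 (insertOnes m ρ)) (cong suc (length-insertOnes m ρ))

insertOnes-∈OP : ∀ m {b ρ} → OddParts b ρ → insertOnes m ρ ∈ OP (m ℕ.+ size ρ)
insertOnes-∈OP m {b} {ρ} p = subst (λ n → insertOnes m ρ ∈ OP n) (size-insertOnes m ρ)
  (∈-OP (OddParts-insertOnes m {suc b} (s≤s z≤n) (OddParts-≤ (ℕ.n≤1+n b) p)))

mult-one : ∀ {ρ} → All (λ r → r ≢ 1) ρ → mult 1 ρ ≡ 0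
mult-one [] = refl
mult-one (_∷_ {a} {ρ} p ps) = trans (mult-there {1} {a} ρ (λ e → p (sym e))) (mult-one ps)

mult-insertOnes : ∀ m {ρ} → mult 1 ρ ≡ 0 → mult 1 (insertOnes m ρ) ≡ m
mult-insertOnes zero e = e
mult-insertOnes (suc m) {ρ} e = trans (mult-insertPart 1 1 (insertOnes m ρ)) (cong suc (mult-insertOnes m e))

-- Without a part 1 in ρ, the factor of z at 1 is exactly m!; otherwise it would mix the two
-- multiplicities.
z-insertOnes : ∀ m {ρ} → mult 1 ρ ≡ 0 → Defs.z (insertOnes m ρ) ≡ m ! ℕ.* Defs.z ρ
z-insertOnes zero e = sym (ℕ.*-identityˡ _)
z-insertOnes (suc m) {ρ} e = trans (z-insertPart 0 (insertOnes m ρ)) (trans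
  (cong₂ ℕ._*_ (trans (ℕ.*-identityˡ _) (cong suc (mult-insertOnes m e))) (z-insertOnes m e))
      (sym (ℕ.*-assoc (suc m) (m !) (Defs.z ρ))))

insertPart-1 : ∀ {b ρ} → OddParts b ρ → insertPart 1 ρ ≡ ρ ++ 1 ∷ []
insertPart-1 [] = refl
insertPart-1 (cons {zero} _ _ p) = cong (1 ∷_) (trans (sym (insertPart-≥ ℕ.≤-refl p)) (insertPart-1 p))
insertPart-1 (cons {suc a} _ _ p) = cong (suc (suc a) ∷_) (insertPart-1 p)

insertOnes-injective : ∀ m {b c ρ σ} → OddParts b ρ → OddParts c σ → insertOnes m ρ ≡ insertOnes m σ → ρ ≡ σ
insertOnes-injective zero p q e = e
insertOnes-injective (suc m) {b} {c} {ρ} {σ} p q e = insertOnes-injective m p q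
    (List.∷ʳ-injectiveˡ (insertOnes m ρ) (insertOnes m σ)
  (trans (sym (insertPart-1 (odd p))) (trans e (insertPart-1 (odd q)))))
  where
  odd : ∀ {b ρ} → OddParts b ρ → OddParts (suc b) (insertOnes m ρ)
  odd p = OddParts-insertOnes m (s≤s z≤n) (OddParts-≤ (ℕ.n≤1+n _) p)

fallℕ-< : ∀ {n k} → n < k → fallℕ n k ≡ 0
fallℕ-< {n} {suc k} (s≤s l) = trans (cong (fallℕ n k ℕ.*_) (ℕ.m≤n⇒m∸n≡0 l)) (ℕ.*-zeroʳ (fallℕ n k))

fallℕ-! : ∀ m k → fallℕ (m ℕ.+ k) k ℕ.* m ! ≡ (m ℕ.+ k) !
fallℕ-! m zero = trans (ℕ.*-identityˡ _) (cong _! (sym (ℕ.+-identityʳ m)))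
fallℕ-! m (suc k) = trans (cong (λ d → fallℕ (m ℕ.+ suc k) k ℕ.* d ℕ.* m !) difference)
  (trans (ℕ.*-assoc (fallℕ (m ℕ.+ suc k) k) (suc m) (m !))
      (subst (λ n → fallℕ n k ℕ.* (suc m) ! ≡ n !) (sym (ℕ.+-suc m k)) (fallℕ-! (suc m) k)))
  where
  difference : m ℕ.+ suc k ∸ k ≡ suc m
  difference = trans (cong (_∸ k) (ℕ.+-suc m k)) (ℕ.m+n∸n≡m (suc m) k)

length≤size : ∀ {α} → All (0 ℕ.<_) α → length α ≤ size α
length≤size [] = z≤n
length≤size (p ∷ ps) = ℕ.+-mono-≤ p (length≤size ps)

OddParts-positive : ∀ {b ρ} → OddParts b ρ → All (0 ℕ.<_) ρ
OddParts-positive [] = []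
OddParts-positive (cons _ _ p) = s≤s z≤n ∷ OddParts-positive p

-- An orthogonal system of full size is complete.

module FiniteSums (F : OrderedField) where
  open FieldTheory F
  open ≡.≡-Reasoning

  kronecker : List ℕ → List ℕ → Carrier
  kronecker ρ σ with List.≡-dec ℕ._≟_ ρ σ
  ... | yes _ = 1#
  ... | no _ = 0#

  kronecker-refl : ∀ ρ → kronecker ρ ρ ≡ 1#
  kronecker-refl ρ with List.≡-dec ℕ._≟_ ρ ρ
  ... | yes _ = refl
  ... | no n = contradiction refl n

  kronecker-≢ : ∀ {ρ σ} → ρ ≢ σ → kronecker ρ σ ≡ 0#
  kronecker-≢ {ρ} {σ} n with List.≡-dec ℕ._≟_ ρ σ
  ... | yes e = contradiction e n
  ... | no _ = refl

  ∑-single : ∀ (f : List ℕ → Carrier) {σ} L → Unique L → σ ∈ L → (∀ {ρ} → ρ ∈ L → ρ ≢ σ → f ρ ≡ 0#) → ∑ f L ≡ f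
      σ
  ∑-single f (σ ∷ L) (n ∷ u) (here refl) v = trans
      (cong (f σ +_) (∑-zero L (λ m → v (there m) (λ { refl → All.lookup n m refl })))) (+-identityʳ _)
  ∑-single f (ρ ∷ L) (n ∷ u) (there m) v = trans
      (cong₂ _+_ (v (here refl) (All.lookup n m)) (∑-single f L u m (λ m′ → v (there m′)))) (+-identityˡ _)

  ∑-kronecker : ∀ (f : List ℕ → Carrier) {σ} L → Unique L → σ ∈ L → ∑ (λ ρ → kronecker ρ σ * f ρ) L ≡ f σ
  ∑-kronecker f {σ} L u m = trans (∑-single _ L u m
      (λ {ρ} _ n → trans (cong (_* f ρ) (kronecker-≢ n)) (zeroˡ _)))
    (trans (cong (_* f σ) (kronecker-refl σ)) (*-identityˡ _))

  ∑-nonNeg : ∀ {A : Set} (f : A → Carrier) xs → (∀ {x} → x ∈ xs → NonNeg (f x)) → NonNeg (∑ f xs)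
  ∑-nonNeg f [] p = nonNeg-0
  ∑-nonNeg f (x ∷ xs) p = nonNeg-+ (p (here refl)) (∑-nonNeg f xs (λ m → p (there m)))

  ∑-nonNeg-zero : ∀ {A : Set} (f : A → Carrier) xs → (∀ {x} → x ∈ xs → NonNeg (f x)) → ∑ f xs ≡ 0# → ∀ {x} → x ∈
      xs → f x ≡ 0#
  ∑-nonNeg-zero f (x ∷ xs) p e (here refl) = nonNeg-sum-zero (p (here refl)) (∑-nonNeg f xs (λ m → p (there m)))
      e
  ∑-nonNeg-zero f (x ∷ xs) p e (there m) = ∑-nonNeg-zero f xs (λ m → p (there m))
    (nonNeg-sum-zero (∑-nonNeg f xs (λ m → p (there m))) (p (here refl)) (trans (+-comm _ _) e)) m

  nonNeg-inverse : ∀ {x} → x ≢ 0# → NonNeg x → NonNeg (x ⁻¹)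
  nonNeg-inverse {x} p n = subst NonNeg (trans (sym (*-assoc _ _ _))
      (trans (cong (_* x ⁻¹) (inverseʳ p)) (*-identityˡ _))) (nonNeg-* n (nonNeg-square (x ⁻¹)))

  -- In matrix terms, with diagonal matrices W and C, the hypothesis is XᵀWX = C⁻¹ and the
  -- conclusion is XCXᵀ = W⁻¹. For a square X a one-sided inverse is thus shown to be two-sided, and
  -- positivity takes the place of determinants.
  module Completeness
    (L M : List (List ℕ)) (unique-L : Unique L) (unique-M : Unique M)
    (same-size : ∑ (λ _ → 1#) L ≡ ∑ (λ _ → 1#) M)
    (X : List ℕ → List ℕ → Carrier) (w c : List ℕ → Carrier) (w≢0 : ∀ α → w α ≢ 0#)
        (w-nonNeg : ∀ α → NonNeg (w α))
    (orthogonal : ∀ {ρ σ} → ρ ∈ M → σ ∈ M → c σ * ∑ (λ α → w α * (X α ρ * X α σ)) L ≡ kronecker σ ρ) where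

    gram : List ℕ → List ℕ → Carrier
    gram α β = ∑ (λ τ → c τ * (X α τ * X β τ)) M

    private
      w⁻¹ : List ℕ → Carrier
      w⁻¹ α = w α ⁻¹

      gram-apply : ∀ α (Y : List ℕ → Carrier) → ∑ (λ β → w β * (Y β * gram α β)) L ≡ ∑
          (λ τ → X α τ * (c τ * ∑ (λ β → w β * (Y β * X β τ)) L)) M
      gram-apply α Y = begin
        ∑ (λ β → w β * (Y β * gram α β)) L
          ≡⟨ ∑-cong L (λ {β} _ → trans (sym (*-assoc _ _ _)) (sym (∑-*ˡ (w β * Y β) _ M))) ⟩
        ∑ (λ β → ∑ (λ τ → w β * Y β * (c τ * (X α τ * X β τ))) M) L
          ≡⟨ ∑-swap _ L M ⟩
        ∑ (λ τ → ∑ (λ β → w β * Y β * (c τ * (X α τ * X β τ))) L) M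
          ≡⟨ ∑-cong M (λ {τ} _ → trans (∑-cong L
               (λ {β} _ → solve 5 (λ w y c x z → w :* y :* (c :* (x :* z)) := (x :* c) :* (w :* (y :* z))) refl
               (w β) (Y β) (c τ) (X α τ) (X β τ)))
               (trans (∑-*ˡ (X α τ * c τ) _ L) (*-assoc _ _ _))) ⟩
        ∑ (λ τ → X α τ * (c τ * ∑ (λ β → w β * (Y β * X β τ)) L)) M ∎

      -- A diagonal entry of GWG = G for G = XCXᵀ, which follows from the orthogonality of the
      -- columns.
      gram-square : ∀ α → ∑ (λ β → w β * (gram α β * gram α β)) L ≡ gram α α
      gram-square α = trans (gram-apply α (gram α)) (∑-cong M (λ {τ} m → begin
        X α τ * (c τ * ∑ (λ β → w β * (gram α β * X β τ)) L)
          ≡⟨ cong (λ s → X α τ * (c τ * s)) (trans (∑-cong L (λ {β} _ → cong (w β *_) (*-comm _ _)))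
               (gram-apply α (λ β → X β τ))) ⟩
        X α τ * (c τ * ∑ (λ υ → X α υ * (c υ * ∑ (λ β → w β * (X β τ * X β υ)) L)) M)
          ≡⟨ cong (λ s → X α τ * (c τ * s)) (trans
               (∑-cong M (λ {υ} m′ → trans (cong (X α υ *_) (orthogonal m m′)) (*-comm _ _)))
               (∑-kronecker (X α) M unique-M m)) ⟩
        X α τ * (c τ * X α τ)
          ≡⟨ solve 2 (λ x c → x :* (c :* x) := c :* (x :* x)) refl (X α τ) (c τ) ⟩
        c τ * (X α τ * X α τ) ∎))

      defect : List ℕ → List ℕ → Carrier
      defect α β = gram α β - kronecker β α * w⁻¹ α

      total : List ℕ → Carrier
      total α = ∑ (λ β → w β * (defect α β * defect α β)) L

      -- On expanding the square, `gram-square` turns the quadratic term into G_αα, and the mixed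
      -- term is -2 G_αα.
      total-value : ∀ {α} → α ∈ L → total α ≡ w⁻¹ α - gram α α
      total-value {α} m = begin
        ∑ (λ β → w β * (defect α β * defect α β)) L
          ≡⟨ ∑-cong L (λ {β} _ → solve 4 (λ w g k i → w :* ((g :- k :* i) :* (g :- k :* i)) := w :* (g :* g) :+
               k :* (w :* (k :* i :* i :- :2 :* g :* i))) refl (w β) (gram α β) (kronecker β α) (w⁻¹ α)) ⟩
        ∑ (λ β → w β * (gram α β * gram α β) + kronecker β α *
            (w β * (kronecker β α * w⁻¹ α * w⁻¹ α - 2# * gram α β * w⁻¹ α))) L
          ≡⟨ trans (∑-+ _ _ L) (cong₂ _+_ (gram-square α) (∑-kronecker _ L unique-L m)) ⟩
        gram α α + w α * (kronecker α α * w⁻¹ α * w⁻¹ α - 2# * gram α α * w⁻¹ α)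
          ≡⟨ cong (λ k → gram α α + w α * (k * w⁻¹ α * w⁻¹ α - 2# * gram α α * w⁻¹ α)) (kronecker-refl α) ⟩
        gram α α + w α * (1# * w⁻¹ α * w⁻¹ α - 2# * gram α α * w⁻¹ α)
          ≡⟨ solve 3 (λ g w i → g :+ w :* (:1 :* i :* i :- :2 :* g :* i) := g :+ (w :* i) :* (i :- :2 :* g))
               refl (gram α α) (w α) (w⁻¹ α) ⟩
        gram α α + (w α * w⁻¹ α) * (w⁻¹ α - 2# * gram α α)
          ≡⟨ cong (λ k → gram α α + k * (w⁻¹ α - 2# * gram α α)) (inverseʳ (w≢0 α)) ⟩
        gram α α + 1# * (w⁻¹ α - 2# * gram α α)
          ≡⟨ solve 2 (λ g i → g :+ :1 :* (i :- :2 :* g) := i :- g) refl (gram α α) (w⁻¹ α) ⟩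
        w⁻¹ α - gram α α ∎

      total-nonNeg : ∀ α → NonNeg (total α)
      total-nonNeg α = ∑-nonNeg _ L (λ {β} _ → nonNeg-* (w-nonNeg β) (nonNeg-square (defect α β)))

      trace : ∑ (λ α → w α * gram α α) L ≡ ∑ (λ _ → 1#) M
      trace = begin
        ∑ (λ α → w α * gram α α) L
          ≡⟨ ∑-cong L (λ {α} _ → sym (∑-*ˡ (w α) _ M)) ⟩
        ∑ (λ α → ∑ (λ τ → w α * (c τ * (X α τ * X α τ))) M) L
          ≡⟨ ∑-swap _ L M ⟩
        ∑ (λ τ → ∑ (λ α → w α * (c τ * (X α τ * X α τ))) L) M
          ≡⟨ ∑-cong M (λ {τ} m → trans (∑-cong L
               (λ {α} _ → solve 3 (λ w c x → w :* (c :* x) := c :* (w :* x)) refl (w α) (c τ) (X α τ * X α τ)))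
               (trans (∑-*ˡ (c τ) _ L) (trans (orthogonal m m) (kronecker-refl τ)))) ⟩
        ∑ (λ _ → 1#) M ∎

      totals-zero : ∑ (λ α → w α * total α) L ≡ 0#
      totals-zero = begin
        ∑ (λ α → w α * total α) L
          ≡⟨ ∑-cong L (λ {α} m → trans (cong (w α *_) (total-value m))
               (trans (solve 3 (λ w i g → w :* (i :- g) := w :* i :+ :- :1 :* (w :* g)) refl (w α) (w⁻¹ α)
               (gram α α)) (cong (_+ - 1# * (w α * gram α α)) (inverseʳ (w≢0 α))))) ⟩
        ∑ (λ α → 1# + - 1# * (w α * gram α α)) L
          ≡⟨ trans (∑-+ _ _ L) (cong₂ _+_ same-size (trans (∑-*ˡ (- 1#) _ L) (cong (- 1# *_) trace))) ⟩
        ∑ (λ _ → 1#) M + - 1# * ∑ (λ _ → 1#) M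
          ≡⟨ solve 1 (λ a → a :+ :- :1 :* a := :0) refl _ ⟩
        0# ∎

    -- L and M have the same size, so the Gram defects, which are sums of squares with total |L| - |M|, all vanish.
    complete : ∀ {α β} → α ∈ L → β ∈ L → gram α β ≡ kronecker β α * w α ⁻¹
    complete {α} {β} m m′ = x-y≡0⇒x≡y (square-zero
        (*-zero-cancelˡ (w≢0 β) (∑-nonNeg-zero _ L
        (λ {β} _ → nonNeg-* (w-nonNeg β) (nonNeg-square (defect α β)))
      (*-zero-cancelˡ (w≢0 α) (∑-nonNeg-zero _ L (λ {α} _ → nonNeg-* (w-nonNeg α) (total-nonNeg α)) totals-zero
          m)) m′)))

    -- By `complete`, Y is the combination of the columns of X whose coefficients are its weighted
    -- pairings with them, and by hypothesis only the column ρ has a nonzero coefficient.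
    determined : ∀ {ρ} → ρ ∈ M → (Y : List ℕ → Carrier) →
        (∀ {τ} → τ ∈ M → c τ * ∑ (λ β → w β * (Y β * X β τ)) L ≡ kronecker τ ρ) →
      ∀ {α} → α ∈ L → Y α ≡ X α ρ
    determined {ρ} m Y h {α} mα = begin
      Y α
        ≡⟨ *-identityʳ _ ⟨
      Y α * 1#
        ≡⟨ cong (Y α *_) (inverseʳ (w≢0 α)) ⟨
      Y α * (w α * w⁻¹ α)
        ≡⟨ ∑-kronecker (λ β → Y β * (w β * w⁻¹ α)) L unique-L mα ⟨
      ∑ (λ β → kronecker β α * (Y β * (w β * w⁻¹ α))) L
        ≡⟨ ∑-cong L (λ {β} mβ → trans (solve 4 (λ k y w i → k :* (y :* (w :* i)) := w :* (y :* (k :* i))) refl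
             (kronecker β α) (Y β) (w β) (w⁻¹ α)) (cong (λ s → w β * (Y β * s)) (sym (complete mα mβ)))) ⟩
      ∑ (λ β → w β * (Y β * gram α β)) L
        ≡⟨ gram-apply α Y ⟩
      ∑ (λ τ → X α τ * (c τ * ∑ (λ β → w β * (Y β * X β τ)) L)) M
        ≡⟨ ∑-cong M (λ {τ} mτ → trans (cong (X α τ *_) (h mτ)) (*-comm _ _)) ⟩
      ∑ (λ τ → kronecker τ ρ * X α τ) M
        ≡⟨ ∑-kronecker (X α) M unique-M m ⟩
      X α ρ ∎

-- Characters, their orthogonality, and the expectation.

module Orthogonality (F : OrderedField) where
  open FieldTheory F
  open Symmetrised F
  open PowerSeries F
  open Kernel F
  open StrictSums F
  open OddSums F
  open LinearIndependence F
  open Boxes F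
  open FiniteSums F
  open ≡.≡-Reasoning

  upⁿ : ℕ → (List ℕ → Carrier) → List ℕ → Carrier
  upⁿ zero Y = Y
  upⁿ (suc m) Y = up (upⁿ m Y)

  module _ (X : List ℕ → List ℕ → Carrier)
           (character : ∀ k {α} → α ∈ SP k → ∀ {ns} → Points ns → length ns ≡ k →
             2# ^ length α * P α (map fromℕ ns) ≡ ∑ (λ ρ → zWeight ρ * X α ρ * powerProduct ns ρ) (OP k)) where

    -- The number of variables is free here, in contrast to `character`, where it equals the degree.
    Expands : ℕ → (List ℕ → Carrier) → List ℕ → Set
    Expands n Y ρ = ∀ {ns} → Points ns → ∑ (λ α → Y α * P α (map fromℕ ns)) (SP n) ≡ powerProduct ns ρ

    -- Expand one side of the Cauchy identity in power sums and compare coefficients.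
    power-expansion : ∀ k {τ} → τ ∈ OP k → Expands k (λ α → X α τ) τ
    power-expansion k {τ} m {ns} p = x-y≡0⇒x≡y
        (*-zero-cancelˡ (zWeight≢0 τ) (powerProducts-independent k k ℕ.≤-refl _ relation m))
      where
      xs = map fromℕ ns
      -- The k variables `ms` are those to which `character` applies. The variables `ns` stay fixed,
      -- and their power sums are mere coefficients of the relation.
      relation : ∀ ms → Points ms → length ms ≡ k →
        ∑ (λ ρ → zWeight ρ * (∑ (λ α → X α ρ * P α xs) (SP k) - powerProduct ns ρ) * powerProduct ms ρ) (OP k) ≡
            0#
      relation ms p′ e = begin
        ∑ (λ ρ → zWeight ρ * (∑ (λ α → X α ρ * P α xs) (SP k) - powerProduct ns ρ) * powerProduct ms ρ) (OP k)
          ≡⟨ ∑-cong (OP k) (λ {ρ} _ → solve 4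
               (λ z s n m → z :* (s :- n) :* m := z :* m :* s :+ :- :1 :* (z :* (n :* m))) refl (zWeight ρ) _
               (powerProduct ns ρ) (powerProduct ms ρ)) ⟩
        ∑ (λ ρ → zWeight ρ * powerProduct ms ρ * ∑ (λ α → X α ρ * P α xs) (SP k) + - 1# *
            (zWeight ρ * (powerProduct ns ρ * powerProduct ms ρ))) (OP k)
          ≡⟨ trans (∑-+ _ _ (OP k)) (cong₂ _+_ cauchy-side
               (trans (∑-*ˡ (- 1#) _ (OP k)) (cong (- 1# *_) zSum-side))) ⟩
        kernel (map fromℕ ms) xs k + - 1# * kernel (map fromℕ ms) xs k
          ≡⟨ solve 1 (λ a → a :+ :- :1 :* a := :0) refl _ ⟩
        0# ∎
        where
        zSum-side : ∑ (λ ρ → zWeight ρ * (powerProduct ns ρ * powerProduct ms ρ)) (OP k) ≡ kernel (map fromℕ ms)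
            xs k
        zSum-side = trans (∑-cong (OP k) (λ {ρ} _ → cong (zWeight ρ *_) (sym (∏-* _ _ ρ))))
            (sym (kernel-zSum k (map fromℕ ms) xs k ℕ.≤-refl))
        cauchy-side : ∑ (λ ρ → zWeight ρ * powerProduct ms ρ * ∑ (λ α → X α ρ * P α xs) (SP k)) (OP k) ≡ kernel
            (map fromℕ ms) xs k
        cauchy-side = begin
          ∑ (λ ρ → zWeight ρ * powerProduct ms ρ * ∑ (λ α → X α ρ * P α xs) (SP k)) (OP k)
            ≡⟨ ∑-cong (OP k) (λ {ρ} _ → sym (∑-*ˡ _ _ (SP k))) ⟩
          ∑ (λ ρ → ∑ (λ α → zWeight ρ * powerProduct ms ρ * (X α ρ * P α xs)) (SP k)) (OP k)
            ≡⟨ ∑-swap _ (OP k) (SP k) ⟩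
          ∑ (λ α → ∑ (λ ρ → zWeight ρ * powerProduct ms ρ * (X α ρ * P α xs)) (OP k)) (SP k)
            ≡⟨ ∑-cong (SP k) (λ {α} mα → trans
                 (∑-cong (OP k) (λ {ρ} _ → solve 4 (λ z m x p → z :* m :* (x :* p) := p :* (z :* x :* m)) refl
                     (zWeight ρ) (powerProduct ms ρ) (X α ρ) (P α xs)))
                 (trans (∑-*ˡ (P α xs) _ (OP k)) (trans (cong (P α xs *_) (sym (character k mα p′ e)))
                   (solve 3 (λ a b c → a :* (b :* c) := b :* a :* c) refl (P α xs) (2# ^ length α)
                       (P α (map fromℕ ms)))))) ⟩
          ∑ (λ α → 2# ^ length α * P α xs * P α (map fromℕ ms)) (SP k)
            ≡⟨ cauchy k (map fromℕ ms) xs (points-generic p′) (points-generic p) k ℕ.≤-refl ⟨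
          kernel (map fromℕ ms) xs k ∎

    -- The Pieri rule with σ = 0 is multiplication by p₁, and `addBox-up` moves the box from the
    -- functions to the coefficients.
    Expands-up : ∀ n {Y ρ} → Expands n Y ρ → Expands (suc n) (up Y) (insertPart 1 ρ)
    Expands-up n {Y} {ρ} h {ns} p = begin
      ∑ (λ α → up Y α * P α xs) (SP (suc n))
        ≡⟨ addBox-up n Y (λ α → P α xs) (R-alternating _^_ xs (apart (points-generic p))) ⟨
      ∑ (λ α → Y α * addBox (λ β → P β xs) α) (SP n)
        ≡⟨ ∑-cong (SP n) (λ {α} _ → trans (cong (Y α *_)
             (sym (pieri _^_ (λ _ → 0#) refl (λ _ → refl) power-suc xs (apart (points-generic p)) α)))
             (trans (cong (λ s → Y α * ((∑ id xs - s) * P α xs)) (∑-zero α (λ _ → refl)))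
                 (solve 3 (λ y s p → y :* ((s :- :0) :* p) := s :* (y :* p)) refl (Y α) (∑ id xs) (P α xs)))) ⟩
      ∑ (λ α → ∑ id xs * (Y α * P α xs)) (SP n)
        ≡⟨ trans (∑-*ˡ (∑ id xs) _ (SP n)) (cong₂ _*_ (∑-cong xs (λ {x} _ → sym (*-identityʳ x))) (h p)) ⟩
      powerSum xs 1 * powerProduct ns ρ
        ≡⟨ ∏-insertPart (powerSum xs) 1 ρ ⟨
      powerProduct ns (insertPart 1 ρ) ∎
      where
      xs = map fromℕ ns
      power-suc : ∀ y a → y ^ suc a ≡ y ^ a * (y - 0#)
      power-suc y a = solve 2 (λ y p → y :* p := p :* (y :- :0)) refl y (y ^ a)

    Expands-upⁿ : ∀ m {n Y ρ} → Expands n Y ρ → Expands (m ℕ.+ n) (upⁿ m Y) (insertOnes m ρ)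
    Expands-upⁿ zero h = h
    Expands-upⁿ (suc m) {n} {Y} {ρ} h = Expands-up (m ℕ.+ n) {upⁿ m Y} {insertOnes m ρ} (Expands-upⁿ m h)

    inverseWeight : List ℕ → Carrier
    inverseWeight α = (2# ^ length α) ⁻¹

    pairing : ℕ → (List ℕ → Carrier) → (List ℕ → Carrier) → Carrier
    pairing n Y Z = ∑ (λ α → inverseWeight α * (Y α * Z α)) (SP n)

    -- Substitute the power-sum expansion of each P_α into the expansion of p_ρ and compare the
    -- coefficients of p_τ. The weight 2^(-ℓ) corrects for `character` expanding 2^ℓ P_α. For a
    -- column of X in place of Y this is orthogonality of characters.
    pairing-character : ∀ n {Y ρ τ} → Expands n Y ρ → ρ ∈ OP n → τ ∈ OP n → zWeight τ * pairing n Y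
        (λ α → X α τ) ≡ kronecker τ ρ
    pairing-character n {Y} {ρ} {τ} h mρ mτ = x-y≡0⇒x≡y (powerProducts-independent n n ℕ.≤-refl _ relation mτ)
      where
      relation : ∀ ms → Points ms → length ms ≡ n → ∑
          (λ σ → (zWeight σ * pairing n Y (λ α → X α σ) - kronecker σ ρ) * powerProduct ms σ) (OP n) ≡ 0#
      relation ms p e = begin
        ∑ (λ σ → (zWeight σ * pairing n Y (λ α → X α σ) - kronecker σ ρ) * powerProduct ms σ) (OP n)
          ≡⟨ ∑-cong (OP n) (λ {σ} _ → trans (solve 4
               (λ z s k m → (z :* s :- k) :* m := z :* m :* s :+ :- :1 :* (k :* m)) refl (zWeight σ) _
               (kronecker σ ρ) (powerProduct ms σ))
               (cong (_+ - 1# * (kronecker σ ρ * powerProduct ms σ))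
                   (sym (∑-*ˡ (zWeight σ * powerProduct ms σ) _ (SP n))))) ⟩
        ∑ (λ σ → ∑ (λ α → zWeight σ * powerProduct ms σ * (inverseWeight α * (Y α * X α σ))) (SP n) + - 1# *
            (kronecker σ ρ * powerProduct ms σ)) (OP n)
          ≡⟨ trans (∑-+ _ _ (OP n)) (cong₂ _+_ (∑-swap _ (OP n) (SP n))
               (trans (∑-*ˡ (- 1#) _ (OP n)) (cong (- 1# *_)
               (∑-kronecker (powerProduct ms) (OP n) (oddPartsB-unique n n) mρ)))) ⟩
        ∑ (λ α → ∑ (λ σ → zWeight σ * powerProduct ms σ * (inverseWeight α * (Y α * X α σ))) (OP n)) (SP n) + -
            1# * powerProduct ms ρ
          ≡⟨ cong (_+ - 1# * powerProduct ms ρ) (∑-cong (SP n) (λ {α} mα → evaluate α mα)) ⟩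
        ∑ (λ α → Y α * P α (map fromℕ ms)) (SP n) + - 1# * powerProduct ms ρ
          ≡⟨ cong (_+ - 1# * powerProduct ms ρ) (h p) ⟩
        powerProduct ms ρ + - 1# * powerProduct ms ρ
          ≡⟨ solve 1 (λ a → a :+ :- :1 :* a := :0) refl _ ⟩
        0# ∎
        where
        evaluate : ∀ α → α ∈ SP n → ∑ (λ σ → zWeight σ * powerProduct ms σ * (inverseWeight α * (Y α * X α σ)))
            (OP n) ≡ Y α * P α (map fromℕ ms)
        evaluate α mα = begin
          ∑ (λ σ → zWeight σ * powerProduct ms σ * (i * (Y α * X α σ))) (OP n)
            ≡⟨ ∑-cong (OP n) (λ {σ} _ → solve 5
                 (λ z m i y x → z :* m :* (i :* (y :* x)) := i :* y :* (z :* x :* m)) refl (zWeight σ)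
                 (powerProduct ms σ) i (Y α) (X α σ)) ⟩
          ∑ (λ σ → i * Y α * (zWeight σ * X α σ * powerProduct ms σ)) (OP n)
            ≡⟨ trans (∑-*ˡ (i * Y α) _ (OP n)) (cong (i * Y α *_) (sym (character n mα p e))) ⟩
          i * Y α * (2# ^ length α * Q)
            ≡⟨ solve 4 (λ i y t q → i :* y :* (t :* q) := (t :* i) :* (y :* q)) refl i (Y α) (2# ^ length α) Q ⟩
          (2# ^ length α * i) * (Y α * Q)
            ≡⟨ trans (cong (_* (Y α * Q)) (inverseʳ (^-≢0 (length α) 2≢0))) (*-identityˡ _) ⟩
          Y α * Q ∎
          where
          i = inverseWeight α
          Q = P α (map fromℕ ms)

    private
      inverse-≢0 : ∀ {x} → x ≢ 0# → x ⁻¹ ≢ 0#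
      inverse-≢0 {x} p e = 1≢0 (trans (sym (inverseʳ p)) (trans (cong (x *_) e) (zeroʳ x)))

      nonNeg-power : ∀ n → NonNeg (2# ^ n)
      nonNeg-power zero = nonNeg-1
      nonNeg-power (suc n) = nonNeg-* (nonNeg-+ nonNeg-1 nonNeg-1) (nonNeg-power n)

    -- Identifies the iterates of `up` on the column ρ with the column of ρ ∪ 1^m. In `pairing-up`
    -- one of two such iterates can then be replaced by a character.
    Expands⇒character : ∀ n {Y ρ} → Expands n Y ρ → ρ ∈ OP n → ∀ {α} → α ∈ SP n → Y α ≡ X α ρ
    Expands⇒character n {Y} {ρ} h m = determined m Y (λ mτ → pairing-character n h m mτ)
      where
      open Completeness (SP n) (OP n) (strictPartsB-unique n n) (oddPartsB-unique n n) (euler n) X inverseWeight zWeight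
        (λ α → inverse-≢0 (^-≢0 (length α) 2≢0))
            (λ α → nonNeg-inverse (^-≢0 (length α) 2≢0) (nonNeg-power (length α)))
        (λ {ρ} {σ} mρ mσ → pairing-character n (power-expansion n mρ) mρ mσ)

    pairing-up : ∀ n {Y Z ρ σ} → Expands n Y ρ → Expands n Z σ → ρ ∈ OP n → σ ∈ OP n → zWeight σ * pairing n Y Z
        ≡ kronecker σ ρ
    pairing-up n {Y} {Z} {σ = σ} h h′ m m′ = trans
        (cong (zWeight σ *_) (∑-cong (SP n) (λ {α} mα → cong (λ z → inverseWeight α * (Y α * z))
        (Expands⇒character n h′ m′ mα))))
      (pairing-character n h m m′)

    frakpˢ : ℕ → List ℕ → List ℕ → Carrier
    frakpˢ k ρ ns = ∑ (λ μ → X μ ρ * Pˢ μ ns) (SP k)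

    frakpˢ-small : ∀ {n k} ρ {α} → n < k → α ∈ SP n → frakpˢ k ρ α ≡ 0#
    frakpˢ-small {n} {k} ρ {α} l m = ∑-zero (SP k) (λ {μ} mμ → trans (cong (X μ ρ *_) (Pˢ-size μ α
      (subst₂ ℕ._<_ (sym (proj₂ (∈⇒Strict n n m))) (sym (proj₂ (∈⇒Strict k k mμ))) l))) (zeroʳ _))

  ∑-fromℕ : ∀ α → ∑ fromℕ α ≡ fromℕ (size α)
  ∑-fromℕ [] = refl
  ∑-fromℕ (a ∷ α) = trans (cong (fromℕ a +_) (∑-fromℕ α)) (sym (fromℕ-+ a (size α)))

  -- Iterating the Pieri rule at a partition of size j + k turns P* expansions of degree k into multiples of P*_α(α).
  climb : ∀ j k (Y : List ℕ → Carrier) {α} → α ∈ SP (j ℕ.+ k) →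
    fromℕ (j !) * ∑ (λ μ → Y μ * Pˢ μ α) (SP k) ≡ upⁿ j Y α * Pˢ α α
  climb j k Y {α} m = trans (go j 0 (sym (ℕ.+-identityʳ j)))
    -- On the last level ν and α have the same size, so only ν = α survives.
    (∑-single _ (SP (j ℕ.+ k)) (strictPartsB-unique (j ℕ.+ k) (j ℕ.+ k)) m
        (λ {ν} mν ν≢α → trans (cong (upⁿ j Y ν *_) (Pˢ-vanish ν α
      (trans sα (sym (proj₂ (∈⇒Strict (j ℕ.+ k) (j ℕ.+ k) mν)))) (Points.positive pα)
          (λ p → ν≢α (Strict-↭ (proj₁ (∈⇒Strict (j ℕ.+ k) (j ℕ.+ k) mν))
          (proj₁ (∈⇒Strict (j ℕ.+ k) (j ℕ.+ k) m)) p)))) (zeroʳ _)))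
    where
    sα = proj₂ (∈⇒Strict (j ℕ.+ k) (j ℕ.+ k) m)
    pα = Strict-points (proj₁ (∈⇒Strict (j ℕ.+ k) (j ℕ.+ k) m))
    xs = map fromℕ α
    T : ℕ → Carrier
    T i = ∑ (λ ν → upⁿ i Y ν * Pˢ ν α) (SP (i ℕ.+ k))
    -- On level i the Pieri factor |α| - |ν| is j - i = d + 1 for every ν, so it can be taken out of
    -- the sum. Over all levels these factors multiply to j!.
    step : ∀ d i → j ≡ suc d ℕ.+ i → T (suc i) ≡ fromℕ (suc d) * T i
    step d i e = begin
      ∑ (λ ν → up (upⁿ i Y) ν * Pˢ ν α) (SP (suc (i ℕ.+ k)))
        ≡⟨ addBox-up (i ℕ.+ k) (upⁿ i Y) (λ ν → Pˢ ν α) (R-alternating falling xs (apart (points-generic pα))) ⟨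
      ∑ (λ ν → upⁿ i Y ν * addBox (λ β → Pˢ β α) ν) (SP (i ℕ.+ k))
        ≡⟨ ∑-cong (SP (i ℕ.+ k)) (λ {ν} mν → trans
             (cong (upⁿ i Y ν *_) (trans (sym
                 (pieri falling fromℕ refl (λ _ → refl) (λ _ _ → refl) xs (apart (points-generic pα)) ν))
                 (cong (_* Pˢ ν α) (excess ν mν))))
             (solve 3 (λ y d p → y :* (d :* p) := d :* (y :* p)) refl (upⁿ i Y ν) (fromℕ (suc d)) (Pˢ ν α))) ⟩
      ∑ (λ ν → fromℕ (suc d) * (upⁿ i Y ν * Pˢ ν α)) (SP (i ℕ.+ k))
        ≡⟨ ∑-*ˡ _ _ (SP (i ℕ.+ k)) ⟩
      fromℕ (suc d) * T i ∎
      where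
      excess : ∀ ν → ν ∈ SP (i ℕ.+ k) → ∑ id xs - ∑ fromℕ ν ≡ fromℕ (suc d)
      excess ν mν = begin
        ∑ id xs - ∑ fromℕ ν
          ≡⟨ cong₂ _-_ (trans (∑-map id fromℕ α)
               (trans (∑-fromℕ α) (cong fromℕ (trans sα (trans (cong (ℕ._+ k) e) (ℕ.+-assoc (suc d) i k))))))
               (trans (∑-fromℕ ν) (cong fromℕ (proj₂ (∈⇒Strict (i ℕ.+ k) (i ℕ.+ k) mν)))) ⟩
        fromℕ (suc d ℕ.+ (i ℕ.+ k)) - fromℕ (i ℕ.+ k)
          ≡⟨ cong (_- fromℕ (i ℕ.+ k)) (fromℕ-+ (suc d) (i ℕ.+ k)) ⟩
        (fromℕ (suc d) + fromℕ (i ℕ.+ k)) - fromℕ (i ℕ.+ k)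
          ≡⟨ solve 2 (λ a b → (a :+ b) :- b := a) refl (fromℕ (suc d)) (fromℕ (i ℕ.+ k)) ⟩
        fromℕ (suc d) ∎
    go : ∀ d i → j ≡ d ℕ.+ i → fromℕ (d !) * T i ≡ T j
    go zero i refl = solve 1 (λ t → (:1 :+ :0) :* t := t) refl (T i)
    go (suc d) i e = begin
      fromℕ (suc d ℕ.* d !) * T i
        ≡⟨ cong (_* T i) (fromℕ-* (suc d) (d !)) ⟩
      fromℕ (suc d) * fromℕ (d !) * T i
        ≡⟨ solve 3 (λ a b t → a :* b :* t := b :* (a :* t)) refl (fromℕ (suc d)) (fromℕ (d !)) (T i) ⟩
      fromℕ (d !) * (fromℕ (suc d) * T i)
        ≡⟨ cong (fromℕ (d !) *_) (step d i e) ⟨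
      fromℕ (d !) * T (suc i)
        ≡⟨ go d (suc i) (trans e (sym (ℕ.+-suc d i))) ⟩
      T j ∎

  private
    chain : ℕ → List ℕ → Carrier
    chain k α = fromℕ (Defs.gAux k α)

    chain-suc : ∀ k α → chain (suc k) α ≡ up (chain k) α
    chain-suc k α = go (filter (λ μ → Bool.T? (isStrict μ)) (removeBox α))
      where
      go : ∀ L → fromℕ (foldr ℕ._+_ 0 (map (Defs.gAux k) L)) ≡ ∑ (chain k) L
      go [] = refl
      go (μ ∷ L) = trans (fromℕ-+ (Defs.gAux k μ) _) (cong (chain k μ +_) (go L))

    up-cong : ∀ {Y Z} → (∀ α → Y α ≡ Z α) → ∀ α → up Y α ≡ up Z α
    up-cong e α = ∑-cong (filter (λ μ → Bool.T? (isStrict μ)) (removeBox α)) (λ _ → e _)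

    chain-upⁿ : ∀ k α → chain k α ≡ upⁿ k (chain 0) α
    chain-upⁿ zero α = refl
    chain-upⁿ (suc k) α = trans (chain-suc k α) (up-cong (chain-upⁿ k) α)

  -- The climb from the empty partition: there P* is 1, and the n-fold `up` of the indicator of the
  -- empty partition counts chains.
  hook-formula : ∀ n {α} → α ∈ SP n → fromℕ (n !) ≡ fromℕ (Defs.g α) * Pˢ α α
  hook-formula n {α} m = begin
    fromℕ (n !)
      ≡⟨ solve 1 (λ a → a := a :* ((:1 :+ :0) :* :1 :+ :0)) refl (fromℕ (n !)) ⟩
    fromℕ (n !) * ∑ (λ μ → chain 0 μ * Pˢ μ α) (SP 0)
      ≡⟨ climb n 0 (chain 0) (subst (λ k → α ∈ SP k) (sym (ℕ.+-identityʳ n)) m) ⟩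
    upⁿ n (chain 0) α * Pˢ α α
      ≡⟨ cong (_* Pˢ α α) (trans (sym (chain-upⁿ n α))
           (cong (λ k → chain k α) (sym (proj₂ (∈⇒Strict n n m))))) ⟩
    fromℕ (Defs.g α) * Pˢ α α ∎

  expectation : ℕ → (List ℕ → Carrier) → Carrier
  expectation n φ = ∑ (λ α → fromℕ (2 ℕ.^ (n ∸ length α) ℕ.* (Defs.g α ℕ.* Defs.g α)) * fromℕ (n !) ⁻¹ * φ α)
      (SP n)

  fromℕ-2^ : ∀ n → fromℕ (2 ℕ.^ n) ≡ 2# ^ n
  fromℕ-2^ zero = +-identityʳ 1#
  fromℕ-2^ (suc n) = trans (fromℕ-* 2 (2 ℕ.^ n)) (cong₂ _*_ (cong (1# +_) (+-identityʳ 1#)) (fromℕ-2^ n))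

  module _ (X : List ℕ → List ℕ → Carrier)
           (character : ∀ k {α} → α ∈ SP k → ∀ {ns} → Points ns → length ns ≡ k →
             2# ^ length α * P α (map fromℕ ns) ≡ ∑ (λ ρ → zWeight ρ * X α ρ * powerProduct ns ρ) (OP k)) where

    private
      Fρ : ℕ → List ℕ → List ℕ → Carrier
      Fρ = frakpˢ X character

      !≢0 : ∀ n → fromℕ (n !) ≢ 0#
      !≢0 n = fromℕ-pos≢0 (ℕ.1≤n! n)

    expectation-small : ∀ n k {ρ} (φ : List ℕ → Carrier) → n < k → expectation n (λ α → Fρ k ρ α * φ α) ≡ 0#
    expectation-small n k {ρ} φ l = ∑-zero (SP n)
        (λ {α} m → trans (cong (λ f → fromℕ (2 ℕ.^ (n ∸ length α) ℕ.* (Defs.g α ℕ.* Defs.g α)) * fromℕ (n !) ⁻¹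
        * (f * φ α)) (frakpˢ-small X character ρ l m))
      (solve 2 (λ a b → a :* (:0 :* b) := :0) refl _ (φ α)))

    -- `climb` leaves the unknown value P*_α(α), and the factor g^α turns it into n!. The factors j!
    -- and g^α stay on the left, so nothing is divided.
    frakpˢ-value : ∀ j k ρ {α} → α ∈ SP (j ℕ.+ k) →
      fromℕ (j !) * (fromℕ (Defs.g α) * Fρ k ρ α) ≡ upⁿ j (λ μ → X μ ρ) α * fromℕ ((j ℕ.+ k) !)
    frakpˢ-value j k ρ {α} m = begin
      fromℕ (j !) * (gα * Fρ k ρ α)
        ≡⟨ solve 3 (λ j g f → j :* (g :* f) := g :* (j :* f)) refl (fromℕ (j !)) gα (Fρ k ρ α) ⟩
      gα * (fromℕ (j !) * Fρ k ρ α)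
        ≡⟨ cong (gα *_) (climb j k (λ μ → X μ ρ) m) ⟩
      gα * (Y α * Pˢ α α)
        ≡⟨ solve 3 (λ g y p → g :* (y :* p) := y :* (g :* p)) refl gα (Y α) (Pˢ α α) ⟩
      Y α * (gα * Pˢ α α)
        ≡⟨ cong (Y α *_) (hook-formula (j ℕ.+ k) m) ⟨
      Y α * fromℕ ((j ℕ.+ k) !) ∎
      where
      gα = fromℕ (Defs.g α)
      Y = upⁿ j (λ μ → X μ ρ)

    -- Each factor g^α of the weight is used for one of the two values `frakpˢ-value`. These bring
    -- n! twice, the weight brings its inverse once, and 2^(n - ℓ) splits into 2^n and the weight
    -- 2^(-ℓ) of the pairing.
    expectation-pairing : ∀ n i k j l {ρ σ} → n ≡ i ℕ.+ k → n ≡ j ℕ.+ l →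
      fromℕ (i !) * fromℕ (j !) * expectation n (λ α → Fρ k ρ α * Fρ l σ α) ≡
      fromℕ (n !) * 2# ^ n * pairing X character n (upⁿ i (λ μ → X μ ρ)) (upⁿ j (λ μ → X μ σ))
    expectation-pairing n i k j l {ρ} {σ} e e′ = trans (sym (∑-*ˡ _ _ (SP n)))
        (trans (∑-cong (SP n) (λ {α} m → term α m)) (∑-*ˡ _ _ (SP n)))
      where
      N = fromℕ (n !)
      term : ∀ α → α ∈ SP n →
        fromℕ (i !) * fromℕ (j !) * (fromℕ (2 ℕ.^ (n ∸ length α) ℕ.* (Defs.g α ℕ.* Defs.g α)) * N ⁻¹ *
            (Fρ k ρ α * Fρ l σ α)) ≡
        N * 2# ^ n * (inverseWeight X character α * (upⁿ i (λ μ → X μ ρ) α * upⁿ j (λ μ → X μ σ) α))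
      term α m = begin
        fromℕ (i !) * fromℕ (j !) * (fromℕ (2 ℕ.^ (n ∸ length α) ℕ.* (Defs.g α ℕ.* Defs.g α)) * N ⁻¹ *
            (Fρ k ρ α * Fρ l σ α))
          ≡⟨ cong (λ t → fromℕ (i !) * fromℕ (j !) * (t * N ⁻¹ * (Fρ k ρ α * Fρ l σ α)))
               (trans (fromℕ-* (2 ℕ.^ (n ∸ length α)) (Defs.g α ℕ.* Defs.g α))
                   (cong₂ _*_ (fromℕ-2^ (n ∸ length α)) (fromℕ-* (Defs.g α) (Defs.g α)))) ⟩
        fromℕ (i !) * fromℕ (j !) * (2# ^ (n ∸ length α) * (gα * gα) * N ⁻¹ * (Fρ k ρ α * Fρ l σ α))
          ≡⟨ solve 7 (λ i j t g v a b → i :* j :* (t :* (g :* g) :* v :* (a :* b)) := t :* v :*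
               ((i :* (g :* a)) :* (j :* (g :* b)))) refl
               (fromℕ (i !)) (fromℕ (j !)) (2# ^ (n ∸ length α)) gα (N ⁻¹) (Fρ k ρ α) (Fρ l σ α) ⟩
        2# ^ (n ∸ length α) * N ⁻¹ * ((fromℕ (i !) * (gα * Fρ k ρ α)) * (fromℕ (j !) * (gα * Fρ l σ α)))
          ≡⟨ cong₂ (λ a b → 2# ^ (n ∸ length α) * N ⁻¹ * (a * b))
               (trans (frakpˢ-value i k ρ (subst (λ n → α ∈ SP n) e m)) (cong (λ n → y * fromℕ (n !)) (sym e)))
               (trans (frakpˢ-value j l σ (subst (λ n → α ∈ SP n) e′ m))
                   (cong (λ n → y′ * fromℕ (n !)) (sym e′))) ⟩
        2# ^ (n ∸ length α) * N ⁻¹ * ((y * N) * (y′ * N))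
          ≡⟨ solve 5 (λ t v y n z → t :* v :* ((y :* n) :* (z :* n)) := (n :* v) :* (n :* t :* (y :* z))) refl
               (2# ^ (n ∸ length α)) (N ⁻¹) y N y′ ⟩
        (N * N ⁻¹) * (N * 2# ^ (n ∸ length α) * (y * y′))
          ≡⟨ trans (cong (_* (N * 2# ^ (n ∸ length α) * (y * y′))) (inverseʳ (!≢0 n))) (*-identityˡ _) ⟩
        N * 2# ^ (n ∸ length α) * (y * y′)
          ≡⟨ cong (λ t → N * t * (y * y′)) power ⟩
        N * (2# ^ n * inverseWeight X character α) * (y * y′)
          ≡⟨ solve 4 (λ n t w y → n :* (t :* w) :* y := n :* t :* (w :* y)) refl N (2# ^ n)
               (inverseWeight X character α) (y * y′) ⟩
        N * 2# ^ n * (inverseWeight X character α * (y * y′)) ∎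
        where
        gα = fromℕ (Defs.g α)
        y = upⁿ i (λ μ → X μ ρ) α
        y′ = upⁿ j (λ μ → X μ σ) α
        length≤n : length α ≤ n
        length≤n = subst (length α ℕ.≤_) (proj₂ (∈⇒Strict n n m))
            (length≤size (Points.positive (Strict-points (proj₁ (∈⇒Strict n n m)))))
        power : 2# ^ (n ∸ length α) ≡ 2# ^ n * inverseWeight X character α
        power = sym (trans (cong (λ k → 2# ^ k * inverseWeight X character α) (sym (ℕ.m∸n+n≡m length≤n)))
          (trans (cong (_* inverseWeight X character α) (^-+ 2# (n ∸ length α) (length α)))
              (trans (*-assoc _ _ _)
            (trans (cong (2# ^ (n ∸ length α) *_) (inverseʳ (^-≢0 (length α) 2≢0))) (*-identityʳ _)))))

    -- For n ≥ k and n ≥ l this is orthogonality of the characters of ρ ∪ 1^i and σ ∪ 1^j with i = n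
    -- - k and j = n - l. Below these sizes one of the two functions vanishes on all partitions of
    -- n.
    orthogonality : ∀ {k l ρ σ} → ρ ∈ OP k → σ ∈ OP l → All (λ r → r ≢ 1) ρ → All (λ r → r ≢ 1) σ → ∀ n →
      expectation n (λ α → Fρ k ρ α * Fρ l σ α) ≡ kronecker ρ σ * fromℕ (2 ℕ.^ (k ∸ length ρ)) * fromℕ
          (Defs.z ρ) * fromℕ (fallℕ n k)
    orthogonality {k} {l} {ρ} {σ} mρ mσ nρ nσ n with k ≤? n
    ... | no k≰n = trans (expectation-small n k (Fρ l σ) (ℕ.≰⇒> k≰n))
          (sym (trans (cong (λ f → kronecker ρ σ * fromℕ (2 ℕ.^ (k ∸ length ρ)) * fromℕ (Defs.z ρ) * fromℕ f)
              (fallℕ-< (ℕ.≰⇒> k≰n))) (zeroʳ _)))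
    ... | yes k≤n with l ≤? n
    -- Here k ≤ n < l, so ρ and σ differ in size and the right side vanishes through δ, not through
    -- the falling power.
    ...   | no l≰n = trans (∑-cong (SP n) (λ {α} _ → cong
          (fromℕ (2 ℕ.^ (n ∸ length α) ℕ.* (Defs.g α ℕ.* Defs.g α)) * fromℕ (n !) ⁻¹ *_)
          (*-comm (Fρ k ρ α) (Fρ l σ α))))
            (trans (expectation-small n l (Fρ k ρ) (ℕ.≰⇒> l≰n))
            (sym (trans (cong (λ d → d * fromℕ (2 ℕ.^ (k ∸ length ρ)) * fromℕ (Defs.z ρ) * fromℕ (fallℕ n k))
                (kronecker-≢ ρ≢σ)) (solve 3 (λ a b c → :0 :* a :* b :* c := :0) refl _ _ _))))
      where
      ρ≢σ : ρ ≢ σ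
      ρ≢σ refl = l≰n (subst (ℕ._≤ n) (trans (sym (proj₂ (∈⇒OddParts k k mρ))) (proj₂ (∈⇒OddParts l l mσ))) k≤n)
    ...   | yes l≤n = *-cancelˡ {zWeight σ̃ * (fromℕ (i !) * fromℕ (j !))}
          (*-≢0 (zWeight≢0 σ̃) (*-≢0 (!≢0 i) (!≢0 j))) (begin
        zWeight σ̃ * (fromℕ (i !) * fromℕ (j !)) * expectation n (λ α → Fρ k ρ α * Fρ l σ α)
          ≡⟨ *-assoc _ _ _ ⟩
        zWeight σ̃ * (fromℕ (i !) * fromℕ (j !) * expectation n (λ α → Fρ k ρ α * Fρ l σ α))
          ≡⟨ cong (zWeight σ̃ *_) (expectation-pairing n i k j l n≡i+k n≡j+l) ⟩
        zWeight σ̃ * (fromℕ (n !) * 2# ^ n * pairing X character n (upⁿ i (λ μ → X μ ρ)) (upⁿ j (λ μ → X μ σ)))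
          ≡⟨ solve 3 (λ z n p → z :* (n :* p) := n :* (z :* p)) refl (zWeight σ̃) (fromℕ (n !) * 2# ^ n) _ ⟩
        fromℕ (n !) * 2# ^ n * (zWeight σ̃ * pairing X character n (upⁿ i (λ μ → X μ ρ)) (upⁿ j (λ μ → X μ σ)))
          ≡⟨ cong (fromℕ (n !) * 2# ^ n *_) (pairing-up X character n (expands i k ρ n≡i+k mρ)
               (expands j l σ n≡j+l mσ) (member i k ρ n≡i+k mρ) (member j l σ n≡j+l mσ)) ⟩
        fromℕ (n !) * 2# ^ n * kronecker σ̃ ρ̃
          ≡⟨ final (List.≡-dec ℕ._≟_ ρ σ) ⟩
        zWeight σ̃ * (fromℕ (i !) * fromℕ (j !)) *
            (kronecker ρ σ * fromℕ (2 ℕ.^ (k ∸ length ρ)) * fromℕ (Defs.z ρ) * fromℕ (fallℕ n k)) ∎)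
      where
      i = n ∸ k
      j = n ∸ l
      ρ̃ = insertOnes i ρ
      σ̃ = insertOnes j σ
      n≡i+k : n ≡ i ℕ.+ k
      n≡i+k = sym (ℕ.m∸n+n≡m k≤n)
      n≡j+l : n ≡ j ℕ.+ l
      n≡j+l = sym (ℕ.m∸n+n≡m l≤n)
      oρ = proj₁ (∈⇒OddParts k k mρ)
      oσ = proj₁ (∈⇒OddParts l l mσ)
      expands : ∀ i k ρ → n ≡ i ℕ.+ k → ρ ∈ OP k → Expands X character n (upⁿ i (λ μ → X μ ρ)) (insertOnes i ρ)
      expands i k ρ e m = subst (λ n → Expands X character n (upⁿ i (λ μ → X μ ρ)) (insertOnes i ρ)) (sym e)
        (λ {ns} → Expands-upⁿ X character i {k} {λ μ → X μ ρ} {ρ}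
            (λ {ns} → power-expansion X character k m {ns}) {ns})
      member : ∀ i k ρ → n ≡ i ℕ.+ k → ρ ∈ OP k → insertOnes i ρ ∈ OP n
      member i k ρ e m = subst (λ n → insertOnes i ρ ∈ OP n)
          (trans (cong (i ℕ.+_) (proj₂ (∈⇒OddParts k k m))) (sym e))
          (insertOnes-∈OP i (proj₁ (∈⇒OddParts k k m)))
      final : Dec (ρ ≡ σ) → fromℕ (n !) * 2# ^ n * kronecker σ̃ ρ̃ ≡
        zWeight σ̃ * (fromℕ (i !) * fromℕ (j !)) *
            (kronecker ρ σ * fromℕ (2 ℕ.^ (k ∸ length ρ)) * fromℕ (Defs.z ρ) * fromℕ (fallℕ n k))
      final (no ρ≢σ) = trans (trans (cong (fromℕ (n !) * 2# ^ n *_) (kronecker-≢ {σ̃} {ρ̃} different))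
          (zeroʳ _))
        (sym (trans (cong (λ d → zWeight σ̃ * (fromℕ (i !) * fromℕ (j !)) *
            (d * fromℕ (2 ℕ.^ (k ∸ length ρ)) * fromℕ (Defs.z ρ) * fromℕ (fallℕ n k))) (kronecker-≢ ρ≢σ))
          (solve 4 (λ z a b c → z :* (:0 :* a :* b :* c) := :0) refl _ _ _ _)))
        where
        -- Since neither ρ nor σ has a part 1, counting the parts 1 gives i = j, and the adjoined
        -- parts can be removed.
        different : σ̃ ≢ ρ̃
        different e = ρ≢σ (insertOnes-injective i oρ oσ (trans (sym e) (cong (λ m → insertOnes m σ)
          (trans (sym (mult-insertOnes j (mult-one nσ)))
              (trans (cong (mult 1) e) (mult-insertOnes i (mult-one nρ)))))))
      final (yes refl) = same (trans (sym (proj₂ (∈⇒OddParts k k mρ))) (proj₂ (∈⇒OddParts l l mσ)))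
        where
        same : k ≡ l → fromℕ (n !) * 2# ^ n * kronecker σ̃ ρ̃ ≡
          zWeight σ̃ * (fromℕ (i !) * fromℕ (j !)) *
              (kronecker ρ ρ * fromℕ (2 ℕ.^ (k ∸ length ρ)) * fromℕ (Defs.z ρ) * fromℕ (fallℕ n k))
        -- One factor i! completes z_ρ to the z of ρ ∪ 1^i and cancels with `zWeight`; the other
        -- completes the falling power to n!. The powers of 2 combine to 2^n.
        same refl = sym (begin
          2# ^ length ρ̃ * fromℕ (Defs.z ρ̃) ⁻¹ * (a * a) *
              (kronecker ρ ρ * fromℕ (2 ℕ.^ (k ∸ length ρ)) * zρ * f)
            ≡⟨ cong₂ (λ m t → 2# ^ m * fromℕ (Defs.z ρ̃) ⁻¹ * (a * a) * t) (length-insertOnes i ρ)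
                 (cong₂ (λ d t → d * t * zρ * f) (kronecker-refl ρ) (fromℕ-2^ (k ∸ length ρ))) ⟩
          2# ^ (i ℕ.+ length ρ) * fromℕ (Defs.z ρ̃) ⁻¹ * (a * a) * (1# * 2# ^ (k ∸ length ρ) * zρ * f)
            ≡⟨ solve 6 (λ t v a u z f → t :* v :* (a :* a) :* (:1 :* u :* z :* f) := ((a :* z) :* v) :*
                 ((f :* a) :* (t :* u))) refl
                 (2# ^ (i ℕ.+ length ρ)) (fromℕ (Defs.z ρ̃) ⁻¹) a (2# ^ (k ∸ length ρ)) zρ f ⟩
          ((a * zρ) * fromℕ (Defs.z ρ̃) ⁻¹) * ((f * a) * (2# ^ (i ℕ.+ length ρ) * 2# ^ (k ∸ length ρ)))
            ≡⟨ cong₂ _*_ (trans (cong (_* fromℕ (Defs.z ρ̃) ⁻¹)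
                 (trans (sym (fromℕ-* (i !) (Defs.z ρ))) (cong fromℕ (sym (z-insertOnes i (mult-one nρ))))))
                 (inverseʳ (fromℕ-z≢0 ρ̃)))
                 (cong₂ _*_ (trans (sym (fromℕ-* (fallℕ n k) (i !))) (cong fromℕ factorial))
                     (trans (sym (^-+ 2# (i ℕ.+ length ρ) (k ∸ length ρ))) (cong (2# ^_) exponent))) ⟩
          1# * (fromℕ (n !) * 2# ^ n)
            ≡⟨ trans (*-identityˡ _) (sym (trans (cong (fromℕ (n !) * 2# ^ n *_) (kronecker-refl ρ̃))
                 (*-identityʳ _))) ⟩
          fromℕ (n !) * 2# ^ n * kronecker ρ̃ ρ̃ ∎)
          where
          a = fromℕ (i !)
          zρ = fromℕ (Defs.z ρ)
          f = fromℕ (fallℕ n k)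
          factorial : fallℕ n k ℕ.* i ! ≡ n !
          factorial = trans (cong (λ n → fallℕ n k ℕ.* i !) n≡i+k) (trans (fallℕ-! i k) (cong _! (sym n≡i+k)))
          exponent : i ℕ.+ length ρ ℕ.+ (k ∸ length ρ) ≡ n
          exponent = trans (ℕ.+-assoc i (length ρ) _) (trans (cong (i ℕ.+_) (ℕ.m+[n∸m]≡n length≤k)) (sym n≡i+k))
            where
            length≤k : length ρ ≤ k
            length≤k = subst (length ρ ℕ.≤_) (proj₂ (∈⇒OddParts k k mρ)) (length≤size (OddParts-positive oρ))

-- Sums over permutations as iterated picks.

module Symmetrisation (F : OrderedField) where
  open FieldTheory F
  open Symmetrised F
  open ≡.≡-Reasoning

  private
    ∑-concatMap : ∀ {A B : Set} (f : B → Carrier) (h : A → List B) xs → ∑ f (concatMap h xs) ≡ ∑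
        (λ x → ∑ f (h x)) xs
    ∑-concatMap f h [] = refl
    ∑-concatMap f h (x ∷ xs) = trans (∑-++ f (h x) (concatMap h xs)) (cong (∑ f (h x) +_) (∑-concatMap f h xs))

  permSum : (List Carrier → Carrier) → List Carrier → Carrier
  permSum f xs = ∑ f (perms xs)

  private
    permSum-insertions : ∀ f a l → permSum f (a ∷ l) ≡ permSum (λ π → ∑ f (insertions a π)) l
    permSum-insertions f a l = ∑-concatMap f (insertions a) (perms l)

    permSum-cong : ∀ {f h} l → (∀ π → f π ≡ h π) → permSum f l ≡ permSum h l
    permSum-cong l e = ∑-cong (perms l) (λ _ → e _)

  -- `perms` inserts the head into the permutations of the tail; here the permutations are regrouped
  -- by their first entry. An insertion puts a either in front or behind some first entry b, and
  -- these two cases are the two sums.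
  permSum-∷ : ∀ f a l → permSum f (a ∷ l) ≡ ∑ᵖ (λ b l′ → permSum (λ π → f (b ∷ π)) l′) (a ∷ l)
  permSum-∷ f a [] = solve 1 (λ a → a :+ :0 := a :+ :0 :+ :0) refl (f (a ∷ []))
  permSum-∷ f a (c ∷ l) = begin
    permSum f (a ∷ c ∷ l)
      ≡⟨ permSum-insertions f a (c ∷ l) ⟩
    permSum (λ π → ∑ f (insertions a π)) (c ∷ l)
      ≡⟨ permSum-∷ _ c l ⟩
    ∑ᵖ (λ b l′ → permSum (λ π → f (a ∷ b ∷ π) + ∑ f (map (b ∷_) (insertions a π))) l′) (c ∷ l)
      ≡⟨ ∑ᵖ-cong (c ∷ l) (λ {b} {l′} _ → trans (∑-+ _ _ (perms l′)) (cong (permSum (λ π → f (a ∷ b ∷ π)) l′ +_)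
           (trans (permSum-cong l′ (λ π → ∑-map f (b ∷_) (insertions a π)))
               (sym (permSum-insertions (λ π → f (b ∷ π)) a l′))))) ⟩
    ∑ᵖ (λ b l′ → permSum (λ π → f (a ∷ b ∷ π)) l′ + permSum (λ π → f (b ∷ π)) (a ∷ l′)) (c ∷ l)
      ≡⟨ ∑ᵖ-+ (λ b l′ → permSum (λ π → f (a ∷ b ∷ π)) l′) (λ b l′ → permSum (λ π → f (b ∷ π)) (a ∷ l′))
           (c ∷ l) ⟩
    ∑ᵖ (λ b l′ → permSum (λ π → f (a ∷ b ∷ π)) l′) (c ∷ l) + ∑ᵖ (λ b l′ → permSum (λ π → f (b ∷ π)) (a ∷ l′))
        (c ∷ l)
      ≡⟨ cong (_+ ∑ᵖ (λ b l′ → permSum (λ π → f (b ∷ π)) (a ∷ l′)) (c ∷ l)) (permSum-∷ (λ π → f (a ∷ π)) c l) ⟨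
    ∑ᵖ (λ b l′ → permSum (λ π → f (b ∷ π)) l′) (a ∷ c ∷ l) ∎

  permSum-∏ : ∀ h f l → permSum (λ π → ∏ h π * f π) l ≡ ∏ h l * permSum f l
  permSum-∏ h f l = go (length l) f l ℕ.≤-refl
    where
    go : ∀ n f l → length l ≤ n → permSum (λ π → ∏ h π * f π) l ≡ ∏ h l * permSum f l
    go n f [] _ = solve 1 (λ a → :1 :* a :+ :0 := :1 :* (a :+ :0)) refl (f [])
    go (suc n) f (a ∷ l) (s≤s len) = begin
      permSum (λ π → ∏ h π * f π) (a ∷ l)
        ≡⟨ permSum-∷ _ a l ⟩
      ∑ᵖ (λ b l′ → permSum (λ π → h b * ∏ h π * f (b ∷ π)) l′) (a ∷ l)
        ≡⟨ ∑ᵖ-cong (a ∷ l) (λ {b} {l′} p → begin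
             permSum (λ π → h b * ∏ h π * f (b ∷ π)) l′
               ≡⟨ permSum-cong l′ (λ π → solve 3 (λ x y z → x :* y :* z := y :* (x :* z)) refl (h b) (∏ h π)
                    (f (b ∷ π))) ⟩
             permSum (λ π → ∏ h π * (h b * f (b ∷ π))) l′
               ≡⟨ go n _ l′ (ℕ.≤-trans (ℕ.≤-reflexive (ℕ.suc-injective (sym (Pick-length p)))) len) ⟩
             ∏ h l′ * permSum (λ π → h b * f (b ∷ π)) l′
               ≡⟨ cong (∏ h l′ *_) (∑-*ˡ (h b) _ (perms l′)) ⟩
             ∏ h l′ * (h b * permSum (λ π → f (b ∷ π)) l′)
               ≡⟨ solve 3 (λ x y z → x :* (y :* z) := y :* x :* z) refl (∏ h l′) (h b) _ ⟩
             h b * ∏ h l′ * permSum (λ π → f (b ∷ π)) l′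
               ≡⟨ cong (_* permSum (λ π → f (b ∷ π)) l′) (∏-pick h p) ⟨
             ∏ h (a ∷ l) * permSum (λ π → f (b ∷ π)) l′ ∎) ⟩
      ∑ᵖ (λ b l′ → ∏ h (a ∷ l) * permSum (λ π → f (b ∷ π)) l′) (a ∷ l)
        ≡⟨ ∑ᵖ-*ˡ (∏ h (a ∷ l)) (λ b l′ → permSum (λ π → f (b ∷ π)) l′) (a ∷ l) ⟩
      ∏ h (a ∷ l) * ∑ᵖ (λ b l′ → permSum (λ π → f (b ∷ π)) l′) (a ∷ l)
        ≡⟨ cong (∏ h (a ∷ l) *_) (permSum-∷ f a l) ⟨
      ∏ h (a ∷ l) * permSum f (a ∷ l) ∎

  ∑ᵖ-const : ∀ {A : Set} c (xs : List A) → ∑ᵖ (λ _ _ → c) xs ≡ fromℕ (length xs) * c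
  ∑ᵖ-const c [] = sym (zeroˡ c)
  ∑ᵖ-const c (x ∷ xs) = trans (cong (c +_) (∑ᵖ-const c xs))
      (solve 2 (λ c n → c :+ n :* c := (:1 :+ n) :* c) refl c (fromℕ (length xs)))

  permSum-const : ∀ n l → length l ≡ n → permSum (λ _ → 1#) l ≡ fromℕ (n !)
  permSum-const zero [] _ = refl
  permSum-const (suc n) (a ∷ l) e = begin
    permSum (λ _ → 1#) (a ∷ l)
      ≡⟨ permSum-∷ (λ _ → 1#) a l ⟩
    ∑ᵖ (λ _ l′ → permSum (λ _ → 1#) l′) (a ∷ l)
      ≡⟨ ∑ᵖ-cong (a ∷ l) (λ {_} {l′} p → permSum-const n l′ (ℕ.suc-injective (trans (sym (Pick-length p)) e))) ⟩
    ∑ᵖ (λ _ _ → fromℕ (n !)) (a ∷ l)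
      ≡⟨ ∑ᵖ-const (fromℕ (n !)) (a ∷ l) ⟩
    fromℕ (length (a ∷ l)) * fromℕ (n !)
      ≡⟨ cong (λ m → fromℕ m * fromℕ (n !)) e ⟩
    fromℕ (suc n) * fromℕ (n !)
      ≡⟨ fromℕ-* (suc n) (n !) ⟨
    fromℕ ((suc n) !) ∎

  R-cong : ∀ {pw pw′ : Carrier → ℕ → Carrier} → (∀ y a → pw y a ≡ pw′ y a) → ∀ α xs → R pw α xs ≡ R pw′ α xs
  R-cong e [] xs = refl
  R-cong e (a ∷ α) xs = ∑ᵖ-cong xs (λ {y} {ys} _ → cong₂ (λ p r → p * weight y ys * r) (e y a) (R-cong e α ys))

  R-short : ∀ pw α xs → length xs < length α → R pw α xs ≡ 0#
  R-short pw (a ∷ α) xs l = ∑ᵖ-zero xs (λ {y} {ys} p → trans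
      (cong (pw y a * weight y ys *_) (R-short pw α ys
      (ℕ.≤-trans (ℕ.≤-reflexive (sym (Pick-length p))) (ℕ.≤-pred l)))) (zeroʳ _))

  permSum-R : ∀ pw (summand : List ℕ → List Carrier → Carrier) →
    (∀ ys → summand [] ys ≡ 1#) → (∀ a α y ys → summand (a ∷ α) (y ∷ ys) ≡ pw y a * weight y ys * summand α ys)
        →
    ∀ α xs → length α ≤ length xs → permSum (summand α) xs ≡ fromℕ ((length xs ∸ length α) !) * R pw α xs
  permSum-R pw summand e₀ e [] xs _ = trans (permSum-cong xs e₀)
      (trans (permSum-const (length xs) xs refl) (sym (*-identityʳ _)))
  permSum-R pw summand e₀ e (a ∷ α) (x ∷ xs) (s≤s l) = begin
    permSum (summand (a ∷ α)) (x ∷ xs)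
      ≡⟨ permSum-∷ _ x xs ⟩
    ∑ᵖ (λ y ys → permSum (λ π → summand (a ∷ α) (y ∷ π)) ys) (x ∷ xs)
      ≡⟨ ∑ᵖ-cong (x ∷ xs) (λ {y} {ys} p → begin
           permSum (λ π → summand (a ∷ α) (y ∷ π)) ys
             ≡⟨ permSum-cong ys (λ π → trans (e a α y π)
                  (solve 3 (λ p w s → p :* w :* s := w :* (p :* s)) refl (pw y a) (weight y π) (summand α π))) ⟩
           permSum (λ π → weight y π * (pw y a * summand α π)) ys
             ≡⟨ permSum-∏ (v y) _ ys ⟩
           weight y ys * permSum (λ π → pw y a * summand α π) ys
             ≡⟨ cong (weight y ys *_) (trans (∑-*ˡ (pw y a) _ (perms ys))
                  (cong (pw y a *_) (permSum-R pw summand e₀ e α ys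
                  (ℕ.≤-trans l (ℕ.≤-reflexive (ℕ.suc-injective (Pick-length p))))))) ⟩
           weight y ys * (pw y a * (fromℕ ((length ys ∸ length α) !) * R pw α ys))
             ≡⟨ cong (λ k → weight y ys * (pw y a * (fromℕ ((k ∸ length α) !) * R pw α ys)))
                  (ℕ.suc-injective (sym (Pick-length p))) ⟩
           weight y ys * (pw y a * (f * R pw α ys))
             ≡⟨ solve 4 (λ w p f r → w :* (p :* (f :* r)) := f :* (p :* w :* r)) refl (weight y ys) (pw y a) f
                  (R pw α ys) ⟩
           f * (pw y a * weight y ys * R pw α ys) ∎) ⟩
    ∑ᵖ (λ y ys → f * (pw y a * weight y ys * R pw α ys)) (x ∷ xs)
      ≡⟨ ∑ᵖ-*ˡ f (λ y ys → pw y a * weight y ys * R pw α ys) (x ∷ xs) ⟩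
    f * R pw (a ∷ α) (x ∷ xs) ∎
    where f = fromℕ ((length xs ∸ length α) !)

-- Specialisation to the rational numbers.

ℚ-field : OrderedField
ℚ-field = record
  { Carrier = ℚ ; _+_ = ℚ._+_ ; _*_ = ℚ._*_ ; -_ = ℚ.-_ ; 0# = 0ℚ ; 1# = 1ℚ
  ; isCommutativeRing = ℚ.+-*-isCommutativeRing
  ; _⁻¹ = Defs.inv
  ; inverseʳ = λ {x} → inverse x
  ; 1≢0 = ℚ.1≢0
  ; NonNeg = 0ℚ ℚ.≤_
  ; nonNeg-square = square
  ; nonNeg-+ = λ p q → ℚ.+-mono-≤ p q
  ; nonNeg-* = product
  ; nonNeg-sum-zero = λ {x} {y} p q e → ℚ.≤-antisym (subst₂ ℚ._≤_ (ℚ.+-identityʳ x) e (ℚ.+-monoʳ-≤ x q)) p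
  ; square-zero = λ {x} → zero-square x
  }
  where
  inverse : ∀ x → x ≢ 0ℚ → x ℚ.* Defs.inv x ≡ 1ℚ
  inverse x x≢0 with x ℚ.≟ 0ℚ
  ... | yes e = contradiction e x≢0
  ... | no ne = ℚ.*-inverseʳ x {{ℚ.≢-nonZero ne}}
  product : ∀ {x y} → 0ℚ ℚ.≤ x → 0ℚ ℚ.≤ y → 0ℚ ℚ.≤ x ℚ.* y
  product {x} {y} p q = ℚ.nonNegative⁻¹ (x ℚ.* y)
      {{ℚ.nonNeg*nonNeg⇒nonNeg x {{ℚ.nonNegative p}} y {{ℚ.nonNegative q}}}}
  square : ∀ x → 0ℚ ℚ.≤ x ℚ.* x
  square x with ℚ.≤-total 0ℚ x
  ... | inj₁ p = product p p
  ... | inj₂ p = ℚ.nonNegative⁻¹ (x ℚ.* x) {{ℚ.nonPos*nonPos⇒nonPos x {{ℚ.nonPositive p}} x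
        {{ℚ.nonPositive p}}}}
  zero-square : ∀ x → x ℚ.* x ≡ 0ℚ → x ≡ 0ℚ
  zero-square x e with x ℚ.≟ 0ℚ
  ... | yes p = p
  ... | no ne = contradiction (trans (sym (trans (ℚ.*-assoc x x (Defs.inv x))
        (trans (cong (x ℚ.*_) (inverse x ne)) (ℚ.*-identityʳ x))))
    (trans (cong (ℚ._* Defs.inv x) e) (ℚ.*-zeroˡ (Defs.inv x)))) ne

open FieldTheory ℚ-field using (fromℕ; fromℕ-injective; ∑; ∏; ∑-cong; ∏-cong; _^_; 2#)
open Symmetrised ℚ-field using (R)
open StrictSums ℚ-field using (P)
open OddSums ℚ-field using (zWeight)
open LinearIndependence ℚ-field using (powerProduct)
open Boxes ℚ-field using (falling; Pˢ)
open FiniteSums ℚ-field using (kronecker)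
open Orthogonality ℚ-field using (fromℕ-2^; expectation; orthogonality)
open Symmetrisation ℚ-field using (permSum-R; R-cong; R-short)

-- In unnormalised fractions (n + 1)/1 = 1/1 + n/1 is an identity of integers that involves no gcd.
ℕ→ℚ≡fromℕ : ∀ n → Defs.ℕ→ℚ n ≡ fromℕ n
ℕ→ℚ≡fromℕ zero = refl
ℕ→ℚ≡fromℕ (suc n) = trans (ℚ.toℚᵘ-injective (begin
  ℚ.toℚᵘ (ℤ.+ suc n ℚ./ 1)                                 ≈⟨ ℚ.toℚᵘ-fromℚᵘ (ℚᵘ.mkℚᵘ (ℤ.+ suc n) 0) ⟩
  ℚᵘ.mkℚᵘ (ℤ.+ suc n) 0                                    ≈⟨ ℚᵘ.*≡* (numerators n) ⟩
  ℚᵘ.1ℚᵘ ℚᵘ.+ ℚᵘ.mkℚᵘ (ℤ.+ n) 0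
      ≈⟨ ℚᵘ.+-congʳ ℚᵘ.1ℚᵘ (ℚ.toℚᵘ-fromℚᵘ (ℚᵘ.mkℚᵘ (ℤ.+ n) 0)) ⟨
  ℚᵘ.1ℚᵘ ℚᵘ.+ ℚ.toℚᵘ (ℤ.+ n ℚ./ 1)                           ≈⟨ ℚ.toℚᵘ-homo-+ 1ℚ (ℤ.+ n ℚ./ 1) ⟨
  ℚ.toℚᵘ (1ℚ ℚ.+ (ℤ.+ n ℚ./ 1))                              ∎))
  (cong (1ℚ ℚ.+_) (ℕ→ℚ≡fromℕ n))
  where
  open import Relation.Binary.Reasoning.Setoid ℚᵘ.≃-setoid
  numerators : ∀ n → ℤ.+ suc n ℤ.* ℤ.+ 1 ≡ (ℤ.+ 1 ℤ.* ℤ.+ 1 ℤ.+ ℤ.+ n ℤ.* ℤ.+ 1) ℤ.* ℤ.+ 1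
  numerators n = cong (ℤ._* ℤ.+ 1) (cong (ℤ._+_ (ℤ.+ 1)) (sym (ℤ.*-identityʳ (ℤ.+ n))))

fall≡falling : ∀ x k → Defs.fall x k ≡ falling x k
fall≡falling x zero = refl
fall≡falling x (suc k) = cong₂ (λ f n → f ℚ.* (x ℚ.- n)) (fall≡falling x k) (ℕ→ℚ≡fromℕ k)

^ℚ≡^ : ∀ x k → x Defs.^ℚ k ≡ x ^ k
^ℚ≡^ x zero = refl
^ℚ≡^ x (suc k) = cong (x ℚ.*_) (^ℚ≡^ x k)

-- With fewer variables than parts the definition prescribes 0, which agrees with `R` because some
-- part finds no variable to pick.
symmetrise≡R : ∀ pw α xs → Defs.symmetrise pw α xs ≡ R pw α xs
symmetrise≡R pw α xs with length xs <ᵇ length α in eq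
... | true = sym (R-short pw α xs (ℕ.<ᵇ⇒< (length xs) (length α) (subst Bool.T (sym eq) tt)))
... | false = trans (cong₂ (λ c s → Defs.inv c ℚ.* s) (ℕ→ℚ≡fromℕ k!)
      (permSum-R pw (Defs.summand pw) (λ _ → refl) (λ _ _ _ _ → refl) α xs α≤xs))
  (trans (sym (ℚ.*-assoc (Defs.inv (fromℕ k!)) (fromℕ k!) (R pw α xs)))
    (trans (cong (ℚ._* R pw α xs) (trans (ℚ.*-comm (Defs.inv (fromℕ k!)) (fromℕ k!))
        (OrderedField.inverseʳ ℚ-field (FieldTheory.fromℕ-pos≢0 ℚ-field (ℕ.1≤n! (length xs ∸ length α))))))
      (ℚ.*-identityˡ _)))
  where
  k! = (length xs ∸ length α) !
  α≤xs : length α ≤ length xs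
  α≤xs = ℕ.≮⇒≥ (λ l → subst Bool.T eq (ℕ.<⇒<ᵇ l))

Pstar≡Pˢ : ∀ α ns → Defs.Pstar α (map Defs.ℕ→ℚ ns) ≡ Pˢ α ns
Pstar≡Pˢ α ns = trans (symmetrise≡R Defs.fall α (map Defs.ℕ→ℚ ns))
  (trans (R-cong fall≡falling α (map Defs.ℕ→ℚ ns)) (cong (R falling α) (List.map-cong ℕ→ℚ≡fromℕ ns)))

pfun≡powerProduct : ∀ ρ ns → Defs.pfun ρ (map fromℕ ns) ≡ powerProduct ns ρ
pfun≡powerProduct ρ ns = ∏-cong ρ (λ {r} _ → ∑-cong (map fromℕ ns) (λ {x} _ → ^ℚ≡^ x r))

ℕ→ℚ-2^ : ∀ n → Defs.ℕ→ℚ (2 ℕ.^ n) ≡ 2# ^ n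
ℕ→ℚ-2^ n = trans (ℕ→ℚ≡fromℕ (2 ℕ.^ n)) (fromℕ-2^ n)

-- The table is consulted only at distinct positive integers, which satisfy its distinctness
-- condition.
IsCharTable⇒character : ∀ X → Defs.IsCharTable X → ∀ k {α} → α ∈ SP k → ∀ {ns} → Points ns → length ns ≡ k →
  2# ^ length α ℚ.* P α (map fromℕ ns) ≡ ∑ (λ ρ → zWeight ρ ℚ.* X α ρ ℚ.* powerProduct ns ρ) (OP k)
IsCharTable⇒character X table k {α} m {ns} p e = trans
  (cong₂ ℚ._*_ (sym (ℕ→ℚ-2^ (length α))) (sym
      (trans (symmetrise≡R Defs._^ℚ_ α (map fromℕ ns)) (R-cong ^ℚ≡^ α (map fromℕ ns)))))
  (trans (table k α m (map fromℕ ns) (trans (List.length-map fromℕ ns) e)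
      (Unique.map⁺ fromℕ-injective (Points.distinct p)))
    (∑-cong (OP k) (λ {ρ} _ → cong₂ (λ c q → c ℚ.* X α ρ ℚ.* q)
      (cong₂ (λ t z → t ℚ.* Defs.inv z) (ℕ→ℚ-2^ (length ρ)) (ℕ→ℚ≡fromℕ (Defs.z ρ))) (pfun≡powerProduct ρ ns))))

δ≡kronecker : ∀ ρ σ → Defs.δ ρ σ ≡ kronecker ρ σ
δ≡kronecker ρ σ with List.≡-dec ℕ._≟_ ρ σ
... | yes _ = refl
... | no _ = refl

open import Defs
open import Data.Nat using (ℕ; _∸_)
open import Data.List using (List; length)
open import Data.List.Membership.Propositional using (_∈_)
open import Data.List.Relation.Unary.All using (All)
open import Data.Rational using (ℚ; _*_)
open import Relation.Binary.PropositionalEquality using (_≡_; _≢_)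

theorem4p4 : (X : List ℕ → List ℕ → ℚ) → IsCharTable X →
    ∀ (a b : ℕ) (ρ σ : List ℕ) → ρ ∈ OP a → σ ∈ OP b →
    All (λ r → r ≢ 1) ρ → All (λ r → r ≢ 1) σ →
    ∀ (n : ℕ) →
    𝔼 n (λ λ' → frakp X ρ λ' * frakp X σ λ')
    ≡ δ ρ σ * ℕ→ℚ (Data.Nat._^_ 2 (size ρ ∸ length ρ)) * ℕ→ℚ (z ρ) * ℕ→ℚ (fallℕ n (size ρ))
theorem4p4 X table a b ρ σ ρ∈ σ∈ ρ≢1 σ≢1 n = trans
  (∑-cong (SP n) (λ {α} _ → cong₂ _*_
    (cong₂ (λ c d → c * inv d) (ℕ→ℚ≡fromℕ (2 ℕ.^ (n ∸ length α) ℕ.* (g α ℕ.* g α))) (ℕ→ℚ≡fromℕ (n !)))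
    (cong₂ _*_ (frakp≡ ρ α) (frakp≡ σ α))))
  (trans (orthogonality X (IsCharTable⇒character X table) {size ρ} {size σ} (member a ρ∈) (member b σ∈) ρ≢1 σ≢1
      n)
    (cong₂ _*_ (cong₂ _*_ (cong₂ _*_ (sym (δ≡kronecker ρ σ)) (sym (ℕ→ℚ≡fromℕ (2 ℕ.^ (size ρ ∸ length ρ)))))
        (sym (ℕ→ℚ≡fromℕ (z ρ)))) (sym (ℕ→ℚ≡fromℕ (fallℕ n (size ρ))))))
  where
  member : ∀ a {ρ} → ρ ∈ OP a → ρ ∈ OP (size ρ)
  member a m = ∈-OP (proj₁ (∈⇒OddParts a a m))
  frakp≡ : ∀ ρ α → frakp X ρ α ≡ Orthogonality.frakpˢ ℚ-field X (IsCharTable⇒character X table) (size ρ) ρ α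
  frakp≡ ρ α = ∑-cong (SP (size ρ)) (λ {μ} _ → cong (X μ ρ *_) (Pstar≡Pˢ μ α))
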